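{- Let $a \in \mathbf{F}_q$ be nonzero, let $n\ge 1$, and let $\sqrt{a}$ be a square root of $a$ in an extension of $\mathbf{F}_q$. Let $f(x) \in \mathbf{F}_q[x]$ be a nontrivial $a$-self reciprocal monic polynomial of degree $2n$ with $f(\sqrt{a})f(-\sqrt{a}) \neq 0$, and let $r$ be the number of irreducible factors of $f(x)$ over $\mathbf{F}_q$, counted with multiplicity. Then $r$ is even if and only if $$(-1)^n a^{n(n-2)} f(\sqrt{a})\, f(-\sqrt{a})$$ is a square in $\mathbf{F}_q$.
   Context: Let $q=p^e$ be an odd prime power and $\mathbf{F}_q$ the finite field with $q$ elements. For a nonzero $a\in\mathbf{F}_q$ and a monic polynomial $f(x)=\sum_{i=0}^N b_i x^i \in \mathbf{F}_q[x]$ of degree $N$ with $f(0)\neq 0$, the $a$-reciprocal of $f$ is $\hat{f}_a(x) := \frac{x^N}{f(0)} f\left(\frac{a}{x}\right) = \frac{1}{b_0}\sum_{i=0}^N b_i a^i x^{N-i}$. A monic polynomial $f(x)$ (with $f(0)\ne 0$) is $a$-self reciprocal if $\hat{f}_a(x)=f(x)$. An $a$-self reciprocal monic polynomial of even degree $N=2m$ is called nontrivial if its constant term is $b_0=a^m$. The product $f(\sqrt{a})f(-\sqrt{a})$ always lies in $\mathbf{F}_q$. The exponent $n(n-2)$ may be negative (when $n=1$), in which case the power is taken in the multiplicative group of $\mathbf{F}_q$. -}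

module Defs where

open import Algebra.Apartness.Bundles using (HeytingCommutativeRing; HeytingField)
open import Algebra.Bundles using (CommutativeRing)
open import Algebra.Bundles.Raw using (RawRing; RawSemiring)
open import Algebra.Morphism.Structures using (module RingMorphisms)
import Algebra.Definitions.RawSemiring as RawSemiringDefinitions
open import Data.Fin.Base using (Fin)
open import Data.Integer.Base using (ℤ; +_; -[1+_])
open import Data.List.Base using (List; []; _∷_; map; foldr; applyUpTo)
open import Data.Nat.Base as ℕ using (ℕ; zero; suc; _≤_; _<_; _∸_)
open import Data.Nat.Divisibility using (_∣_)
open import Data.Nat.Primality using (Prime)
open import Data.Product.Base using (∃-syntax; ∃₂; _×_; proj₁)
open import Data.Vec.Functional using (Vector)
open import Function.Bundles using (Inverse)
open import Level using (Level; _⊔_)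
open import Relation.Binary.Bundles using (Setoid)
open import Relation.Binary.PropositionalEquality.Core using (_≡_)
import Relation.Binary.PropositionalEquality.Properties as ≡
open import Relation.Nullary.Negation.Core using (¬_)

OddPrimePower : ℕ → Set
OddPrimePower q =
  ∃₂ λ p e → Prime p × 1 ≤ e × q ≡ p ℕ.^ e × ¬ (2 ∣ q)

HasCardinality : ∀ {c ℓ} → Setoid c ℓ → ℕ → Set (c ⊔ ℓ)
HasCardinality S q = Inverse (≡.setoid (Fin q)) S

module Polynomials {c ℓ} (R : RawRing c ℓ) where

  open RawRing R

  -- The list b₀ ∷ b₁ ∷ … stands for Σ bᵢ xⁱ. Trailing zeros are allowed, so
  -- polynomials are compared by _≈ₚ_ and not by equality of lists.
  Polynomial : Set c
  Polynomial = List Carrier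

  coefficient : Polynomial → ℕ → Carrier
  coefficient []      _       = 0#
  coefficient (b ∷ f) zero    = b
  coefficient (b ∷ f) (suc i) = coefficient f i

  infix 4 _≈ₚ_

  _≈ₚ_ : Polynomial → Polynomial → Set ℓ
  f ≈ₚ g = ∀ i → coefficient f i ≈ coefficient g i

  infixl 6 _+ₚ_
  infixl 7 _*ₚ_

  _+ₚ_ : Polynomial → Polynomial → Polynomial
  []      +ₚ g       = g
  (b ∷ f) +ₚ []      = b ∷ f
  (b ∷ f) +ₚ (d ∷ g) = b + d ∷ f +ₚ g

  _*ₚ_ : Polynomial → Polynomial → Polynomial
  []      *ₚ g = []
  (b ∷ f) *ₚ g = map (b *_) g +ₚ (0# ∷ f *ₚ g)

  polynomialRawSemiring : RawSemiring c ℓ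
  polynomialRawSemiring = record
    { Carrier = Polynomial
    ; _≈_     = _≈ₚ_
    ; _+_     = _+ₚ_
    ; _*_     = _*ₚ_
    ; 0#      = []
    ; 1#      = 1# ∷ []
    }

  evaluate : Polynomial → Carrier → Carrier
  evaluate f x = foldr (λ b y → b + x * y) 0# f

  MonicOfDegree : ℕ → Polynomial → Set ℓ
  MonicOfDegree N f =
    coefficient f N ≈ 1# × (∀ i → N < i → coefficient f i ≈ 0#)

  open RawSemiringDefinitions polynomialRawSemiring
    using (Irreducible; product)

  -- A factorisation into r irreducible factors; a factor of multiplicity m is
  -- listed m times.
  record IrreducibleFactorisation (f : Polynomial) (r : ℕ) : Set (c ⊔ ℓ) where
    field
      factors            : Vector Polynomial r
      factorsIrreducible : ∀ i → Irreducible (factors i)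
      isFactorisation    : f ≈ₚ product factors

-- In a Heyting field the apartness x # 0# plays the role of x ≠ 0. It is
-- equivalent to ¬ (x ≈ 0#) as soon as invertibility is decidable, in
-- particular in every finite field.
module FieldNotions {c ℓ₁ ℓ₂} (F : HeytingField c ℓ₁ ℓ₂) where

  open HeytingField F public
  open HeytingCommutativeRing heytingCommutativeRing public
    using (commutativeRing)
  open CommutativeRing commutativeRing public
    using (rawRing)
  open RawRing rawRing public using (rawSemiring)
  open RawSemiringDefinitions rawSemiring public using (_^_)
  open Polynomials rawRing public

  -- #⇒invertible inverts x - 0#, which is equal to x.
  inverse : (x : Carrier) → x # 0# → Carrier
  inverse x x#0 = proj₁ (#⇒invertible x#0)

  zpow : (x : Carrier) → x # 0# → ℤ → Carrier
  zpow x x#0 (+ k)    = x ^ k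
  zpow x x#0 -[1+ k ] = inverse x x#0 ^ suc k

  -- The coefficient of xʲ in (1 / b₀) Σ_{i ≤ N} bᵢ aⁱ xᴺ⁻ⁱ.
  reciprocal : Carrier → (N : ℕ) (f : Polynomial) →
               coefficient f 0 # 0# → Polynomial
  reciprocal a N f b₀#0 =
    applyUpTo
      (λ j → inverse (coefficient f 0) b₀#0 *
             (coefficient f (N ∸ j) * a ^ (N ∸ j)))
      (suc N)

  record SelfReciprocal (a : Carrier) (N : ℕ) (f : Polynomial)
         : Set (ℓ₁ ⊔ ℓ₂) where
    field
      monic           : MonicOfDegree N f
      constantNonzero : coefficient f 0 # 0#
      reciprocalEqual : reciprocal a N f constantNonzero ≈ₚ f

  record NontrivialSelfReciprocal (a : Carrier) (m : ℕ) (f : Polynomial)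
         : Set (ℓ₁ ⊔ ℓ₂) where
    field
      selfReciprocal : SelfReciprocal a (2 ℕ.* m) f
      constantTerm   : coefficient f 0 ≈ a ^ m

record FieldExtension {c ℓ₁ ℓ₂} (F : HeytingField c ℓ₁ ℓ₂)
                      (c′ ℓ₁′ ℓ₂′ : Level)
       : Set (c ⊔ ℓ₁ ⊔ ℓ₂ ⊔ Level.suc (c′ ⊔ ℓ₁′ ⊔ ℓ₂′)) where
  private module F = FieldNotions F
  field
    extensionField : HeytingField c′ ℓ₁′ ℓ₂′
  open FieldNotions extensionField public
  field
    ι : F.Carrier → Carrier
    ι-isRingMonomorphism :
      RingMorphisms.IsRingMonomorphism F.rawRing rawRing ι

  evaluateAt : F.Polynomial → Carrier → Carrier
  evaluateAt f x = evaluate (map ι f) x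

  IsSquareInBase : Carrier → Set (c ⊔ ℓ₁′)
  IsSquareInBase x = ∃[ y ] ι (y F.* y) ≈ x

-- Let N(f) = f(√a) f(-√a). Since (-1)^n a^(n(n-2)) and (-a)^n differ by a square,
-- the question is whether (-a)^n N(f) is a square. If p is an irreducible factor
-- of f and α a root of p in L = F[x]/p, then a/α is a root of f, hence of some
-- factor g of f, and g is a constant times the reversal x^d p(a/x), d = deg p.
--
-- If g and p are different factors, (-a)^d N(p g) is a square. If g = p, then p is
-- itself self-reciprocal, N(p) ≠ 0 forces d = 2m, and (-a)^m N(p) is not a square:
-- with φ the Frobenius map the roots of p are β_i = φ^i(α), i < 2m, and
-- β_i β_(m+i) = a. Thus (-a)^m N(p) = ((-a)^m c Δ)² with c the leading coefficient
-- of p and Δ = ∏_(i<m) (β_i - β_(m+i)), and φ(Δ) = -Δ ≠ Δ, so that the square root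
-- is not in F. Dividing by p or p g leaves a self-reciprocal polynomial, and
-- induction on r concludes, as a product of two nonsquares of F is a square.

module Submission where

open import Algebra.Apartness.Bundles using (HeytingField)
open import Algebra.Bundles using (CommutativeRing; CommutativeMonoid)
open import Algebra.Bundles.Raw using (RawSemiring)
import Algebra.Consequences.Setoid as Consequences
open import Algebra.Core using (Op₁; Op₂)
import Algebra.Definitions as AlgebraDefinitions
import Algebra.Definitions.RawMagma as RawMagmaDefinitions
import Algebra.Definitions.RawSemiring as RawSemiringDefinitions
open import Algebra.Morphism.Structures using (module RingMorphisms)
import Algebra.Properties.CommutativeMonoid.Sum as Sum
import Algebra.Properties.CommutativeSemigroup as CommutativeSemigroupProperties
import Algebra.Properties.CommutativeSemiring.Exp as Exp
import Algebra.Properties.Ring as RingProperties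
import Algebra.Properties.Semiring.Mult as Mult
import Algebra.Properties.Semiring.Mult.TCOptimised as SemiringMult
import Algebra.Solver.Ring as RingSolver
open import Algebra.Solver.Ring.AlmostCommutativeRing using (fromCommutativeRing; _-Raw-AlmostCommutative⟶_)
open import Data.Fin.Base using (Fin; zero; suc)
import Data.Fin.Base as Fin
open import Data.Fin.Permutation using (Permutation; permutation)
import Data.Fin.Properties as Fin
open import Data.Integer.Base as ℤ using (ℤ; +_; -[1+_])
import Data.Integer.Properties as ℤ
open import Data.List.Base using (List; []; _∷_; map; foldr; applyUpTo)
open import Data.Maybe.Base using (Maybe; just; nothing)
open import Data.Nat.Base as ℕ using (ℕ; zero; suc; _≤_; z≤n; s≤s; _<_; _∸_)
import Data.Nat.DivMod as ℕ
open import Data.Nat.Divisibility using (_∣_; divides)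
import Data.Nat.Divisibility as ℕ
open import Data.Nat.Induction using (<-rec)
import Data.Nat.Properties as ℕ
open import Data.Nat.Solver using (module +-*-Solver)
open import Data.Product.Base using (_×_; _,_; proj₁; proj₂; ∃)
open import Data.Sum.Base using (inj₁; inj₂; _⊎_; [_,_]′)
open import Data.Vec.Functional using (Vector; replicate; removeAt)
open import Defs
open import Function.Base using (_∘_; id)
open import Function.Bundles using (Inverse; _⇔_; mk⇔)
open import Level using (Level; _⊔_)
open import Relation.Binary.Bundles using (Setoid)
open import Relation.Binary.Core using (Rel)
open import Relation.Binary.Definitions using (Decidable; Tri; tri<; tri≈; tri>)
open import Relation.Binary.PropositionalEquality.Core as ≡ using (_≡_; _≢_)
import Relation.Binary.Reasoning.Setoid as SetoidReasoning
open import Relation.Binary.Structures using (IsEquivalence)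
open import Relation.Nullary.Decidable.Core using (yes; no; map′)
open import Relation.Nullary.Negation.Core using (¬_; contradiction)

-- Frobenius is studied on a domain `L` that is never enumerated, so the q-th power map has to be
-- controlled by counting the roots of polynomials over `L` among the q elements of F. Its
-- additivity is obtained in this way, and so is the fact that its fixed points lie in F.
--
-- The product f(√a) f(-√a) is computed as the norm u² - a v² of f(s) = u + v s in the formal ring
-- F[s] with s² = a, whether or not a is a square. Hence N(f) is an element of F from the start, it
-- is multiplicative and compatible with base change, and the field containing √a appears only when
-- the result is transferred to it.
--
-- The induction cannot stay within monic polynomials equal to their own reciprocal, because
-- irreducible factors and their reversals match only up to constants. It runs over polynomials f
-- with x^N f(a/x) = k f for some constant k. A constant κ multiplies N by κ², which does not affect
-- whether a value is a square.

private
  variable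
    c ℓ c′ ℓ′ : Level

-- A ring solver with integer coefficients

module IntegerCoefficients {c ℓ} (R : CommutativeRing c ℓ) where

  open CommutativeRing R
  open RingProperties ring
  open SemiringMult semiring renaming (_×_ to _·_)
  open SetoidReasoning setoid

  private
    ⟦_⟧ : ℤ → Carrier
    ⟦ + n ⟧      = n · 1#
    ⟦ -[1+ n ] ⟧ = - (suc n · 1#)

    -- Integer addition with mixed signs computes `⊖`, so additivity of the map from ℤ reduces to
    -- this case. The recursion inserts 1 - 1 in order to cancel one unit from both arguments.
    ⊖-homo : ∀ m n → ⟦ m ℤ.⊖ n ⟧ ≈ m · 1# + - (n · 1#)
    ⊖-homo m zero = begin
      m · 1#          ≈⟨ +-identityʳ _ ⟨
      m · 1# + 0#     ≈⟨ +-congˡ -0#≈0# ⟨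
      m · 1# + - 0#   ∎
    ⊖-homo zero (suc n) = sym (+-identityˡ _)
    ⊖-homo (suc m) (suc n) = begin
      ⟦ suc m ℤ.⊖ suc n ⟧                          ≡⟨ ≡.cong ⟦_⟧ (ℤ.[1+m]⊖[1+n]≡m⊖n m n) ⟩
      ⟦ m ℤ.⊖ n ⟧                                  ≈⟨ ⊖-homo m n ⟩
      m · 1# + - (n · 1#)                          ≈⟨ +-congʳ (+-identityʳ _) ⟨
      (m · 1# + 0#) + - (n · 1#)                   ≈⟨ +-congʳ (+-congˡ (-‿inverseʳ 1#)) ⟨
      (m · 1# + (1# + - 1#)) + - (n · 1#)          ≈⟨ +-congʳ (+-assoc _ _ _) ⟨
      ((m · 1# + 1#) + - 1#) + - (n · 1#)          ≈⟨ +-assoc _ _ _ ⟩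
      (m · 1# + 1#) + (- 1# + - (n · 1#))          ≈⟨ +-cong (+-comm _ _) (-‿+-comm 1# (n · 1#)) ⟩
      (1# + m · 1#) + - (1# + n · 1#)              ≈⟨ +-cong (1+× m 1#) (-‿cong (1+× n 1#)) ⟨
      suc m · 1# + - (suc n · 1#)                  ∎

    +-homo′ : ∀ i j → ⟦ i ℤ.+ j ⟧ ≈ ⟦ i ⟧ + ⟦ j ⟧
    +-homo′ (+ m)    (+ n)    = ×-homo-+ 1# m n
    +-homo′ (+ m)    -[1+ n ] = ⊖-homo m (suc n)
    +-homo′ -[1+ m ] (+ n)    = trans (⊖-homo n (suc m)) (+-comm _ _)
    +-homo′ -[1+ m ] -[1+ n ] = begin
      - (suc (suc (m ℕ.+ n)) · 1#)           ≡⟨ ≡.cong (λ k → - (suc k · 1#)) (ℕ.+-suc m n) ⟨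
      - ((suc m ℕ.+ suc n) · 1#)             ≈⟨ -‿cong (×-homo-+ 1# (suc m) (suc n)) ⟩
      - (suc m · 1# + suc n · 1#)            ≈⟨ -‿+-comm (suc m · 1#) (suc n · 1#) ⟨
      - (suc m · 1#) + - (suc n · 1#)        ∎

    neg-homo : ∀ i → ⟦ ℤ.- i ⟧ ≈ - ⟦ i ⟧
    neg-homo (+ zero)  = sym -0#≈0#
    neg-homo (+ suc n) = refl
    neg-homo -[1+ n ]  = sym (-‿involutive _)

    *-homo⁺ : ∀ m n → ⟦ + m ℤ.* + n ⟧ ≈ ⟦ + m ⟧ * ⟦ + n ⟧
    *-homo⁺ m n = begin
      ⟦ + m ℤ.* + n ⟧     ≡⟨ ≡.cong ⟦_⟧ (ℤ.pos-* m n) ⟨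
      (m ℕ.* n) · 1#      ≈⟨ ×1-homo-* m n ⟩
      m · 1# * n · 1#     ∎

    *-homo′ : ∀ i j → ⟦ i ℤ.* j ⟧ ≈ ⟦ i ⟧ * ⟦ j ⟧
    *-homo′ (+ m) (+ n) = *-homo⁺ m n
    *-homo′ (+ m) -[1+ n ] = begin
      ⟦ + m ℤ.* -[1+ n ] ⟧            ≡⟨ ≡.cong ⟦_⟧ (ℤ.neg-distribʳ-* (+ m) (+ suc n)) ⟨
      ⟦ ℤ.- (+ m ℤ.* + suc n) ⟧       ≈⟨ neg-homo (+ m ℤ.* + suc n) ⟩
      - ⟦ + m ℤ.* + suc n ⟧           ≈⟨ -‿cong (*-homo⁺ m (suc n)) ⟩
      - (m · 1# * suc n · 1#)         ≈⟨ -‿distribʳ-* _ _ ⟩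
      m · 1# * - (suc n · 1#)         ∎
    *-homo′ -[1+ m ] (+ n) = begin
      ⟦ -[1+ m ] ℤ.* + n ⟧            ≡⟨ ≡.cong ⟦_⟧ (ℤ.neg-distribˡ-* (+ suc m) (+ n)) ⟨
      ⟦ ℤ.- (+ suc m ℤ.* + n) ⟧       ≈⟨ neg-homo (+ suc m ℤ.* + n) ⟩
      - ⟦ + suc m ℤ.* + n ⟧           ≈⟨ -‿cong (*-homo⁺ (suc m) n) ⟩
      - (suc m · 1# * n · 1#)         ≈⟨ -‿distribˡ-* _ _ ⟩
      - (suc m · 1#) * n · 1#         ∎
    *-homo′ -[1+ m ] -[1+ n ] = begin
      ⟦ + suc m ℤ.* + suc n ⟧                 ≈⟨ *-homo⁺ (suc m) (suc n) ⟩
      suc m · 1# * suc n · 1#                 ≈⟨ -‿involutive _ ⟨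
      - - (suc m · 1# * suc n · 1#)           ≈⟨ -‿cong (-‿distribˡ-* _ _) ⟩
      - (- (suc m · 1#) * suc n · 1#)         ≈⟨ -‿distribʳ-* _ _ ⟩
      - (suc m · 1#) * - (suc n · 1#)         ∎

    morphism : ℤ.+-*-rawRing -Raw-AlmostCommutative⟶ fromCommutativeRing R
    morphism = record
      { ⟦_⟧    = ⟦_⟧
      ; +-homo = +-homo′
      ; *-homo = *-homo′
      ; -‿homo = neg-homo
      ; 0-homo = refl
      ; 1-homo = refl
      }

    -- Coefficients are compared as integers. That different integers may coincide in positive
    -- characteristic goes undetected, but the identities solved below hold in every commutative
    -- ring.
    _≟′_ : ∀ i j → Maybe (⟦ i ⟧ ≈ ⟦ j ⟧)
    i ≟′ j with i ℤ.≟ j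
    ... | yes i≡j = just (reflexive (≡.cong ⟦_⟧ i≡j))
    ... | no  _   = nothing

  open RingSolver ℤ.+-*-rawRing (fromCommutativeRing R) morphism _≟′_ public
    using (solve; _:+_; _:*_; :-_; _:-_; _:=_; con; Polynomial)

-- Commutative rings, homomorphisms and finite products

module _ {A : Set c} {_≈_ : Rel A ℓ} (isEquivalence : IsEquivalence _≈_)
         {_+_ _*_ : Op₂ A} { -_ : Op₁ A} {0# 1# : A} where
  open AlgebraDefinitions _≈_
  private
    setoid : Setoid c ℓ
    setoid = record { isEquivalence = isEquivalence }
    open Consequences setoid

  -- Shared by the polynomial ring, the quadratic ring and the quotient ring: commutativity supplies
  -- the mirrored half of each law.
  commutativeRingʳ :
    Congruent₂ _+_ → Congruent₂ _*_ → Congruent₁ -_ →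
    Associative _+_ → Commutative _+_ → LeftIdentity 0# _+_ → LeftInverse 0# -_ _+_ →
    Associative _*_ → Commutative _*_ → LeftIdentity 1# _*_ → _*_ DistributesOverʳ _+_ →
    CommutativeRing c ℓ
  commutativeRingʳ +-cong *-cong -‿cong +-assoc +-comm +-idˡ +-invˡ *-assoc *-comm *-idˡ distribʳ = record
    { isCommutativeRing = record
      { isRing = record
        { +-isAbelianGroup = record
          { isGroup = record
            { isMonoid = record
              { isSemigroup = record
                { isMagma = record { isEquivalence = isEquivalence ; ∙-cong = +-cong }
                ; assoc = +-assoc
                }
              ; identity = comm∧idˡ⇒id +-comm +-idˡ
              }
            ; inverse = comm∧invˡ⇒inv +-comm +-invˡ
            ; ⁻¹-cong = -‿cong
            }
          ; comm = +-comm
          }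
        ; *-cong = *-cong
        ; *-assoc = *-assoc
        ; *-identity = comm∧idˡ⇒id *-comm *-idˡ
        ; distrib = comm∧distrʳ⇒distr +-cong *-comm distribʳ
        }
      ; *-comm = *-comm
      }
    }

-- Preservation of zero and of negatives is forced by additivity. Leaving both out of the fields
-- shortens the many instances: evaluations, embeddings, Frobenius and its iterates.
record RingHom (R : CommutativeRing c ℓ) (S : CommutativeRing c′ ℓ′)
               : Set (c ⊔ ℓ ⊔ c′ ⊔ ℓ′) where
  private
    module R = CommutativeRing R
    module S = CommutativeRing S
  field
    ⟦_⟧     : R.Carrier → S.Carrier
    ⟦⟧-cong : ∀ {x y} → x R.≈ y → ⟦ x ⟧ S.≈ ⟦ y ⟧
    +-homo  : ∀ x y → ⟦ x R.+ y ⟧ S.≈ ⟦ x ⟧ S.+ ⟦ y ⟧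
    *-homo  : ∀ x y → ⟦ x R.* y ⟧ S.≈ ⟦ x ⟧ S.* ⟦ y ⟧
    1#-homo : ⟦ R.1# ⟧ S.≈ S.1#

  open SetoidReasoning S.setoid
  open RingProperties S.ring

  0#-homo : ⟦ R.0# ⟧ S.≈ S.0#
  0#-homo = x+x≈x⇒x≈0 ⟦ R.0# ⟧ (begin
    ⟦ R.0# ⟧ S.+ ⟦ R.0# ⟧   ≈⟨ +-homo R.0# R.0# ⟨
    ⟦ R.0# R.+ R.0# ⟧       ≈⟨ ⟦⟧-cong (R.+-identityʳ R.0#) ⟩
    ⟦ R.0# ⟧                ∎)

  -‿homo : ∀ x → ⟦ R.- x ⟧ S.≈ S.- ⟦ x ⟧
  -‿homo x = +-inverseˡ-unique ⟦ R.- x ⟧ ⟦ x ⟧ (begin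
    ⟦ R.- x ⟧ S.+ ⟦ x ⟧     ≈⟨ +-homo (R.- x) x ⟨
    ⟦ R.- x R.+ x ⟧         ≈⟨ ⟦⟧-cong (R.-‿inverseˡ x) ⟩
    ⟦ R.0# ⟧                ≈⟨ 0#-homo ⟩
    S.0#                    ∎)

idHom : (R : CommutativeRing c ℓ) → RingHom R R
idHom R = record
  { ⟦_⟧ = λ x → x ; ⟦⟧-cong = λ p → p
  ; +-homo = λ _ _ → R.refl ; *-homo = λ _ _ → R.refl ; 1#-homo = R.refl }
  where module R = CommutativeRing R

module Product (R : CommutativeRing c ℓ) where
  open CommutativeRing R
  open Sum *-commutativeMonoid public
    renaming ( sum to product; sum-cong-≋ to product-cong; sum-remove to product-remove
             ; sum-permute to product-permute; sum-init-last to product-init-last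
             ; ∑-distrib-+ to product-* )
    using ()

module _ {R : CommutativeRing c ℓ} {S : CommutativeRing c′ ℓ′} (h : RingHom R S) where
  open RingHom h
  private
    module S = CommutativeRing S

  product-homo : ∀ {n} (t : Vector _ n) →
                 ⟦ Product.product R t ⟧ S.≈ Product.product S (⟦_⟧ ∘ t)
  product-homo {zero}  t = 1#-homo
  product-homo {suc n} t = S.trans (*-homo _ _) (S.*-congˡ (product-homo (t ∘ suc)))

-- The polynomial ring

module PolynomialRing (R : CommutativeRing c ℓ) where

  open CommutativeRing R
  open RingProperties ring
  open CommutativeSemigroupProperties (CommutativeMonoid.commutativeSemigroup +-commutativeMonoid)
    using (interchange)
  open Polynomials rawRing public
  private module ≈-Reasoning = SetoidReasoning setoid

  -- The coefficientwise equality in a form from which Agda can infer f and g.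
  infix 4 _≋_
  record _≋_ (f g : Polynomial) : Set ℓ where
    constructor pointwise
    field
      at : f ≈ₚ g
  open _≋_ public

  ≋-isEquivalence : IsEquivalence _≋_
  ≋-isEquivalence = record
    { refl  = pointwise λ _ → refl
    ; sym   = λ p → pointwise λ i → sym (at p i)
    ; trans = λ p q → pointwise λ i → trans (at p i) (at q i)
    }

  ≋-setoid : Setoid c ℓ
  ≋-setoid = record { isEquivalence = ≋-isEquivalence }

  private
    module ≋ = IsEquivalence ≋-isEquivalence
    module ≋-Reasoning = SetoidReasoning ≋-setoid

  infixl 7 _·_
  _·_ : Carrier → Polynomial → Polynomial
  b · f = map (b *_) f

  coefficient-+ : ∀ f g i → coefficient (f +ₚ g) i ≈ coefficient f i + coefficient g i
  coefficient-+ []      g       i       = sym (+-identityˡ _)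
  coefficient-+ (b ∷ f) []      i       = sym (+-identityʳ _)
  coefficient-+ (b ∷ f) (d ∷ g) zero    = refl
  coefficient-+ (b ∷ f) (d ∷ g) (suc i) = coefficient-+ f g i

  coefficient-· : ∀ b f i → coefficient (b · f) i ≈ b * coefficient f i
  coefficient-· b []      i       = sym (zeroʳ b)
  coefficient-· b (d ∷ f) zero    = refl
  coefficient-· b (d ∷ f) (suc i) = coefficient-· b f i

  -ₚ_ : Polynomial → Polynomial
  -ₚ f = map -_ f

  coefficient-neg : ∀ f i → coefficient (-ₚ f) i ≈ - coefficient f i
  coefficient-neg []      i       = sym -0#≈0#
  coefficient-neg (b ∷ f) zero    = refl
  coefficient-neg (b ∷ f) (suc i) = coefficient-neg f i

  ∷-cong : ∀ {b d f g} → b ≈ d → f ≋ g → b ∷ f ≋ d ∷ g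
  ∷-cong p q = pointwise λ { zero → p ; (suc i) → at q i }

  0∷[]≋[] : ∀ {b f} → b ≈ 0# → f ≋ [] → b ∷ f ≋ []
  0∷[]≋[] p q = pointwise λ { zero → p ; (suc i) → at q i }

  tail-≋[] : ∀ {b f} → b ∷ f ≋ [] → f ≋ []
  tail-≋[] p = pointwise (at p ∘ suc)

  +ₚ-cong : ∀ {f f′ g g′} → f ≋ f′ → g ≋ g′ → f +ₚ g ≋ f′ +ₚ g′
  +ₚ-cong {f} {f′} {g} {g′} p q = pointwise λ i →
    trans (coefficient-+ f g i) (trans (+-cong (at p i) (at q i)) (sym (coefficient-+ f′ g′ i)))

  -ₚ-cong : ∀ {f g} → f ≋ g → -ₚ f ≋ -ₚ g
  -ₚ-cong {f} {g} p = pointwise λ i →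
    trans (coefficient-neg f i) (trans (-‿cong (at p i)) (sym (coefficient-neg g i)))

  +ₚ-assoc : ∀ f g h → (f +ₚ g) +ₚ h ≋ f +ₚ (g +ₚ h)
  +ₚ-assoc f g h = pointwise λ i → let open ≈-Reasoning in begin
    coefficient (f +ₚ g +ₚ h) i                                 ≈⟨ coefficient-+ (f +ₚ g) h i ⟩
    coefficient (f +ₚ g) i + coefficient h i                    ≈⟨ +-congʳ (coefficient-+ f g i) ⟩
    coefficient f i + coefficient g i + coefficient h i         ≈⟨ +-assoc _ _ _ ⟩
    coefficient f i + (coefficient g i + coefficient h i)       ≈⟨ +-congˡ (coefficient-+ g h i) ⟨
    coefficient f i + coefficient (g +ₚ h) i                    ≈⟨ coefficient-+ f (g +ₚ h) i ⟨
    coefficient (f +ₚ (g +ₚ h)) i                               ∎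

  +ₚ-comm : ∀ f g → f +ₚ g ≋ g +ₚ f
  +ₚ-comm f g = pointwise λ i →
    trans (coefficient-+ f g i) (trans (+-comm _ _) (sym (coefficient-+ g f i)))

  +ₚ-identityʳ : ∀ f → f +ₚ [] ≋ f
  +ₚ-identityʳ f = +ₚ-comm f []

  +ₚ-inverseˡ : ∀ f → -ₚ f +ₚ f ≋ []
  +ₚ-inverseˡ f = pointwise λ i →
    trans (coefficient-+ (-ₚ f) f i) (trans (+-congʳ (coefficient-neg f i)) (-‿inverseˡ _))

  +ₚ-interchange : ∀ f g h k → (f +ₚ g) +ₚ (h +ₚ k) ≋ (f +ₚ h) +ₚ (g +ₚ k)
  +ₚ-interchange f g h k = pointwise λ i → let open ≈-Reasoning in begin
    coefficient ((f +ₚ g) +ₚ (h +ₚ k)) i          ≈⟨ coefficient-+ (f +ₚ g) (h +ₚ k) i ⟩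
    coefficient (f +ₚ g) i + coefficient (h +ₚ k) i
                                                  ≈⟨ +-cong (coefficient-+ f g i) (coefficient-+ h k i) ⟩
    _                                             ≈⟨ interchange _ _ _ _ ⟩
    (coefficient f i + coefficient h i) + (coefficient g i + coefficient k i)
                                                  ≈⟨ +-cong (coefficient-+ f h i) (coefficient-+ g k i) ⟨
    coefficient (f +ₚ h) i + coefficient (g +ₚ k) i
                                                  ≈⟨ coefficient-+ (f +ₚ h) (g +ₚ k) i ⟨
    coefficient ((f +ₚ h) +ₚ (g +ₚ k)) i          ∎

  ·-cong : ∀ {b d f g} → b ≈ d → f ≋ g → b · f ≋ d · g
  ·-cong {b} {d} {f} {g} p q = pointwise λ i →
    trans (coefficient-· b f i) (trans (*-cong p (at q i)) (sym (coefficient-· d g i)))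

  ·-distribˡ : ∀ b f g → b · (f +ₚ g) ≋ b · f +ₚ b · g
  ·-distribˡ b f g = pointwise λ i → let open ≈-Reasoning in begin
    coefficient (b · (f +ₚ g)) i                     ≈⟨ coefficient-· b (f +ₚ g) i ⟩
    b * coefficient (f +ₚ g) i                       ≈⟨ *-congˡ (coefficient-+ f g i) ⟩
    b * (coefficient f i + coefficient g i)          ≈⟨ distribˡ _ _ _ ⟩
    b * coefficient f i + b * coefficient g i        ≈⟨ +-cong (coefficient-· b f i) (coefficient-· b g i) ⟨
    coefficient (b · f) i + coefficient (b · g) i    ≈⟨ coefficient-+ (b · f) (b · g) i ⟨
    coefficient (b · f +ₚ b · g) i                   ∎

  ·-distribʳ : ∀ b d f → (b + d) · f ≋ b · f +ₚ d · f
  ·-distribʳ b d f = pointwise λ i → let open ≈-Reasoning in begin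
    coefficient ((b + d) · f) i                      ≈⟨ coefficient-· (b + d) f i ⟩
    (b + d) * coefficient f i                        ≈⟨ distribʳ _ _ _ ⟩
    b * coefficient f i + d * coefficient f i        ≈⟨ +-cong (coefficient-· b f i) (coefficient-· d f i) ⟨
    coefficient (b · f) i + coefficient (d · f) i    ≈⟨ coefficient-+ (b · f) (d · f) i ⟨
    coefficient (b · f +ₚ d · f) i                   ∎

  ·-assoc : ∀ b d f → (b * d) · f ≋ b · (d · f)
  ·-assoc b d f = pointwise λ i → let open ≈-Reasoning in begin
    coefficient ((b * d) · f) i    ≈⟨ coefficient-· (b * d) f i ⟩
    (b * d) * coefficient f i      ≈⟨ *-assoc _ _ _ ⟩
    b * (d * coefficient f i)      ≈⟨ *-congˡ (coefficient-· d f i) ⟨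
    b * coefficient (d · f) i      ≈⟨ coefficient-· b (d · f) i ⟨
    coefficient (b · (d · f)) i    ∎

  ·-identityˡ : ∀ f → 1# · f ≋ f
  ·-identityˡ f = pointwise λ i → trans (coefficient-· 1# f i) (*-identityˡ _)

  ·-zeroˡ : ∀ {b} f → b ≈ 0# → b · f ≋ []
  ·-zeroˡ f p = pointwise λ i → trans (coefficient-· _ f i) (trans (*-congʳ p) (zeroˡ _))

  *ₚ-zeroʳ : ∀ f → f *ₚ [] ≋ []
  *ₚ-zeroʳ []      = ≋.refl
  *ₚ-zeroʳ (b ∷ f) = 0∷[]≋[] refl (*ₚ-zeroʳ f)

  -- Because of trailing zeros, `f ≋ []` does not make `f` the empty list. This case is what
  -- congruence in the left factor needs when the two lists differ in length.
  *ₚ-zeroˡ : ∀ {f} → f ≋ [] → ∀ g → f *ₚ g ≋ []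
  *ₚ-zeroˡ {[]}    p g = ≋.refl
  *ₚ-zeroˡ {b ∷ f} p g = +ₚ-cong (·-zeroˡ g (at p 0)) (0∷[]≋[] refl (*ₚ-zeroˡ (tail-≋[] p) g))

  *ₚ-congˡ : ∀ f {g g′} → g ≋ g′ → f *ₚ g ≋ f *ₚ g′
  *ₚ-congˡ []      q = ≋.refl
  *ₚ-congˡ (b ∷ f) q = +ₚ-cong (·-cong refl q) (∷-cong refl (*ₚ-congˡ f q))

  *ₚ-congʳ : ∀ {f f′} g → f ≋ f′ → f *ₚ g ≋ f′ *ₚ g
  *ₚ-congʳ {[]}    {f′}    g p = ≋.sym (*ₚ-zeroˡ (≋.sym p) g)
  *ₚ-congʳ {b ∷ f} {[]}    g p = *ₚ-zeroˡ p g
  *ₚ-congʳ {b ∷ f} {d ∷ e} g p =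
    +ₚ-cong (·-cong {f = g} (at p 0) ≋.refl) (∷-cong refl (*ₚ-congʳ {f} {e} g (pointwise (at p ∘ suc))))

  *ₚ-cong : ∀ {f f′ g g′} → f ≋ f′ → g ≋ g′ → f *ₚ g ≋ f′ *ₚ g′
  *ₚ-cong {f′ = f′} {g} p q = ≋.trans (*ₚ-congʳ g p) (*ₚ-congˡ f′ q)

  0∷-* : ∀ f g → (0# ∷ f) *ₚ g ≋ 0# ∷ f *ₚ g
  0∷-* f g = +ₚ-cong (·-zeroˡ g refl) ≋.refl

  0∷-+ : ∀ f g → 0# ∷ (f +ₚ g) ≋ (0# ∷ f) +ₚ (0# ∷ g)
  0∷-+ f g = ∷-cong (sym (+-identityˡ 0#)) ≋.refl

  *ₚ-distribʳ : ∀ h f g → (f +ₚ g) *ₚ h ≋ f *ₚ h +ₚ g *ₚ h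
  *ₚ-distribʳ h []      g       = ≋.refl
  *ₚ-distribʳ h (b ∷ f) []      = ≋.sym (+ₚ-identityʳ _)
  *ₚ-distribʳ h (b ∷ f) (d ∷ g) = let open ≋-Reasoning in begin
    (b + d) · h +ₚ (0# ∷ (f +ₚ g) *ₚ h)
      ≈⟨ +ₚ-cong (·-distribʳ b d h) (≋.trans (∷-cong refl (*ₚ-distribʳ h f g)) (0∷-+ (f *ₚ h) (g *ₚ h))) ⟩
    (b · h +ₚ d · h) +ₚ ((0# ∷ f *ₚ h) +ₚ (0# ∷ g *ₚ h))
      ≈⟨ +ₚ-interchange (b · h) (d · h) (0# ∷ f *ₚ h) (0# ∷ g *ₚ h) ⟩
    (b · h +ₚ (0# ∷ f *ₚ h)) +ₚ (d · h +ₚ (0# ∷ g *ₚ h)) ∎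

  ·-*ₚ : ∀ b f g → (b · f) *ₚ g ≋ b · (f *ₚ g)
  ·-*ₚ b []      g = ≋.refl
  ·-*ₚ b (d ∷ f) g = let open ≋-Reasoning in begin
    (b * d) · g +ₚ (0# ∷ (b · f) *ₚ g)          ≈⟨ +ₚ-cong (·-assoc b d g) (∷-cong (sym (zeroʳ b)) (·-*ₚ b f g)) ⟩
    b · (d · g) +ₚ b · (0# ∷ f *ₚ g)            ≈⟨ ·-distribˡ b (d · g) (0# ∷ f *ₚ g) ⟨
    b · (d · g +ₚ (0# ∷ f *ₚ g))                ∎

  *ₚ-assoc : ∀ f g h → (f *ₚ g) *ₚ h ≋ f *ₚ (g *ₚ h)
  *ₚ-assoc []      g h = ≋.refl
  *ₚ-assoc (b ∷ f) g h = let open ≋-Reasoning in begin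
    (b · g +ₚ (0# ∷ f *ₚ g)) *ₚ h               ≈⟨ *ₚ-distribʳ h (b · g) _ ⟩
    (b · g) *ₚ h +ₚ (0# ∷ f *ₚ g) *ₚ h          ≈⟨ +ₚ-cong (·-*ₚ b g h) (0∷-* (f *ₚ g) h) ⟩
    b · (g *ₚ h) +ₚ (0# ∷ (f *ₚ g) *ₚ h)        ≈⟨ +ₚ-cong ≋.refl (∷-cong refl (*ₚ-assoc f g h)) ⟩
    b · (g *ₚ h) +ₚ (0# ∷ f *ₚ (g *ₚ h))        ∎

  -- Multiplication recurses on its left argument; the mirrored recursion on the right argument is
  -- the inductive step of commutativity.
  *ₚ-∷ : ∀ f d g → f *ₚ (d ∷ g) ≋ d · f +ₚ (0# ∷ f *ₚ g)
  *ₚ-∷ []      d g = ≋.sym (0∷[]≋[] refl ≋.refl)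
  *ₚ-∷ (b ∷ f) d g = ∷-cong (+-congʳ (*-comm b d)) (let open ≋-Reasoning in begin
    b · g +ₚ f *ₚ (d ∷ g)                        ≈⟨ +ₚ-cong ≋.refl (*ₚ-∷ f d g) ⟩
    b · g +ₚ (d · f +ₚ (0# ∷ f *ₚ g))            ≈⟨ +ₚ-assoc (b · g) (d · f) _ ⟨
    (b · g +ₚ d · f) +ₚ (0# ∷ f *ₚ g)            ≈⟨ +ₚ-cong (+ₚ-comm (b · g) (d · f)) ≋.refl ⟩
    (d · f +ₚ b · g) +ₚ (0# ∷ f *ₚ g)            ≈⟨ +ₚ-assoc (d · f) (b · g) _ ⟩
    d · f +ₚ (b · g +ₚ (0# ∷ f *ₚ g))            ∎)

  *ₚ-comm : ∀ f g → f *ₚ g ≋ g *ₚ f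
  *ₚ-comm []      g = ≋.sym (*ₚ-zeroʳ g)
  *ₚ-comm (b ∷ f) g = ≋.trans (+ₚ-cong ≋.refl (∷-cong refl (*ₚ-comm f g))) (≋.sym (*ₚ-∷ g b f))

  constant-* : ∀ b f → (b ∷ []) *ₚ f ≋ b · f
  constant-* b f = ≋.trans (+ₚ-cong ≋.refl (0∷[]≋[] refl ≋.refl)) (+ₚ-identityʳ _)

  *ₚ-identityˡ : ∀ f → (1# ∷ []) *ₚ f ≋ f
  *ₚ-identityˡ f = ≋.trans (constant-* 1# f) (·-identityˡ f)

  -- A bound on the degree in place of the degree: over a general ring it may be undecidable whether
  -- a leading coefficient vanishes. The bound is strict, so that the zero polynomial is the one
  -- below 0.
  Below : ℕ → Polynomial → Set ℓ
  Below k f = ∀ i → k ≤ i → coefficient f i ≈ 0#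

  Below-cong : ∀ {k f g} → f ≋ g → Below k f → Below k g
  Below-cong p f<k i k≤i = trans (sym (at p i)) (f<k i k≤i)

  Below-mono : ∀ {k l f} → k ≤ l → Below k f → Below l f
  Below-mono k≤l f<k i l≤i = f<k i (ℕ.≤-trans k≤l l≤i)

  Below-lower : ∀ {k} f → Below (suc k) f → coefficient f k ≈ 0# → Below k f
  Below-lower f f≤k fₖ≈0 i k≤i with ℕ.m≤n⇒m<n∨m≡n k≤i
  ... | inj₁ k<i     = f≤k i k<i
  ... | inj₂ ≡.refl = fₖ≈0

  Below-0⇒≋[] : ∀ {f} → Below 0 f → f ≋ []
  Below-0⇒≋[] f<0 = pointwise λ i → f<0 i z≤n

  Below-+ₚ : ∀ {k} f g → Below k f → Below k g → Below k (f +ₚ g)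
  Below-+ₚ f g f<k g<k i k≤i =
    trans (coefficient-+ f g i) (trans (+-cong (f<k i k≤i) (g<k i k≤i)) (+-identityʳ 0#))

  Below-· : ∀ {k} b f → Below k f → Below k (b · f)
  Below-· b f f<k i k≤i = trans (coefficient-· b f i) (trans (*-congˡ (f<k i k≤i)) (zeroʳ b))

  Below--ₚ : ∀ {k} f → Below k f → Below k (-ₚ f)
  Below--ₚ f f<k i k≤i = trans (coefficient-neg f i) (trans (-‿cong (f<k i k≤i)) -0#≈0#)

  Below-∷ : ∀ {k b f} → Below k f → Below (suc k) (b ∷ f)
  Below-∷ f<k (suc i) (s≤s k≤i) = f<k i k≤i

  Below-tail : ∀ {k b f} → Below (suc k) (b ∷ f) → Below k f
  Below-tail f<k i k≤i = f<k (suc i) (s≤s k≤i)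

  length-Below : ∀ f → Below (Data.List.Base.length f) f
  length-Below []      i       _         = refl
  length-Below (b ∷ f) (suc i) (s≤s k≤i) = length-Below f i k≤i

  constantTail-* : ∀ {b f} → Below 0 f → ∀ g → (b ∷ f) *ₚ g ≋ b · g
  constantTail-* {b} {f} f<0 g = ≋.trans
    (+ₚ-cong {b · g} ≋.refl (0∷[]≋[] refl (*ₚ-zeroˡ (Below-0⇒≋[] {f} f<0) g)))
    (+ₚ-identityʳ (b · g))

  Below-*ₚ : ∀ M N f g → Below (suc M) f → Below (suc N) g → Below (suc (M ℕ.+ N)) (f *ₚ g)
  Below-*ₚ M       N []      g f≤M g≤N i       _ = refl
  Below-*ₚ zero    N (b ∷ f) g f≤M g≤N =
    Below-cong (≋.sym (constantTail-* {b} {f} (Below-tail {b = b} {f} f≤M) g)) (Below-· b g g≤N)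
  Below-*ₚ (suc M) N (b ∷ f) g f≤M g≤N =
    Below-+ₚ (b · g) (0# ∷ f *ₚ g)
      (Below-mono {f = b · g} (s≤s (ℕ.m≤n+m N (suc M))) (Below-· b g g≤N))
      (Below-∷ {b = 0#} {f *ₚ g} (Below-*ₚ M N f g (Below-tail {b = b} {f} f≤M) g≤N))

  -- The bounds may fail to be sharp, in which case both sides vanish; no knowledge of the exact
  -- degrees is required.
  coefficient-top-*ₚ : ∀ M N f g → Below (suc M) f → Below (suc N) g →
                      coefficient (f *ₚ g) (M ℕ.+ N) ≈ coefficient f M * coefficient g N
  coefficient-top-*ₚ M       N []      g f≤M g≤N = sym (zeroˡ _)
  coefficient-top-*ₚ zero    N (b ∷ f) g f≤M g≤N = let open ≈-Reasoning in begin
    coefficient (b · g +ₚ (0# ∷ f *ₚ g)) N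
      ≈⟨ at (constantTail-* {b} {f} (Below-tail {b = b} {f} f≤M) g) N ⟩
    coefficient (b · g) N                        ≈⟨ coefficient-· b g N ⟩
    b * coefficient g N                          ∎
  coefficient-top-*ₚ (suc M) N (b ∷ f) g f≤M g≤N = let open ≈-Reasoning in begin
    coefficient (b · g +ₚ (0# ∷ f *ₚ g)) (suc (M ℕ.+ N))
      ≈⟨ coefficient-+ (b · g) (0# ∷ f *ₚ g) _ ⟩
    coefficient (b · g) (suc (M ℕ.+ N)) + coefficient (f *ₚ g) (M ℕ.+ N)
      ≈⟨ +-cong (Below-· b g g≤N _ (s≤s (ℕ.m≤n+m N M)))
                (coefficient-top-*ₚ M N f g (Below-tail {b = b} {f} f≤M) g≤N) ⟩
    0# + coefficient f M * coefficient g N       ≈⟨ +-identityˡ _ ⟩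
    coefficient f M * coefficient g N            ∎

  coefficient-0-*ₚ : ∀ f g → coefficient (f *ₚ g) 0 ≈ coefficient f 0 * coefficient g 0
  coefficient-0-*ₚ []      g = sym (zeroˡ _)
  coefficient-0-*ₚ (b ∷ f) g =
    trans (coefficient-+ (b · g) (0# ∷ f *ₚ g) 0) (trans (+-identityʳ _) (coefficient-· b g 0))

  -- Opaque copies of the operations: products no longer unfold during
  -- unification, so that Agda infers the factors from an equation.
  opaque
    infixl 6 _⊕_
    infixl 7 _⊗_
    infix  8 ⊖_

    _⊕_ _⊗_ : Polynomial → Polynomial → Polynomial
    _⊕_ = _+ₚ_
    _⊗_ = _*ₚ_

    ⊖_ : Polynomial → Polynomial
    ⊖_ = -ₚ_

    𝟙 X : Polynomial
    𝟙 = 1# ∷ []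
    X = 0# ∷ 1# ∷ []

    C : Carrier → Polynomial
    C b = b ∷ []

    ⊕-cong : ∀ {f f′ g g′} → f ≋ f′ → g ≋ g′ → f ⊕ g ≋ f′ ⊕ g′
    ⊕-cong = +ₚ-cong

    ⊗-cong : ∀ {f f′ g g′} → f ≋ f′ → g ≋ g′ → f ⊗ g ≋ f′ ⊗ g′
    ⊗-cong = *ₚ-cong

    ⊖-cong : ∀ {f g} → f ≋ g → ⊖ f ≋ ⊖ g
    ⊖-cong = -ₚ-cong

    ⊕-assoc : ∀ f g h → (f ⊕ g) ⊕ h ≋ f ⊕ (g ⊕ h)
    ⊕-assoc = +ₚ-assoc

    ⊕-comm : ∀ f g → f ⊕ g ≋ g ⊕ f
    ⊕-comm = +ₚ-comm

    ⊕-identityˡ : ∀ f → [] ⊕ f ≋ f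
    ⊕-identityˡ f = ≋.refl

    ⊖-inverseˡ : ∀ f → ⊖ f ⊕ f ≋ []
    ⊖-inverseˡ = +ₚ-inverseˡ

    ⊗-assoc : ∀ f g h → (f ⊗ g) ⊗ h ≋ f ⊗ (g ⊗ h)
    ⊗-assoc = *ₚ-assoc

    ⊗-comm : ∀ f g → f ⊗ g ≋ g ⊗ f
    ⊗-comm = *ₚ-comm

    ⊗-identityˡ : ∀ f → 𝟙 ⊗ f ≋ f
    ⊗-identityˡ = *ₚ-identityˡ

    ⊗-distribʳ : ∀ h f g → (f ⊕ g) ⊗ h ≋ (f ⊗ h) ⊕ (g ⊗ h)
    ⊗-distribʳ = *ₚ-distribʳ

    C-cong : ∀ {b d} → b ≈ d → C b ≋ C d
    C-cong p = ∷-cong p ≋.refl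

    C-homo-+ : ∀ b d → C (b + d) ≋ C b ⊕ C d
    C-homo-+ b d = ≋.refl

    C-homo-* : ∀ b d → C (b * d) ≋ C b ⊗ C d
    C-homo-* b d = ≋.sym (constant-* b (d ∷ []))

    C-1 : C 1# ≋ 𝟙
    C-1 = ≋.refl

    C-≋[] : ∀ {b} → b ≈ 0# → C b ≋ []
    C-≋[] p = 0∷[]≋[] p ≋.refl

    X-⊗ : ∀ f → X ⊗ f ≋ 0# ∷ f
    X-⊗ f = ≋.trans (0∷-* (1# ∷ []) f) (∷-cong refl (*ₚ-identityˡ f))

    ∷-≋ : ∀ b f → b ∷ f ≋ C b ⊕ (X ⊗ f)
    ∷-≋ b f = ≋.sym (≋.trans (+ₚ-cong (≋.refl {b ∷ []}) (X-⊗ f)) (∷-cong (+-identityʳ b) (≋.refl {f})))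

    coefficient-⊕ : ∀ f g i → coefficient (f ⊕ g) i ≈ coefficient f i + coefficient g i
    coefficient-⊕ = coefficient-+

    coefficient-⊖ : ∀ f i → coefficient (⊖ f) i ≈ - coefficient f i
    coefficient-⊖ = coefficient-neg

    coefficient-C⊗ : ∀ b f i → coefficient (C b ⊗ f) i ≈ b * coefficient f i
    coefficient-C⊗ b f i = trans (at (constant-* b f) i) (coefficient-· b f i)

    coefficient-C : ∀ b → coefficient (C b) 0 ≈ b
    coefficient-C b = refl

    coefficient-X : coefficient X 1 ≈ 1#
    coefficient-X = refl

    Below-⊕ : ∀ {k} f g → Below k f → Below k g → Below k (f ⊕ g)
    Below-⊕ = Below-+ₚ

    Below-⊖ : ∀ {k} f → Below k f → Below k (⊖ f)
    Below-⊖ = Below--ₚ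

    Below-C : ∀ b → Below 1 (C b)
    Below-C b (suc i) _ = refl

    Below-𝟙 : Below 1 𝟙
    Below-𝟙 = Below-C 1#

    Below-X : Below 2 X
    Below-X (suc (suc i)) _        = refl
    Below-X (suc zero)    (s≤s ())

    Below-1⇒C : ∀ {f} → Below 1 f → f ≋ C (coefficient f 0)
    Below-1⇒C f<1 = pointwise λ { zero → refl ; (suc i) → f<1 (suc i) (s≤s z≤n) }

    Below-⊗ : ∀ M N f g → Below (suc M) f → Below (suc N) g → Below (suc (M ℕ.+ N)) (f ⊗ g)
    Below-⊗ = Below-*ₚ

    coefficient-top-⊗ : ∀ M N f g → Below (suc M) f → Below (suc N) g →
                        coefficient (f ⊗ g) (M ℕ.+ N) ≈ coefficient f M * coefficient g N
    coefficient-top-⊗ = coefficient-top-*ₚ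

    coefficient-0-⊗ : ∀ f g → coefficient (f ⊗ g) 0 ≈ coefficient f 0 * coefficient g 0
    coefficient-0-⊗ = coefficient-0-*ₚ

  Below-C⊗ : ∀ {k} b f → Below k f → Below k (C b ⊗ f)
  Below-C⊗ b f f<k i k≤i = trans (coefficient-C⊗ b f i) (trans (*-congˡ (f<k i k≤i)) (zeroʳ b))

  polynomialRing : CommutativeRing c ℓ
  polynomialRing = commutativeRingʳ ≋-isEquivalence {_⊕_} {_⊗_} {⊖_} {[]} {𝟙}
    ⊕-cong ⊗-cong ⊖-cong ⊕-assoc ⊕-comm ⊕-identityˡ ⊖-inverseˡ
    ⊗-assoc ⊗-comm ⊗-identityˡ ⊗-distribʳ

-- Evaluation along a ring homomorphism

module Evaluation {R : CommutativeRing c ℓ} {S : CommutativeRing c′ ℓ′} (h : RingHom R S) where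
  private
    module R = CommutativeRing R
  open CommutativeRing S
  open RingHom h
  open PolynomialRing R
  open SetoidReasoning setoid
  open IntegerCoefficients S using (solve; _:+_; _:*_; _:=_)

  -- Horner's scheme with each coefficient sent through `h` on the way: points of an extension ring
  -- are covered without mapping the polynomial, and `idHom` gives ordinary evaluation.
  eval : Carrier → Polynomial → Carrier
  eval x f = foldr (λ b y → ⟦ b ⟧ + x * y) 0# f

  eval-≋[] : ∀ x {f} → f ≋ [] → eval x f ≈ 0#
  eval-≋[] x {[]}    p = refl
  eval-≋[] x {b ∷ f} p = begin
    ⟦ b ⟧ + x * eval x f   ≈⟨ +-cong (trans (⟦⟧-cong (at p 0)) 0#-homo) (*-congˡ (eval-≋[] x (tail-≋[] p))) ⟩
    0# + x * 0#            ≈⟨ +-identityˡ _ ⟩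
    x * 0#                 ≈⟨ zeroʳ x ⟩
    0#                     ∎

  eval-cong : ∀ {x y f g} → x ≈ y → f ≋ g → eval x f ≈ eval y g
  eval-cong {f = []} {g}        e p = sym (eval-≋[] _ {g} (pointwise λ i → R.sym (at p i)))
  eval-cong {f = b ∷ f} {[]}    e p = eval-≋[] _ p
  eval-cong {f = b ∷ f} {d ∷ g} e p =
    +-cong (⟦⟧-cong (at p 0)) (*-cong e (eval-cong {f = f} {g} e (pointwise (at p ∘ suc))))

  eval-+ : ∀ x f g → eval x (f +ₚ g) ≈ eval x f + eval x g
  eval-+ x []      g       = sym (+-identityˡ _)
  eval-+ x (b ∷ f) []      = sym (+-identityʳ _)
  eval-+ x (b ∷ f) (d ∷ g) = begin
    ⟦ b R.+ d ⟧ + x * eval x (f +ₚ g)              ≈⟨ +-cong (+-homo b d) (*-congˡ (eval-+ x f g)) ⟩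
    (⟦ b ⟧ + ⟦ d ⟧) + x * (eval x f + eval x g)
      ≈⟨ solve 5 (λ b d x u v → (b :+ d) :+ x :* (u :+ v) := (b :+ x :* u) :+ (d :+ x :* v)) refl _ _ _ _ _ ⟩
    (⟦ b ⟧ + x * eval x f) + (⟦ d ⟧ + x * eval x g) ∎

  eval-· : ∀ x b f → eval x (b · f) ≈ ⟦ b ⟧ * eval x f
  eval-· x b []      = sym (zeroʳ _)
  eval-· x b (d ∷ f) = begin
    ⟦ b R.* d ⟧ + x * eval x (b · f)         ≈⟨ +-cong (*-homo b d) (*-congˡ (eval-· x b f)) ⟩
    ⟦ b ⟧ * ⟦ d ⟧ + x * (⟦ b ⟧ * eval x f)
      ≈⟨ solve 4 (λ b d x u → b :* d :+ x :* (b :* u) := b :* (d :+ x :* u)) refl _ _ _ _ ⟩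
    ⟦ b ⟧ * (⟦ d ⟧ + x * eval x f)           ∎

  eval-0∷ : ∀ x f → eval x (R.0# ∷ f) ≈ x * eval x f
  eval-0∷ x f = trans (+-congʳ 0#-homo) (+-identityˡ _)

  eval-* : ∀ x f g → eval x (f *ₚ g) ≈ eval x f * eval x g
  eval-* x []      g = sym (zeroˡ _)
  eval-* x (b ∷ f) g = begin
    eval x (b · g +ₚ (R.0# ∷ f *ₚ g))              ≈⟨ eval-+ x (b · g) _ ⟩
    eval x (b · g) + eval x (R.0# ∷ f *ₚ g)        ≈⟨ +-cong (eval-· x b g) (eval-0∷ x (f *ₚ g)) ⟩
    ⟦ b ⟧ * eval x g + x * eval x (f *ₚ g)         ≈⟨ +-congˡ (*-congˡ (eval-* x f g)) ⟩
    ⟦ b ⟧ * eval x g + x * (eval x f * eval x g)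
      ≈⟨ solve 4 (λ b x u v → b :* v :+ x :* (u :* v) := (b :+ x :* u) :* v) refl _ _ _ _ ⟩
    (⟦ b ⟧ + x * eval x f) * eval x g              ∎

  opaque
    unfolding _⊗_

    eval-⊕ : ∀ x f g → eval x (f ⊕ g) ≈ eval x f + eval x g
    eval-⊕ = eval-+

    eval-⊗ : ∀ x f g → eval x (f ⊗ g) ≈ eval x f * eval x g
    eval-⊗ = eval-*

    eval-C : ∀ x b → eval x (C b) ≈ ⟦ b ⟧
    eval-C x b = trans (+-congˡ (zeroʳ x)) (+-identityʳ _)

    eval-𝟙 : ∀ x → eval x 𝟙 ≈ 1#
    eval-𝟙 x = trans (eval-C x R.1#) 1#-homo

    eval-X : ∀ x → eval x X ≈ x
    eval-X x = trans (eval-0∷ x (R.1# ∷ [])) (trans (*-congˡ (eval-𝟙 x)) (*-identityʳ x))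

  evalHom : Carrier → RingHom polynomialRing S
  evalHom x = record
    { ⟦_⟧     = eval x
    ; ⟦⟧-cong = eval-cong refl
    ; +-homo  = eval-⊕ x
    ; *-homo  = eval-⊗ x
    ; 1#-homo = eval-𝟙 x
    }

  private
    module S[X] = PolynomialRing S

  coefficient-map : ∀ f i → S[X].coefficient (map ⟦_⟧ f) i ≈ ⟦ coefficient f i ⟧
  coefficient-map []      i       = sym 0#-homo
  coefficient-map (b ∷ f) zero    = refl
  coefficient-map (b ∷ f) (suc i) = coefficient-map f i

  Below-map : ∀ {k} f → Below k f → S[X].Below k (map ⟦_⟧ f)
  Below-map f f<k i k≤i = trans (coefficient-map f i) (trans (⟦⟧-cong (f<k i k≤i)) 0#-homo)

-- Domains and fields

record IsDomain (R : CommutativeRing c ℓ) : Set (c ⊔ ℓ) where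
  open CommutativeRing R hiding (zero)
  open RingProperties ring
  open IntegerCoefficients R using (solve; _:+_; _:*_; _:-_; _:=_)
  open Product R using (product)
  field
    1≉0           : ¬ 1# ≈ 0#
    noZeroDivisor : ∀ {x y} → x * y ≈ 0# → x ≈ 0# ⊎ y ≈ 0#

  *-≉0 : ∀ {x y} → ¬ x ≈ 0# → ¬ y ≈ 0# → ¬ x * y ≈ 0#
  *-≉0 x≉0 y≉0 xy≈0 with noZeroDivisor xy≈0
  ... | inj₁ x≈0 = x≉0 x≈0
  ... | inj₂ y≈0 = y≉0 y≈0

  *-cancelˡ : ∀ {x y z} → ¬ x ≈ 0# → x * y ≈ x * z → y ≈ z
  *-cancelˡ {x} {y} {z} x≉0 xy≈xz with noZeroDivisor {x} {y - z}
    (trans (solve 3 (λ x y z → x :* (y :- z) := x :* y :- x :* z) refl x y z) (x≈y⇒x∙y⁻¹≈ε xy≈xz))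
  ... | inj₁ x≈0   = contradiction x≈0 x≉0
  ... | inj₂ y-z≈0 = x∙y⁻¹≈ε⇒x≈y y z y-z≈0

  product-≈0 : ∀ {n} (t : Vector Carrier n) → product t ≈ 0# → ∃ λ i → t i ≈ 0#
  product-≈0 {zero}  t p = contradiction p 1≉0
  product-≈0 {suc n} t p with noZeroDivisor p
  ... | inj₁ t₀≈0 = zero , t₀≈0
  ... | inj₂ q    = let i , tᵢ≈0 = product-≈0 (t ∘ suc) q in suc i , tᵢ≈0

  y²≈z²⇒y≈±z : ∀ {y z} → y * y ≈ z * z → y ≈ z ⊎ y ≈ - z
  y²≈z²⇒y≈±z {y} {z} yy≈zz with noZeroDivisor {y - z} {y + z} (trans
    (solve 2 (λ y z → (y :- z) :* (y :+ z) := y :* y :- z :* z) refl y z)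
    (x≈y⇒x∙y⁻¹≈ε yy≈zz))
  ... | inj₁ p = inj₁ (x∙y⁻¹≈ε⇒x≈y y z p)
  ... | inj₂ p = inj₂ (+-inverseˡ-unique y z p)

-- Invertibility is decided, so that a constructive proof may split on x ≈ 0.
record IsField (R : CommutativeRing c ℓ) : Set (c ⊔ ℓ) where
  open CommutativeRing R hiding (zero)
  open SetoidReasoning setoid
  field
    1≉0    : ¬ 1# ≈ 0#
    invert : ∀ x → x ≈ 0# ⊎ ∃ λ y → x * y ≈ 1#

  isDomain : IsDomain R
  isDomain = record { 1≉0 = 1≉0 ; noZeroDivisor = noZeroDivisor }
    where
    noZeroDivisor : ∀ {x y} → x * y ≈ 0# → x ≈ 0# ⊎ y ≈ 0#
    noZeroDivisor {x} {y} xy≈0 with invert x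
    ... | inj₁ x≈0          = inj₁ x≈0
    ... | inj₂ (z , xz≈1) = inj₂ (begin
      y             ≈⟨ *-identityˡ y ⟨
      1# * y        ≈⟨ *-congʳ (trans (sym xz≈1) (*-comm x z)) ⟩
      z * x * y     ≈⟨ *-assoc z x y ⟩
      z * (x * y)   ≈⟨ *-congˡ xy≈0 ⟩
      z * 0#        ≈⟨ zeroʳ z ⟩
      0#            ∎)

  inverse : ∀ {x} → ¬ x ≈ 0# → ∃ λ y → x * y ≈ 1#
  inverse {x} x≉0 with invert x
  ... | inj₁ x≈0 = contradiction x≈0 x≉0
  ... | inj₂ x⁻¹ = x⁻¹

-- Division by linear factors

module LinearFactors (R : CommutativeRing c ℓ) where

  open CommutativeRing R hiding (zero)
  open RingProperties ring
  open PolynomialRing R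
  open Evaluation (idHom R)
  private module ≈-Reasoning = SetoidReasoning setoid
  open IntegerCoefficients R using (solve; _:+_; _:*_; _:-_; :-_; _:=_)
  private
    module P = CommutativeRing polynomialRing
  open Product polynomialRing using (product)

  X- : Carrier → Polynomial
  X- b = X ⊕ C (- b)

  Below-X- : ∀ b → Below 2 (X- b)
  Below-X- b = Below-⊕ X (C (- b)) Below-X (Below-mono {f = C (- b)} (s≤s z≤n) (Below-C (- b)))

  coefficient-X- : ∀ b → coefficient (X- b) 1 ≈ 1#
  coefficient-X- b = trans (coefficient-⊕ X (C (- b)) 1)
    (trans (+-cong coefficient-X (Below-C (- b) 1 ℕ.≤-refl)) (+-identityʳ 1#))

  X-‿cong : ∀ {b d} → b ≈ d → X- b ≋ X- d
  X-‿cong b≈d = P.+-congˡ (C-cong (-‿cong b≈d))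

  linear-⊗ : ∀ b g → X- b ⊗ g ≋ (C (- b) ⊗ g) ⊕ (0# ∷ g)
  linear-⊗ b g = P.trans (P.distribʳ g X (C (- b))) (P.trans (P.+-comm _ _) (P.+-congˡ (X-⊗ g)))

  -- Synthetic division by X - b.
  deflate : Carrier → Polynomial → Polynomial
  deflate b []      = []
  deflate b (d ∷ f) = eval b f ∷ deflate b f

  -- This lemma and the next compare coefficients in f = (X - b) g + f(b), where g is `deflate b f`.
  -- Only the constant coefficient sees the remainder f(b).
  coefficient-deflate-0 : ∀ b f → coefficient f 0 ≈ eval b f - b * coefficient (deflate b f) 0
  coefficient-deflate-0 b []      = sym (trans (+-congˡ (trans (-‿cong (zeroʳ b)) -0#≈0#)) (+-identityʳ 0#))
  coefficient-deflate-0 b (d ∷ f) = solve 3 (λ d b e → d := (d :+ b :* e) :- b :* e) refl d b (eval b f)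

  coefficient-deflate : ∀ b f i → coefficient f (suc i) ≈
    coefficient (deflate b f) i - b * coefficient (deflate b f) (suc i)
  coefficient-deflate b []      i       = coefficient-deflate-0 b []
  coefficient-deflate b (d ∷ f) zero    = coefficient-deflate-0 b f
  coefficient-deflate b (d ∷ f) (suc i) = coefficient-deflate b f i

  deflate-root : ∀ b f → eval b f ≈ 0# → f ≋ X- b ⊗ deflate b f
  deflate-root b f f[b]≈0 = P.trans (pointwise step) (P.sym (linear-⊗ b g))
    where
    g = deflate b f
    step : ∀ i → coefficient f i ≈ coefficient ((C (- b) ⊗ g) ⊕ (0# ∷ g)) i
    step zero = let open ≈-Reasoning in begin
      coefficient f 0                         ≈⟨ coefficient-deflate-0 b f ⟩
      eval b f - b * coefficient g 0          ≈⟨ +-congʳ f[b]≈0 ⟩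
      0# - b * coefficient g 0                ≈⟨ +-comm _ _ ⟩
      - (b * coefficient g 0) + 0#            ≈⟨ +-congʳ (-‿distribˡ-* b _) ⟩
      - b * coefficient g 0 + 0#              ≈⟨ +-congʳ (coefficient-C⊗ (- b) g 0) ⟨
      coefficient (C (- b) ⊗ g) 0 + 0#          ≈⟨ coefficient-⊕ (C (- b) ⊗ g) (0# ∷ g) 0 ⟨
      coefficient ((C (- b) ⊗ g) ⊕ (0# ∷ g)) 0   ∎
    step (suc i) = let open ≈-Reasoning in begin
      coefficient f (suc i)                                ≈⟨ coefficient-deflate b f i ⟩
      coefficient g i - b * coefficient g (suc i)          ≈⟨ +-comm _ _ ⟩
      - (b * coefficient g (suc i)) + coefficient g i      ≈⟨ +-congʳ (-‿distribˡ-* b _) ⟩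
      - b * coefficient g (suc i) + coefficient g i        ≈⟨ +-congʳ (coefficient-C⊗ (- b) g (suc i)) ⟨
      coefficient (C (- b) ⊗ g) (suc i) + coefficient g i    ≈⟨ coefficient-⊕ (C (- b) ⊗ g) (0# ∷ g) (suc i) ⟨
      coefficient ((C (- b) ⊗ g) ⊕ (0# ∷ g)) (suc i)          ∎

  Below-deflate : ∀ k b f → Below (suc k) f → Below k (deflate b f)
  Below-deflate k       b []      f<k i       _   = refl
  Below-deflate zero    b (d ∷ f) f<k zero    _   = eval-≋[] b (Below-0⇒≋[] {f} (Below-tail {b = d} {f} f<k))
  Below-deflate zero    b (d ∷ f) f<k (suc i) _   =
    Below-deflate zero b f (Below-mono {f = f} z≤n (Below-tail {b = d} {f} f<k)) i z≤n
  Below-deflate (suc k) b (d ∷ f) f<k (suc i) (s≤s k≤i) =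
    Below-deflate k b f (Below-tail {b = d} {f} f<k) i k≤i

  coefficient-deflate-top : ∀ k b f → Below (suc (suc k)) f →
                            coefficient (deflate b f) k ≈ coefficient f (suc k)
  coefficient-deflate-top k b f f<k = sym (let open ≈-Reasoning in begin
    coefficient f (suc k)                            ≈⟨ coefficient-deflate b f k ⟩
    coefficient g k - b * coefficient g (suc k)      ≈⟨ +-congˡ (-‿cong (*-congˡ (Below-deflate (suc k) b f f<k (suc k) ℕ.≤-refl))) ⟩
    coefficient g k - b * 0#                         ≈⟨ +-congˡ (trans (-‿cong (zeroʳ b)) -0#≈0#) ⟩
    coefficient g k + 0#                             ≈⟨ +-identityʳ _ ⟩
    coefficient g k                                  ∎)
    where g = deflate b f

  Below-linear : ∀ {k} (b : Vector Carrier k) → Below (suc k) (product (X- ∘ b))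
  Below-linear {zero}  b = Below-𝟙
  Below-linear {suc k} b = Below-⊗ 1 k (X- (b zero)) _ (Below-X- (b zero)) (Below-linear (b ∘ suc))

  linear-monic : ∀ {k} (b : Vector Carrier k) → coefficient (product (X- ∘ b)) k ≈ 1#
  linear-monic {zero}  b = trans (sym (at C-1 0)) (coefficient-C 1#)
  linear-monic {suc k} b = let open ≈-Reasoning in begin
    coefficient (product (X- ∘ b)) (suc k)
      ≈⟨ coefficient-top-⊗ 1 k (X- (b zero)) _ (Below-X- (b zero)) (Below-linear (b ∘ suc)) ⟩
    coefficient (X- (b zero)) 1 * coefficient (product (X- ∘ b ∘ suc)) k
      ≈⟨ trans (*-congʳ (coefficient-X- (b zero))) (*-identityˡ _) ⟩
    coefficient (product (X- ∘ b ∘ suc)) k           ≈⟨ linear-monic (b ∘ suc) ⟩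
    1#                                               ∎

  eval-X- : ∀ x b → eval x (X- b) ≈ x - b
  eval-X- x b = trans (eval-⊕ x X (C (- b))) (+-cong (eval-X x) (eval-C x (- b)))

  module _ (isDomain : IsDomain R) where
    open IsDomain isDomain

    -- The root b₀ is divided off. Any other root b of f annihilates (b - b₀) g(b), and b - b₀ is
    -- nonzero, so b is a root of the quotient g. The coefficient of x^k survives each division
    -- unchanged, also when it is zero.
    linearFactorisation : ∀ {k} (b : Vector Carrier k) f → Below (suc k) f →
      (∀ i → eval (b i) f ≈ 0#) → (∀ i j → i ≢ j → ¬ b i ≈ b j) →
      f ≋ C (coefficient f k) ⊗ product (X- ∘ b)
    linearFactorisation {zero} b f f<1 root distinct =
      P.trans (Below-1⇒C f<1) (P.sym (P.*-identityʳ (C (coefficient f 0))))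
    linearFactorisation {suc k} b f f<k root distinct = let open SetoidReasoning P.setoid in begin
      f                                                  ≈⟨ deflate-root b₀ f (root zero) ⟩
      X- b₀ P.* g                                        ≈⟨ P.*-congˡ IH ⟩
      X- b₀ P.* (C (coefficient g k) P.* Π′)          ≈⟨ P.*-congˡ {X- b₀} (P.*-congʳ {Π′} (C-cong (coefficient-deflate-top k b₀ f f<k))) ⟩
      X- b₀ P.* (C₁ P.* Π′)                               ≈⟨ P.*-assoc (X- b₀) C₁ Π′ ⟨
      (X- b₀ P.* C₁) P.* Π′                               ≈⟨ P.*-congʳ {Π′} (P.*-comm (X- b₀) C₁) ⟩
      (C₁ P.* X- b₀) P.* Π′                               ≈⟨ P.*-assoc C₁ (X- b₀) Π′ ⟩
      C₁ P.* product (X- ∘ b)                             ∎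
      where
      b₀ = b zero
      g  = deflate b₀ f
      C₁ = C (coefficient f (suc k))
      Π′ = product (X- ∘ b ∘ suc)
      root′ : ∀ i → eval (b (suc i)) g ≈ 0#
      root′ i with noZeroDivisor {b (suc i) - b₀} {eval (b (suc i)) g} (let open ≈-Reasoning in begin
        (b (suc i) - b₀) * eval (b (suc i)) g              ≈⟨ *-congʳ (eval-X- (b (suc i)) b₀) ⟨
        eval (b (suc i)) (X- b₀) * eval (b (suc i)) g      ≈⟨ eval-⊗ (b (suc i)) (X- b₀) g ⟨
        eval (b (suc i)) (X- b₀ ⊗ g)                      ≈⟨ eval-cong refl (deflate-root b₀ f (root zero)) ⟨
        eval (b (suc i)) f                                 ≈⟨ root (suc i) ⟩
        0#                                                 ∎)
      ... | inj₁ b-b₀≈0 = contradiction (x∙y⁻¹≈ε⇒x≈y _ _ b-b₀≈0) (distinct (suc i) zero λ ())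
      ... | inj₂ g[b]≈0 = g[b]≈0
      IH = linearFactorisation (b ∘ suc) g (Below-deflate (suc k) b₀ f f<k) root′
             (λ i j i≢j → distinct (suc i) (suc j) (i≢j ∘ Fin.suc-injective))

    -- In the factorisation for degree bound k, the constant in front is the coefficient of x^k,
    -- which is zero here.
    distinctRoots⇒≋[] : ∀ {k} (b : Vector Carrier k) f → Below k f →
      (∀ i → eval (b i) f ≈ 0#) → (∀ i j → i ≢ j → ¬ b i ≈ b j) → f ≋ []
    distinctRoots⇒≋[] {k} b f f<k root distinct = P.trans
      (linearFactorisation b f (Below-mono {f = f} (ℕ.n≤1+n k) f<k) root distinct)
      (P.trans (P.*-congʳ (C-≋[] (f<k k ℕ.≤-refl))) (P.zeroˡ _))

-- Finite rings given by an enumeration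

module Enumeration {F : CommutativeRing c ℓ} {q}
                   (enumeration : HasCardinality (CommutativeRing.setoid F) q) where
  open CommutativeRing F
  open Inverse enumeration using (to; from; to-cong; from-cong; inverseˡ; inverseʳ)

  element : Fin q → Carrier
  element = to

  index : Carrier → Fin q
  index = from

  index-cong : ∀ {x y} → x ≈ y → index x ≡ index y
  index-cong = from-cong

  element-index : ∀ x → element (index x) ≈ x
  element-index x = inverseˡ ≡.refl

  index-element : ∀ i → index (element i) ≡ i
  index-element i = inverseʳ refl

  element-injective : ∀ {i j} → element i ≈ element j → i ≡ j
  element-injective {i} {j} p =
    ≡.trans (≡.sym (index-element i)) (≡.trans (index-cong p) (index-element j))

  index-injective : ∀ {x y} → index x ≡ index y → x ≈ y
  index-injective {x} {y} p =
    trans (sym (element-index x)) (trans (to-cong p) (element-index y))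

  infix 4 _≟_
  _≟_ : Decidable _≈_
  x ≟ y = map′ index-injective index-cong (index x Fin.≟ index y)

  module _ (M : CommutativeMonoid c′ ℓ′) where
    private module M = CommutativeMonoid M
    open Sum M using (sum; sum-permute; sum-cong-≋)

    -- Conjugating g with the enumeration yields a permutation of `Fin q`. The monoid is arbitrary
    -- because both sums and products over F are reindexed below, by translations and by
    -- multiplication with a unit.
    sum-bijection : (t : Carrier → M.Carrier) → (∀ {x y} → x ≈ y → t x M.≈ t y) →
      (g g⁻¹ : Carrier → Carrier) →
      (∀ {x y} → x ≈ y → g x ≈ g y) → (∀ {x y} → x ≈ y → g⁻¹ x ≈ g⁻¹ y) →
      (∀ x → g (g⁻¹ x) ≈ x) → (∀ x → g⁻¹ (g x) ≈ x) →
      sum (t ∘ element) M.≈ sum (t ∘ g ∘ element)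
    sum-bijection t t-cong g g⁻¹ g-cong g⁻¹-cong gg⁻¹ g⁻¹g = M.trans
      (sum-permute (t ∘ element) π)
      (sum-cong-≋ λ i → t-cong (element-index (g (element i))))
      where
      conjugate : (Carrier → Carrier) → Fin q → Fin q
      conjugate h i = index (h (element i))
      inverse : ∀ {h k : Carrier → Carrier} → (∀ {x y} → x ≈ y → h x ≈ h y) →
                (∀ x → h (k x) ≈ x) → ∀ i → conjugate h (conjugate k i) ≡ i
      inverse {h} {k} h-cong hk i = ≡.trans
        (index-cong (trans (h-cong (element-index (k (element i)))) (hk (element i))))
        (index-element i)
      π : Permutation q q
      π = permutation (conjugate g) (conjugate g⁻¹)
            (inverse g-cong gg⁻¹) (inverse g⁻¹-cong g⁻¹g)

-- Fermat's little theorem and odd characteristic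

module FiniteField (F : CommutativeRing c ℓ) (isField : IsField F) (q₂ : ℕ)
  (enumeration : HasCardinality (CommutativeRing.setoid F) (suc (suc q₂))) where

  open CommutativeRing F hiding (zero)
  open RingProperties ring
  open IsField isField using (1≉0; inverse; isDomain)
  open IsDomain isDomain hiding (1≉0)
  open Enumeration {F = F} enumeration public
  open Product F
  open Exp commutativeSemiring using (_^_; ^-congˡ)
  open Mult semiring using (×-homo-+; ×-assocˡ; ×-cong) renaming (_×_ to _·_)
  open SetoidReasoning setoid
  open IntegerCoefficients F using (solve; _:+_; _:*_; _:-_; _:=_; con)

  q : ℕ
  q = suc (suc q₂)

  product-≉0 : ∀ {n} (t : Vector Carrier n) → (∀ i → ¬ t i ≈ 0#) → ¬ product t ≈ 0#
  product-≉0 t t≉0 p = let i , tᵢ≈0 = product-≈0 t p in t≉0 i tᵢ≈0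

  private
    -- The default value 1 at zero lets products over the units be written as products over all of
    -- F, where `sum-bijection` applies.
    nonzero : Carrier → Carrier → Carrier
    nonzero u x with x ≟ 0#
    ... | yes _ = 1#
    ... | no  _ = u

    nonzero-yes : ∀ u {x} → x ≈ 0# → nonzero u x ≈ 1#
    nonzero-yes u {x} p with x ≟ 0#
    ... | yes _ = refl
    ... | no ¬p = contradiction p ¬p

    nonzero-no : ∀ u {x} → ¬ x ≈ 0# → nonzero u x ≈ u
    nonzero-no u {x} ¬p with x ≟ 0#
    ... | yes p = contradiction p ¬p
    ... | no  _ = refl

    unit : Carrier → Carrier
    unit x = nonzero x x

    unit-cong : ∀ {x y} → x ≈ y → unit x ≈ unit y
    unit-cong {x} {y} p with x ≟ 0#
    ... | yes x≈0 = sym (nonzero-yes y (trans (sym p) x≈0))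
    ... | no  x≉0 = trans p (sym (nonzero-no y (x≉0 ∘ trans p)))

    unit-≉0 : ∀ x → ¬ unit x ≈ 0#
    unit-≉0 x with x ≟ 0#
    ... | yes _   = 1≉0
    ... | no  x≉0 = x≉0

    unit-* : ∀ u → ¬ u ≈ 0# → ∀ x → unit (u * x) ≈ nonzero u x * unit x
    unit-* u u≉0 x with x ≟ 0#
    ... | yes x≈0 = trans (nonzero-yes _ (trans (*-congˡ x≈0) (zeroʳ u))) (sym (*-identityˡ 1#))
    ... | no  x≉0 = nonzero-no (u * x) (*-≉0 u≉0 x≉0)

  private
    -- Multiplication by u permutes F. Hence the product Π of all units equals Π times one factor u
    -- for every nonzero element, and Π can be cancelled. Removing the index of zero leaves q - 1
    -- factors u.
    fermat-unit : ∀ u → ¬ u ≈ 0# → u ^ suc q₂ ≈ 1#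
    fermat-unit u u≉0 = begin
      u ^ suc q₂                         ≈⟨ sum-replicate′ ⟨
      product (replicate (suc q₂) u)     ≈⟨ product-cong (λ i → nonzero-no u (others i)) ⟨
      product (removeAt k i₀)            ≈⟨ *-identityˡ _ ⟨
      1# * product (removeAt k i₀)       ≈⟨ *-congʳ (nonzero-yes u (element-index 0#)) ⟨
      k i₀ * product (removeAt k i₀)     ≈⟨ product-remove {i = i₀} k ⟨
      product k                          ≈⟨ k≈1 ⟩
      1#                                 ∎
      where
      i₀ = index 0#
      k : Vector Carrier q
      k i = nonzero u (element i)
      Π = product (unit ∘ element)
      open Sum *-commutativeMonoid using (sum-replicate)
      sum-replicate′ = sum-replicate (suc q₂) {u}
      others : ∀ i → ¬ element (Data.Fin.Base.punchIn i₀ i) ≈ 0#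
      others i p = Fin.punchInᵢ≢i i₀ i (≡.trans (≡.sym (index-element _)) (index-cong p))
      u⁻¹ = proj₁ (inverse u≉0)
      uu⁻¹x : ∀ x → u * (u⁻¹ * x) ≈ x
      uu⁻¹x x = trans (sym (*-assoc u u⁻¹ x)) (trans (*-congʳ (proj₂ (inverse u≉0))) (*-identityˡ x))
      u⁻¹ux : ∀ x → u⁻¹ * (u * x) ≈ x
      u⁻¹ux x = trans (solve 3 (λ u v x → v :* (u :* x) := u :* (v :* x)) refl u u⁻¹ x) (uu⁻¹x x)
      k≈1 : product k ≈ 1#
      k≈1 = *-cancelˡ (product-≉0 (unit ∘ element) (unit-≉0 ∘ element)) (begin
        Π * product k                                 ≈⟨ *-comm _ _ ⟩
        product k * Π                                 ≈⟨ product-* k (unit ∘ element) ⟨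
        product (λ i → k i * unit (element i))        ≈⟨ product-cong (λ i → unit-* u u≉0 (element i)) ⟨
        product (λ i → unit (u * element i))
          ≈⟨ sum-bijection *-commutativeMonoid unit unit-cong (u *_) (u⁻¹ *_) *-congˡ *-congˡ uu⁻¹x u⁻¹ux ⟨
        Π                                             ≈⟨ *-identityʳ Π ⟨
        Π * 1#                                        ∎)

  fermat : ∀ u → u ^ q ≈ u
  fermat u with u ≟ 0#
  ... | yes u≈0 = trans (*-congʳ u≈0) (trans (zeroˡ _) (sym u≈0))
  ... | no  u≉0 = trans (*-congˡ (fermat-unit u u≉0)) (*-identityʳ u)

  private
    -- Translation by 1 permutes F, so the sum of all elements does not change when 1 is added to
    -- each of the q summands.
    q·1≈0 : q · 1# ≈ 0#
    q·1≈0 = sym (+-cancelˡ (sum element) _ _ (begin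
      sum element + 0#                       ≈⟨ +-identityʳ _ ⟩
      sum element
        ≈⟨ sum-bijection +-commutativeMonoid (λ x → x) (λ p → p) (_+ 1#) (_- 1#) +-congʳ +-congʳ
             (λ x → solve 2 (λ x e → (x :- e) :+ e := x) refl x 1#)
             (λ x → solve 2 (λ x e → (x :+ e) :- e := x) refl x 1#) ⟩
      sum (λ i → element i + 1#)             ≈⟨ ∑-distrib-+ element (λ _ → 1#) ⟩
      sum element + sum (replicate q 1#)     ≈⟨ +-congˡ (sum-replicate q {1#}) ⟩
      sum element + q · 1#                  ∎))
      where open Sum +-commutativeMonoid using (sum; ∑-distrib-+; sum-replicate)

  -- The odd number q is 2 (q / 2) + 1. If 2 vanished in F, then q times 1, which is zero, would be
  -- equal to 1.
  2≉0 : ¬ 2 ∣ q → ¬ 1# + 1# ≈ 0#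
  2≉0 2∤q 2≈0 = 1≉0 (begin
    1#                                  ≈⟨ +-identityʳ 1# ⟨
    1 · 1#                             ≈⟨ +-identityˡ _ ⟨
    0# + 1 · 1#                        ≈⟨ +-congʳ (×≈0 (q ℕ./ 2)) ⟨
    (q ℕ./ 2) · (2 · 1#) + 1 · 1#    ≈⟨ +-cong (×-assocˡ 1# (q ℕ./ 2) 2) (×-cong (≡.sym odd) refl) ⟩
    ((q ℕ./ 2) ℕ.* 2) · 1# + (q ℕ.% 2) · 1#
                                        ≈⟨ +-comm _ _ ⟩
    (q ℕ.% 2) · 1# + ((q ℕ./ 2) ℕ.* 2) · 1#
                                        ≈⟨ ×-homo-+ 1# (q ℕ.% 2) ((q ℕ./ 2) ℕ.* 2) ⟨
    (q ℕ.% 2 ℕ.+ (q ℕ./ 2) ℕ.* 2) · 1# ≈⟨ ×-cong (ℕ.m≡m%n+[m/n]*n q 2) refl ⟨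
    q · 1#                             ≈⟨ q·1≈0 ⟩
    0#                                  ∎)
    where
    2·1≈0 : 2 · 1# ≈ 0#
    2·1≈0 = trans (+-congˡ (+-identityʳ 1#)) 2≈0
    ×≈0 : ∀ k → k · (2 · 1#) ≈ 0#
    ×≈0 zero    = refl
    ×≈0 (suc k) = trans (+-cong 2·1≈0 (×≈0 k)) (+-identityʳ 0#)
    odd : q ℕ.% 2 ≡ 1
    odd with q ℕ.% 2 in eq | ℕ.m%n<n q 2
    ... | 0           | _                   = contradiction (ℕ.m%n≡0⇒n∣m q 2 eq) 2∤q
    ... | 1           | _                   = ≡.refl
    ... | suc (suc _) | s≤s (s≤s ())

-- Squares in a finite field

module Squares (F : CommutativeRing c ℓ) (isField : IsField F) {q}
  (enumeration : HasCardinality (CommutativeRing.setoid F) q) where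

  open CommutativeRing F hiding (zero)
  open RingProperties ring
  open IsField isField
  open IsDomain isDomain hiding (1≉0)
  open Enumeration {F = F} enumeration
  open SetoidReasoning setoid
  open IntegerCoefficients F using (solve; _:+_; _:*_; _:-_; :-_; _:=_)

  IsSquare : Carrier → Set _
  IsSquare x = ∃ λ y → y * y ≈ x

  IsSquare-cong : ∀ {x y} → x ≈ y → IsSquare x → IsSquare y
  IsSquare-cong x≈y (z , zz≈x) = z , trans zz≈x x≈y

  IsSquare-* : ∀ {x y} → IsSquare x → IsSquare y → IsSquare (x * y)
  IsSquare-* (u , uu≈x) (v , vv≈y) = u * v ,
    trans (solve 2 (λ u v → (u :* v) :* (u :* v) := (u :* u) :* (v :* v)) refl u v) (*-cong uu≈x vv≈y)

  IsSquare-cancelʳ : ∀ {x y} → ¬ y ≈ 0# → IsSquare (x * (y * y)) → IsSquare x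
  IsSquare-cancelʳ {x} {y} y≉0 (z , zz≈xyy) = let w , yw≈1 = inverse y≉0 in z * w , (begin
    (z * w) * (z * w)            ≈⟨ solve 2 (λ z w → (z :* w) :* (z :* w) := (z :* z) :* (w :* w)) refl z w ⟩
    (z * z) * (w * w)            ≈⟨ *-congʳ zz≈xyy ⟩
    (x * (y * y)) * (w * w)      ≈⟨ solve 3 (λ x y w → (x :* (y :* y)) :* (w :* w) := x :* ((y :* w) :* (y :* w))) refl x y w ⟩
    x * ((y * w) * (y * w))      ≈⟨ *-congˡ (trans (*-cong yw≈1 yw≈1) (*-identityʳ 1#)) ⟩
    x * 1#                       ≈⟨ *-identityʳ x ⟩
    x                            ∎)

  -- If u is not a square, y ↦ y² on one half of F and y ↦ u y² on the other
  -- half (the halves being exchanged by negation) is injective, hence onto.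
  module _ {u} (¬square : ¬ IsSquare u) where
    private
      negate : Fin q → Fin q
      negate i = index (- element i)

      negate-involutive : ∀ {i j} → element i ≈ - element j → i ≡ negate j
      negate-involutive p = ≡.trans (≡.sym (index-element _)) (index-cong p)

      -- An element belongs to the first half if its index is at most that of its negative. Zero is
      -- its own negative and so falls into the first half; everything in the second half is
      -- therefore nonzero, which is what `mixed` needs in order to divide by y².
      ψ : Fin q → Fin q
      ψ i with i Fin.≤? negate i
      ... | yes _ = index (element i * element i)
      ... | no  _ = index (u * (element i * element i))

      u≉0 : ¬ u ≈ 0#
      u≉0 u≈0 = ¬square (0# , trans (zeroˡ 0#) (sym u≈0))

      mixed : ∀ {i j} → ¬ (j Fin.≤ negate j) →
              ¬ element i * element i ≈ u * (element j * element j)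
      mixed {i} {j} j≰ p = ¬square (IsSquare-cancelʳ y≉0 (element i , p))
        where
        y≉0 : ¬ element j ≈ 0#
        y≉0 y≈0 = j≰ (Fin.≤-reflexive (negate-involutive
          (trans y≈0 (trans (sym -0#≈0#) (-‿cong (sym y≈0))))))

      swap : ∀ {y z} → y ≈ - z → z ≈ - y
      swap p = trans (sym (-‿involutive _)) (-‿cong (sym p))

      -- Within one half, equal values mean y = z or y = -z. If y = -z in the first half, each index
      -- is at most the other; in the second half neither is at most the other, against totality.
      -- Equal values across the halves would make u a square.
      ψ-injective : ∀ {i j} → ψ i ≡ ψ j → i ≡ j
      ψ-injective {i} {j} ψi≡ψj with i Fin.≤? negate i | j Fin.≤? negate j
      ... | yes i≤ | yes j≤ with y²≈z²⇒y≈±z (index-injective ψi≡ψj)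
      ...   | inj₁ p = element-injective p
      ...   | inj₂ p = Fin.≤-antisym
        (≡.subst (i Fin.≤_) (≡.sym (negate-involutive (swap p))) i≤)
        (≡.subst (j Fin.≤_) (≡.sym (negate-involutive p)) j≤)
      ψ-injective {i} {j} ψi≡ψj | yes i≤ | no j≰ = contradiction (index-injective ψi≡ψj) (mixed j≰)
      ψ-injective {i} {j} ψi≡ψj | no i≰ | yes j≤ = contradiction (sym (index-injective ψi≡ψj)) (mixed i≰)
      ψ-injective {i} {j} ψi≡ψj | no i≰ | no j≰ with y²≈z²⇒y≈±z (*-cancelˡ u≉0 (index-injective ψi≡ψj))
      ...   | inj₁ p = element-injective p
      ...   | inj₂ p with Fin.≤-total i j
      ...     | inj₁ i≤j = contradiction (≡.subst (i Fin.≤_) (negate-involutive (swap p)) i≤j) i≰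
      ...     | inj₂ j≤i = contradiction (≡.subst (j Fin.≤_) (negate-involutive p) j≤i) j≰

      ψ-value : ∀ i {v} → index v ≡ ψ i → IsSquare v ⊎ IsSquare (u * v)
      ψ-value i {v} eq with i Fin.≤? negate i
      ... | yes _ = inj₁ (element i , sym (index-injective eq))
      ... | no  _ = inj₂ (u * element i , (begin
        (u * element i) * (u * element i)
          ≈⟨ solve 2 (λ u y → (u :* y) :* (u :* y) := u :* (u :* (y :* y))) refl u (element i) ⟩
        u * (u * (element i * element i))   ≈⟨ *-congˡ (index-injective eq) ⟨
        u * v                               ∎))

    squareOrMultiple : ∀ v → IsSquare v ⊎ IsSquare (u * v)
    -- The q + 1 indices of v and of the values of ψ lie in a set of size q. Two values of ψ cannot
    -- collide, so v is one of them.
    squareOrMultiple v with Fin.pigeonhole (ℕ.n<1+n q) (λ { zero → index v ; (suc i) → ψ i })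
    ... | zero  , suc j , _         , eq = ψ-value j eq
    ... | suc i , suc j , s≤s i<j , eq = contradiction (≡.cong Fin.toℕ (ψ-injective eq)) (ℕ.<⇒≢ i<j)

-- The q-th power map on a domain over F

module Frobenius (F : CommutativeRing c ℓ) (isField : IsField F) (q₂ : ℕ)
  (enumeration : HasCardinality (CommutativeRing.setoid F) (suc (suc q₂)))
  (L : CommutativeRing c′ ℓ′) (L-isDomain : IsDomain L) (ι : RingHom F L) where

  private
    module F where
      open CommutativeRing F public
      open RingProperties ring public using (x∙y⁻¹≈ε⇒x≈y)
      open IsField isField public
      open FiniteField F isField q₂ enumeration public
      open Exp commutativeSemiring public using (_^_)
    module ι = RingHom ι
    module L[X] = CommutativeRing (PolynomialRing.polynomialRing L)
  open F using (q; element; index)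
  open ι using () renaming (⟦_⟧ to ι⟦_⟧) public
  open CommutativeRing L hiding (zero)
  open RingProperties ring
  open Exp commutativeSemiring
  open IsDomain L-isDomain
  open Product L
  open PolynomialRing L
  open LinearFactors L
  open Evaluation (idHom L)
  open SetoidReasoning setoid
  open IntegerCoefficients L using (solve; _:+_; _:*_; _:-_; :-_; _:=_)

  ι-^ : ∀ x k → ι⟦ x F.^ k ⟧ ≈ ι⟦ x ⟧ ^ k
  ι-^ x zero    = ι.1#-homo
  ι-^ x (suc k) = trans (ι.*-homo x _) (*-congˡ (ι-^ x k))

  ι-≉0 : ∀ {x} → ¬ x F.≈ F.0# → ¬ ι⟦ x ⟧ ≈ 0#
  ι-≉0 {x} x≉0 ιx≈0 = let y , xy≈1 = F.inverse x≉0 in 1≉0 (begin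
    1#                      ≈⟨ ι.1#-homo ⟨
    ι⟦ F.1# ⟧               ≈⟨ ι.⟦⟧-cong xy≈1 ⟨
    ι⟦ x F.* y ⟧            ≈⟨ ι.*-homo x y ⟩
    ι⟦ x ⟧ * ι⟦ y ⟧         ≈⟨ *-congʳ ιx≈0 ⟩
    0# * ι⟦ y ⟧             ≈⟨ zeroˡ _ ⟩
    0#                      ∎)

  ι-‿- : ∀ x y → ι⟦ x F.- y ⟧ ≈ ι⟦ x ⟧ - ι⟦ y ⟧
  ι-‿- x y = trans (ι.+-homo x (F.- y)) (+-congˡ (ι.-‿homo y))

  ι-injective : ∀ {x y} → ι⟦ x ⟧ ≈ ι⟦ y ⟧ → x F.≈ y
  ι-injective {x} {y} p with F.invert (x F.- y)
  ... | inj₁ x-y≈0 = F.x∙y⁻¹≈ε⇒x≈y x y x-y≈0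
  ... | inj₂ (z , xz≈1) = contradiction (trans (ι-‿- x y) (x≈y⇒x∙y⁻¹≈ε p))
    (ι-≉0 λ x-y≈0 → F.1≉0 (F.trans (F.sym xz≈1) (F.trans (F.*-congʳ x-y≈0) (F.zeroˡ z))))

  private
    distinct : ∀ i j → i ≢ j → ¬ ι⟦ element i ⟧ ≈ ι⟦ element j ⟧
    distinct i j i≢j p = i≢j (F.element-injective (ι-injective p))

    -- (X - b)^k in the form of a product of linear factors, so that `Below-linear` and
    -- `linear-monic` give its degree bound and its leading coefficient. The choice b = 0 serves as
    -- X^k.
    power : ∀ k → Carrier → Polynomial
    power k b = Product.product polynomialRing (λ (_ : Fin k) → X- b)

    eval-power : ∀ k b y → eval y (power k b) ≈ (y - b) ^ k
    eval-power k b y = begin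
      eval y (power k b)                       ≈⟨ product-homo (evalHom y) {k} (λ _ → X- b) ⟩
      product (λ (_ : Fin k) → eval y (X- b))  ≈⟨ product-cong {k} (λ _ → eval-X- y b) ⟩
      product (replicate k (y - b))            ≈⟨ Sum.sum-replicate *-commutativeMonoid k ⟩
      (y - b) ^ k                              ∎

    artinSchreier : Polynomial
    artinSchreier = power q 0# ⊕ (⊖ X)

    y-0≈y : ∀ y → y - 0# ≈ y
    y-0≈y y = trans (+-congˡ -0#≈0#) (+-identityʳ y)

    eval-artinSchreier : ∀ y → eval y artinSchreier ≈ y ^ q - y
    eval-artinSchreier y = begin
      eval y artinSchreier                      ≈⟨ eval-⊕ y _ _ ⟩
      eval y (power q 0#) + eval y (⊖ X)
        ≈⟨ +-cong (trans (eval-power q 0# y) (^-congˡ q (y-0≈y y)))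
                  (trans (RingHom.-‿homo (evalHom y) X) (-‿cong (eval-X y))) ⟩
      y ^ q - y                                 ∎

    Below-X^ : ∀ {k} → Below (suc (suc k)) X
    Below-X^ = Below-mono {f = X} (s≤s (s≤s z≤n)) Below-X

    ι-fermat : ∀ x → ι⟦ x ⟧ ^ q ≈ ι⟦ x ⟧
    ι-fermat x = trans (sym (ι-^ x q)) (ι.⟦⟧-cong (F.fermat x))

  -- X^q - X is monic of degree q and, by Fermat, vanishes at the images of the q elements of F,
  -- which are distinct because ι is injective.
  ^q-splits : ∀ y → y ^ q - y ≈ product (λ i → y - ι⟦ element i ⟧)
  ^q-splits y = begin
    y ^ q - y                                        ≈⟨ eval-artinSchreier y ⟨
    eval y artinSchreier                             ≈⟨ eval-cong refl splits ⟩
    eval y (C top L[X].* linears)                    ≈⟨ eval-⊗ y _ _ ⟩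
    eval y (C top) * eval y linears
      ≈⟨ *-cong (trans (eval-C y top) top≈1) (product-homo (evalHom y) (X- ∘ ι⟦_⟧ ∘ element)) ⟩
    1# * product (λ i → eval y (X- ι⟦ element i ⟧))  ≈⟨ *-identityˡ _ ⟩
    product (λ i → eval y (X- ι⟦ element i ⟧))       ≈⟨ product-cong (λ i → eval-X- y ι⟦ element i ⟧) ⟩
    product (λ i → y - ι⟦ element i ⟧)               ∎
    where
    top = coefficient artinSchreier q
    linears = Product.product polynomialRing (X- ∘ ι⟦_⟧ ∘ element)
    top≈1 : top ≈ 1#
    top≈1 = begin
      top                                                ≈⟨ coefficient-⊕ (power q 0#) (⊖ X) q ⟩
      coefficient (power q 0#) q + coefficient (⊖ X) q
        -- Since q ≥ 2, the term -X does not contribute to the coefficient of x^q.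
        ≈⟨ +-cong (linear-monic {q} (λ _ → 0#)) (Below-⊖ X Below-X^ q ℕ.≤-refl) ⟩
      1# + 0#                                            ≈⟨ +-identityʳ 1# ⟩
      1#                                                 ∎
    splits : artinSchreier ≋ C top L[X].* linears
    splits = linearFactorisation L-isDomain (ι⟦_⟧ ∘ element) artinSchreier
      (Below-⊕ (power q 0#) (⊖ X) (Below-linear {q} (λ _ → 0#))
        (Below-⊖ X (Below-mono {f = X} (s≤s (s≤s z≤n)) Below-X)))
      (λ i → trans (eval-artinSchreier ι⟦ element i ⟧) (x≈y⇒x∙y⁻¹≈ε (ι-fermat (element i))))
      distinct

  ^q-fixed : ∀ y → y ^ q ≈ y → ∃ λ x → ι⟦ x ⟧ ≈ y
  ^q-fixed y p = 
    let i , y-ιx≈0 = product-≈0 (λ i → y - ι⟦ element i ⟧) (trans (sym (^q-splits y)) (x≈y⇒x∙y⁻¹≈ε p)) in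
    element i , sym (x∙y⁻¹≈ε⇒x≈y y ι⟦ element i ⟧ y-ιx≈0)

  private
    y+[z-y]≈z : ∀ y z → y + (z - y) ≈ z
    y+[z-y]≈z = solve 2 (λ y z → y :+ (z :- y) := z) refl

    -- The polynomial y^q - y is invariant under translations by F.
    ^q-translate : ∀ y x → (y + ι⟦ x ⟧) ^ q ≈ y ^ q + ι⟦ x ⟧
    ^q-translate y x = begin
      (y + ι⟦ x ⟧) ^ q
        ≈⟨ y+[z-y]≈z (y + ι⟦ x ⟧) ((y + ι⟦ x ⟧) ^ q) ⟨
      (y + ι⟦ x ⟧) + ((y + ι⟦ x ⟧) ^ q - (y + ι⟦ x ⟧))
        ≈⟨ +-congˡ (begin
          (y + ι⟦ x ⟧) ^ q - (y + ι⟦ x ⟧)                    ≈⟨ ^q-splits (y + ι⟦ x ⟧) ⟩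
          product (λ i → (y + ι⟦ x ⟧) - ι⟦ element i ⟧)
            ≈⟨ product-cong (λ i → trans
                 (solve 3 (λ y x z → (y :+ x) :- z := y :- (z :- x)) refl y ι⟦ x ⟧ ι⟦ element i ⟧)
                 (+-congˡ (-‿cong (sym (ι-‿- (element i) x))))) ⟩
          product (λ i → y - ι⟦ element i F.- x ⟧)
            ≈⟨ F.sum-bijection *-commutativeMonoid (λ z → y - ι⟦ z ⟧) (λ p → +-congˡ (-‿cong (ι.⟦⟧-cong p)))
                 (F._- x) (F._+ x) F.+-congʳ F.+-congʳ
                 (λ z → FS.solve 2 (λ z x → (z FS.:+ x) FS.:- x FS.:= z) F.refl z x)
                 (λ z → FS.solve 2 (λ z x → (z FS.:- x) FS.:+ x FS.:= z) F.refl z x) ⟨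
          product (λ i → y - ι⟦ element i ⟧)                 ≈⟨ ^q-splits y ⟨
          y ^ q - y                                          ∎) ⟩
      (y + ι⟦ x ⟧) + (y ^ q - y)
        ≈⟨ solve 3 (λ y x z → (y :+ x) :+ (z :- y) := z :+ x) refl y ι⟦ x ⟧ (y ^ q) ⟩
      y ^ q + ι⟦ x ⟧                                         ∎
      where module FS = IntegerCoefficients F

  -- (X + z)^q - X^q - z^q has degree less than q and vanishes on F.
  ^q-+ : ∀ y z → (y + z) ^ q ≈ y ^ q + z ^ q
  ^q-+ y z = x∙y⁻¹≈ε⇒x≈y _ _ (trans (sym (eval-T y)) (eval-≋[] y T≋[]))
    where
    T₁ = power q (- z)
    T₂ = ⊖ (power q 0# ⊕ C (z ^ q))
    T = T₁ ⊕ T₂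
    eval-T : ∀ y → eval y T ≈ (y + z) ^ q - (y ^ q + z ^ q)
    eval-T y = begin
      eval y T                         ≈⟨ eval-⊕ y T₁ T₂ ⟩
      eval y T₁ + eval y T₂
        ≈⟨ +-cong (trans (eval-power q (- z) y) (^-congˡ q (+-congˡ (-‿involutive z))))
                  (trans (RingHom.-‿homo (evalHom y) _) (-‿cong (trans (eval-⊕ y _ _)
                    (+-cong (trans (eval-power q 0# y) (^-congˡ q (y-0≈y y))) (eval-C y (z ^ q)))))) ⟩
      (y + z) ^ q - (y ^ q + z ^ q)    ∎
    Below-C′ : Below q (C (z ^ q))
    Below-C′ = Below-mono {f = C (z ^ q)} (s≤s z≤n) (Below-C (z ^ q))
    Below-T₂ = Below-⊖ (power q 0# ⊕ C (z ^ q)) (Below-⊕ (power q 0#) (C (z ^ q)) (Below-linear {q} (λ _ → 0#))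
                 (Below-mono {f = C (z ^ q)} (ℕ.n≤1+n q) Below-C′))
    Tq≈0 : coefficient T q ≈ 0#
    Tq≈0 = begin
      coefficient T q                       ≈⟨ coefficient-⊕ T₁ T₂ q ⟩
      coefficient T₁ q + coefficient T₂ q
        ≈⟨ +-cong (linear-monic {q} (λ _ → - z))
             (trans (coefficient-⊖ (power q 0# ⊕ C (z ^ q)) q) (-‿cong (trans (coefficient-⊕ (power q 0#) (C (z ^ q)) q)
               (+-cong (linear-monic {q} (λ _ → 0#)) (Below-C′ q ℕ.≤-refl))))) ⟩
      1# - (1# + 0#)                        ≈⟨ x≈y⇒x∙y⁻¹≈ε (sym (+-identityʳ 1#)) ⟩
      0#                                    ∎
    T≋[] : T ≋ []
    T≋[] = distinctRoots⇒≋[] L-isDomain (ι⟦_⟧ ∘ element) T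
      (Below-lower T (Below-⊕ T₁ T₂ (Below-linear {q} (λ _ → - z)) Below-T₂) Tq≈0)
      -- At a point ι(x) the difference vanishes by `^q-translate`, with z as the translated
      -- element, together with ι(x)^q = ι(x).
      (λ i → trans (eval-T ι⟦ element i ⟧) (x≈y⇒x∙y⁻¹≈ε (begin
        (ι⟦ element i ⟧ + z) ^ q          ≈⟨ ^-congˡ q (+-comm _ _) ⟩
        (z + ι⟦ element i ⟧) ^ q          ≈⟨ ^q-translate z (element i) ⟩
        z ^ q + ι⟦ element i ⟧            ≈⟨ +-comm _ _ ⟩
        ι⟦ element i ⟧ + z ^ q            ≈⟨ +-congʳ (ι-fermat (element i)) ⟨
        ι⟦ element i ⟧ ^ q + z ^ q        ∎)))
      distinct

  private
    ^-≈0 : ∀ k {y} → y ^ k ≈ 0# → y ≈ 0#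
    ^-≈0 zero    p = contradiction p 1≉0
    ^-≈0 (suc k) p with noZeroDivisor p
    ... | inj₁ y≈0  = y≈0
    ... | inj₂ yᵏ≈0 = ^-≈0 k yᵏ≈0

  opaque
    -- Inside `opaque`, so that iterates do not unfold into towers of q-th powers. The conjugation
    -- argument uses only that this is a ring homomorphism, that it is injective, and that its fixed
    -- points are exactly the elements of F.
    frobenius : RingHom L L
    frobenius = record
      { ⟦_⟧     = _^ q
      ; ⟦⟧-cong = ^-congˡ q
      ; +-homo  = ^q-+
      ; *-homo  = λ x y → ^-distrib-* x y q
      ; 1#-homo = trans (^-congˡ q (sym ι.1#-homo)) (trans (ι-fermat F.1#) ι.1#-homo)
      }

    frobenius-ι : ∀ x → RingHom.⟦_⟧ frobenius ι⟦ x ⟧ ≈ ι⟦ x ⟧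
    frobenius-ι = ι-fermat

    frobenius-fixed : ∀ y → RingHom.⟦_⟧ frobenius y ≈ y → ∃ λ x → ι⟦ x ⟧ ≈ y
    frobenius-fixed = ^q-fixed

    frobenius-injective : ∀ {y z} → RingHom.⟦_⟧ frobenius y ≈ RingHom.⟦_⟧ frobenius z → y ≈ z
    frobenius-injective {y} {z} p = x∙y⁻¹≈ε⇒x≈y y z (^-≈0 q (begin
      (y - z) ^ q           ≈⟨ ^q-+ y (- z) ⟩
      y ^ q + (- z) ^ q     ≈⟨ +-congˡ (RingHom.-‿homo frobenius z) ⟩
      y ^ q - z ^ q         ≈⟨ x≈y⇒x∙y⁻¹≈ε p ⟩
      0#                    ∎))

-- The ring obtained by adjoining a formal square root of a, and its norm

module Quadratic (R : CommutativeRing c ℓ) (a : CommutativeRing.Carrier R) where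

  open CommutativeRing R hiding (zero)
  open RingProperties ring
  open SetoidReasoning setoid
  open IntegerCoefficients R using (solve; _:+_; _:*_; _:-_; :-_; _:=_; con)

  -- u ⊹ v stands for u + v s, where s² = a.
  infix 5 _⊹_
  record R[s] : Set c where
    constructor _⊹_
    field
      re im : Carrier
  open R[s] public

  infix 4 _≃_
  record _≃_ (x y : R[s]) : Set ℓ where
    constructor _,_
    field
      re-≈ : re x ≈ re y
      im-≈ : im x ≈ im y
  open _≃_ public

  quadraticRing : CommutativeRing c ℓ
  quadraticRing = commutativeRingʳ
    {_≈_ = _≃_}
    (record { refl = refl , refl ; sym = λ p → sym (re-≈ p) , sym (im-≈ p)
            ; trans = λ p q → trans (re-≈ p) (re-≈ q) , trans (im-≈ p) (im-≈ q) })
    {λ x y → re x + re y ⊹ im x + im y}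
    {λ x y → re x * re y + a * (im x * im y) ⊹ re x * im y + im x * re y}
    {λ x → - re x ⊹ - im x}
    {0# ⊹ 0#}
    {1# ⊹ 0#}
    (λ p q → +-cong (re-≈ p) (re-≈ q) , +-cong (im-≈ p) (im-≈ q))
    (λ p q → +-cong (*-cong (re-≈ p) (re-≈ q)) (*-congˡ (*-cong (im-≈ p) (im-≈ q)))
           , +-cong (*-cong (re-≈ p) (im-≈ q)) (*-cong (im-≈ p) (re-≈ q)))
    (λ p → -‿cong (re-≈ p) , -‿cong (im-≈ p))
    (λ x y z → +-assoc _ _ _ , +-assoc _ _ _)
    (λ x y → +-comm _ _ , +-comm _ _)
    (λ x → +-identityˡ _ , +-identityˡ _)
    (λ x → -‿inverseˡ _ , -‿inverseˡ _)
    (λ (u ⊹ v) (x ⊹ y) (z ⊹ t)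
      → solve 7 (λ a u v x y z t → (u :* x :+ a :* (v :* y)) :* z :+ a :* ((u :* y :+ v :* x) :* t)
                    := u :* (x :* z :+ a :* (y :* t)) :+ a :* (v :* (x :* t :+ y :* z))) refl a u v x y z t
      , solve 7 (λ a u v x y z t → (u :* x :+ a :* (v :* y)) :* t :+ (u :* y :+ v :* x) :* z
                    := u :* (x :* t :+ y :* z) :+ v :* (x :* z :+ a :* (y :* t))) refl a u v x y z t)
    (λ (u ⊹ v) (x ⊹ y)
      → solve 5 (λ a u v x y → u :* x :+ a :* (v :* y) := x :* u :+ a :* (y :* v)) refl a u v x y
      , solve 4 (λ u v x y → u :* y :+ v :* x := x :* v :+ y :* u) refl u v x y)
    (λ (x ⊹ y)
      → solve 3 (λ a x y → con (+ 1) :* x :+ a :* (con (+ 0) :* y) := x) refl a x y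
      , solve 2 (λ x y → con (+ 1) :* y :+ con (+ 0) :* x := y) refl x y)
    (λ (z ⊹ t) (u ⊹ v) (x ⊹ y)
      → solve 7 (λ a u v x y z t → (u :+ x) :* z :+ a :* ((v :+ y) :* t)
                    := (u :* z :+ a :* (v :* t)) :+ (x :* z :+ a :* (y :* t))) refl a u v x y z t
      , solve 6 (λ u v x y z t → (u :+ x) :* t :+ (v :+ y) :* z
                    := (u :* t :+ v :* z) :+ (x :* t :+ y :* z)) refl u v x y z t)

  private module Q = CommutativeRing quadraticRing

  embed : RingHom R quadraticRing
  embed = record
    { ⟦_⟧     = λ x → x ⊹ 0#
    ; ⟦⟧-cong = λ p → p , refl
    ; +-homo  = λ x y → refl , sym (+-identityʳ 0#)
    ; *-homo  = λ x y → solve 3 (λ a x y → x :* y := x :* y :+ a :* (con (+ 0) :* con (+ 0))) refl a x y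
                      , solve 2 (λ x y → con (+ 0) := x :* con (+ 0) :+ con (+ 0) :* y) refl x y
    ; 1#-homo = refl , refl
    }

  s : R[s]
  s = 0# ⊹ 1#

  s²≃a : s Q.* s ≃ a ⊹ 0#
  s²≃a = solve 1 (λ a → con (+ 0) :* con (+ 0) :+ a :* (con (+ 1) :* con (+ 1)) := a) refl a
       , solve 0 (con (+ 0) :* con (+ 1) :+ con (+ 1) :* con (+ 0) := con (+ 0)) refl

  -- The product of u + v s with its conjugate u - v s. Multiplicativity is a polynomial identity
  -- and so persists when a is a square in R and the quadratic ring has zero divisors.
  norm : R[s] → Carrier
  norm x = re x * re x - a * (im x * im x)

  norm-cong : ∀ {x y} → x ≃ y → norm x ≈ norm y
  norm-cong p = +-cong (*-cong (re-≈ p) (re-≈ p)) (-‿cong (*-congˡ (*-cong (im-≈ p) (im-≈ p))))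

  norm-* : ∀ x y → norm (x Q.* y) ≈ norm x * norm y
  norm-* (u ⊹ v) (x ⊹ y) = solve 5 (λ a u v x y →
    (u :* x :+ a :* (v :* y)) :* (u :* x :+ a :* (v :* y)) :- a :* ((u :* y :+ v :* x) :* (u :* y :+ v :* x))
    := (u :* u :- a :* (v :* v)) :* (x :* x :- a :* (y :* y))) refl a u v x y

  norm-1 : norm Q.1# ≈ 1#
  norm-1 = solve 1 (λ a → con (+ 1) :* con (+ 1) :- a :* (con (+ 0) :* con (+ 0)) := con (+ 1)) refl a

  norm-embed : ∀ x → norm (x ⊹ 0#) ≈ x * x
  norm-embed x = solve 2 (λ a x → x :* x :- a :* (con (+ 0) :* con (+ 0)) := x :* x) refl a x

  norm-s : norm s ≈ - a
  norm-s = solve 1 (λ a → con (+ 0) :* con (+ 0) :- a :* (con (+ 1) :* con (+ 1)) := :- a) refl a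

  norm-product : ∀ {n} (t : Vector R[s] n) →
                 norm (Product.product quadraticRing t) ≈ Product.product R (norm ∘ t)
  norm-product {zero}  t = norm-1
  norm-product {suc n} t = trans (norm-* (t zero) _) (*-congˡ (norm-product (t ∘ suc)))

  open PolynomialRing R using (Polynomial; _⊗_; _≋_; C; X; polynomialRing)
  open LinearFactors R using (X-)
  open Evaluation embed public using () renaming (eval to evalQ)
  private module E = Evaluation embed

  -- f(s) f(-s)
  polynomialNorm : Polynomial → Carrier
  polynomialNorm f = norm (E.eval s f)

  polynomialNorm-cong : ∀ {f g} → f ≋ g → polynomialNorm f ≈ polynomialNorm g
  polynomialNorm-cong p = norm-cong (E.eval-cong Q.refl p)

  polynomialNorm-⊗ : ∀ f g → polynomialNorm (f ⊗ g) ≈ polynomialNorm f * polynomialNorm g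
  polynomialNorm-⊗ f g = trans (norm-cong (E.eval-⊗ s f g)) (norm-* _ _)

  polynomialNorm-C : ∀ b → polynomialNorm (C b) ≈ b * b
  polynomialNorm-C b = trans (norm-cong (E.eval-C s b)) (norm-embed b)

  polynomialNorm-X- : ∀ b → polynomialNorm (X- b) ≈ b * b - a
  polynomialNorm-X- b = trans
    (norm-cong (Q.trans (E.eval-⊕ s X (C (- b))) (Q.+-cong (E.eval-X s) (E.eval-C s (- b)))))
    (solve 2 (λ a b → (con (+ 0) :- b) :* (con (+ 0) :- b)
                        :- a :* ((con (+ 1) :+ con (+ 0)) :* (con (+ 1) :+ con (+ 0)))
                      := b :* b :- a) refl a b)

  polynomialNorm-product : ∀ {n} (t : Vector Polynomial n) →
    polynomialNorm (Product.product polynomialRing t) ≈ Product.product R (polynomialNorm ∘ t)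
  polynomialNorm-product t = trans (norm-cong (product-homo (E.evalHom s) t)) (norm-product (E.eval s ∘ t))

-- Base change of evaluations and norms

module _ {R : CommutativeRing c ℓ} {S : CommutativeRing c′ ℓ′} (h : RingHom R S) where
  private
    module R = CommutativeRing R
    module S = CommutativeRing S
    module R[X] = PolynomialRing R
  open RingHom h
  open IntegerCoefficients S using (solve; _:+_; _:*_; _:-_; :-_; _:=_; con)

  eval-map : ∀ {c″ ℓ″} {T : CommutativeRing c″ ℓ″} (g : RingHom S T) (gh : RingHom R T) →
    (∀ b → CommutativeRing._≈_ T (RingHom.⟦_⟧ gh b) (RingHom.⟦_⟧ g ⟦ b ⟧)) →
    ∀ x f → CommutativeRing._≈_ T (Evaluation.eval gh x f) (Evaluation.eval g x (map ⟦_⟧ f))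
  eval-map {T = T} g gh gh≈g∘h x []      = CommutativeRing.refl T
  eval-map {T = T} g gh gh≈g∘h x (b ∷ f) =
    T.+-cong (gh≈g∘h b) (T.*-congˡ (eval-map g gh gh≈g∘h x f))
    where module T = CommutativeRing T

  module _ (a : R.Carrier) where
    private
      module QR = Quadratic R a
      module QS = Quadratic S ⟦ a ⟧
      module QS-ring = CommutativeRing QS.quadraticRing
      open Quadratic._≃_

    eval-s-map : ∀ f → let z = QR.evalQ QR.s f in
                 QS.evalQ QS.s (map ⟦_⟧ f) QS.≃ (⟦ QR.re z ⟧ QS.⊹ ⟦ QR.im z ⟧)
    eval-s-map []      = S.sym 0#-homo QS., S.sym 0#-homo
    eval-s-map (b ∷ f) = QS-ring.trans
      (QS-ring.+-congˡ {⟦ b ⟧ QS.⊹ S.0#} (QS-ring.*-congˡ {QS.s} (eval-s-map f)))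
      ( S.trans (solve 4 (λ a b u v → b :+ (con (+ 0) :* u :+ a :* (con (+ 1) :* v)) := b :+ a :* v) S.refl ⟦ a ⟧ ⟦ b ⟧ ⟦ u ⟧ ⟦ v ⟧)
          (S.sym (S.trans (⟦⟧-cong (SR.solve 4 (λ a b u v → b SR.:+ (SR.con (+ 0) SR.:* u SR.:+ a SR.:* (SR.con (+ 1) SR.:* v)) SR.:= b SR.:+ a SR.:* v) R.refl a b u v))
            (S.trans (+-homo _ _) (S.+-congˡ (*-homo _ _)))))
      QS., S.trans (solve 2 (λ u v → con (+ 0) :+ (con (+ 0) :* v :+ con (+ 1) :* u) := u) S.refl ⟦ u ⟧ ⟦ v ⟧)
          (⟦⟧-cong (SR.solve 2 (λ u v → u SR.:= SR.con (+ 0) SR.:+ (SR.con (+ 0) SR.:* v SR.:+ SR.con (+ 1) SR.:* u)) R.refl u v)) )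
      where
      module SR = IntegerCoefficients R
      u = QR.re (QR.evalQ QR.s f)
      v = QR.im (QR.evalQ QR.s f)

    -- The norm of a polynomial over F is an element of F, but it is computed from the linear
    -- factors of the polynomial, which exist only over the extension.
    polynomialNorm-map : ∀ f → ⟦ QR.polynomialNorm f ⟧ S.≈ QS.polynomialNorm (map ⟦_⟧ f)
    polynomialNorm-map f = S.sym (S.trans (QS.norm-cong (eval-s-map f)) (S.sym
      (S.trans (+-homo _ _) (S.+-cong (*-homo _ _) (S.trans (-‿homo _) (S.-‿cong (S.trans (*-homo _ _) (S.*-congˡ (*-homo _ _)))))))))

-- Products over initial segments of the natural numbers

module InitialProducts (R : CommutativeRing c ℓ) where
  open CommutativeRing R hiding (zero)
  open Product R
  open SetoidReasoning setoid
  open IntegerCoefficients R using (solve; _:+_; _:*_; _:-_; :-_; _:=_)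

  -- The factors are indexed by all natural numbers, so that shifting the index and cutting the
  -- range at m need no arithmetic in `Fin`.
  ∏ : ℕ → (ℕ → Carrier) → Carrier
  ∏ k t = product {k} (t ∘ Fin.toℕ)

  ∏-cong : ∀ k {t u} → (∀ i → t i ≈ u i) → ∏ k t ≈ ∏ k u
  ∏-cong k t≈u = product-cong {k} (t≈u ∘ Fin.toℕ)

  ∏-last : ∀ k t → ∏ (suc k) t ≈ ∏ k t * t k
  ∏-last k t = trans (product-init-last (t ∘ Fin.toℕ))
    (*-cong (product-cong {k} (λ i → reflexive (≡.cong t (Fin.toℕ-inject₁ i))))
            (reflexive (≡.cong t (Fin.toℕ-fromℕ k))))

  ∏-++ : ∀ m n t → ∏ (m ℕ.+ n) t ≈ ∏ m t * ∏ n (λ i → t (m ℕ.+ i))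
  ∏-++ zero    n t = sym (*-identityˡ _)
  ∏-++ (suc m) n t = trans (*-congˡ (∏-++ m n (t ∘ suc))) (sym (*-assoc _ _ _))

  ∏-* : ∀ k t u → ∏ k (λ i → t i * u i) ≈ ∏ k t * ∏ k u
  ∏-* k t u = product-* {k} (t ∘ Fin.toℕ) (u ∘ Fin.toℕ)

  ∏-cycle : ∀ k t → t k ≈ t 0 → ∏ k (t ∘ suc) ≈ ∏ k t
  ∏-cycle zero    t p = refl
  ∏-cycle (suc k) t p = trans (∏-last k (t ∘ suc)) (trans (*-congˡ p) (*-comm _ _))

  -- The shift exchanges only the first factor, for one with the opposite sign; exactly one sign
  -- comes out, whatever the length. Frobenius acts on Δ in this way.
  ∏-anticycle : ∀ k t → 0 < k → t k ≈ - t 0 → ∏ k (t ∘ suc) ≈ - ∏ k t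
  ∏-anticycle (suc k) t _ p = trans (∏-last k (t ∘ suc)) (trans (*-congˡ p)
    (solve 2 (λ x y → x :* (:- y) := :- (y :* x)) refl _ _))

-- Conjugates of a root, and the norm that is not a square

module KeyLemma (F : CommutativeRing c ℓ) (isField : IsField F) (q₂ : ℕ)
  (enumeration : HasCardinality (CommutativeRing.setoid F) (suc (suc q₂)))
  (L : CommutativeRing c′ ℓ′) (L-isDomain : IsDomain L) (ι : RingHom F L) where

  private
    module F where
      open CommutativeRing F public
      open IsField isField public
      open IsDomain isDomain public using (*-≉0; noZeroDivisor)
      open RingProperties ring public using (-0#≈0#; -‿injective)
      open Exp commutativeSemiring public using (_^_)
    module F[X] = PolynomialRing F
    module ι = RingHom ι
    module L[X] where
      open PolynomialRing L public
      open CommutativeRing polynomialRing public using (_≈_; refl; sym; trans; +-cong; +-congˡ; +-congʳ; *-cong; *-congˡ; *-congʳ; setoid)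
      open Product polynomialRing public using (product; product-cong)
      open InitialProducts polynomialRing public using (∏; ∏-cong; ∏-cycle)
      open LinearFactors L public
      open Evaluation (idHom L) public
  open CommutativeRing L hiding (zero)
  open RingProperties ring
  open Exp commutativeSemiring using (_^_; ^-congˡ)
  open IsDomain L-isDomain
  open Frobenius F isField q₂ enumeration L L-isDomain ι
  open Product L
  open InitialProducts L
  open Evaluation ι using () renaming (eval to evalι)
  private module Eι = Evaluation ι
  open SetoidReasoning setoid
  open IntegerCoefficients L using (solve; _:+_; _:*_; _:-_; :-_; _:=_; con)

  private
    module φ = RingHom frobenius
    φ : Carrier → Carrier
    φ = φ.⟦_⟧

  iterate : ℕ → RingHom L L
  iterate zero    = idHom L
  iterate (suc i) = record
    { ⟦_⟧     = φ ∘ it.⟦_⟧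
    ; ⟦⟧-cong = φ.⟦⟧-cong ∘ it.⟦⟧-cong
    ; +-homo  = λ x y → trans (φ.⟦⟧-cong (it.+-homo x y)) (φ.+-homo _ _)
    ; *-homo  = λ x y → trans (φ.⟦⟧-cong (it.*-homo x y)) (φ.*-homo _ _)
    ; 1#-homo = trans (φ.⟦⟧-cong it.1#-homo) φ.1#-homo
    }
    where module it = RingHom (iterate i)

  φ^ : ℕ → Carrier → Carrier
  φ^ i = RingHom.⟦_⟧ (iterate i)

  φ^-+ : ∀ i j y → φ^ (i ℕ.+ j) y ≡ φ^ i (φ^ j y)
  φ^-+ zero    j y = ≡.refl
  φ^-+ (suc i) j y = ≡.cong φ (φ^-+ i j y)

  φ^-ι : ∀ i x → φ^ i ι⟦ x ⟧ ≈ ι⟦ x ⟧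
  φ^-ι zero    x = refl
  φ^-ι (suc i) x = trans (φ.⟦⟧-cong (φ^-ι i x)) (frobenius-ι x)

  φ^-injective : ∀ i {y z} → φ^ i y ≈ φ^ i z → y ≈ z
  φ^-injective zero    p = p
  φ^-injective (suc i) p = φ^-injective i (frobenius-injective p)

  eval-φ^ : ∀ i y f → evalι (φ^ i y) f ≈ φ^ i (evalι y f)
  eval-φ^ i y []      = sym (RingHom.0#-homo (iterate i))
  eval-φ^ i y (b ∷ f) = sym (trans (it.+-homo _ _)
    (+-cong (φ^-ι i b) (trans (it.*-homo _ _) (*-congˡ (sym (eval-φ^ i y f))))))
    where module it = RingHom (iterate i)

  -- Frobenius on the coefficients, as an endomorphism of L[X].
  private
    Cφ : RingHom L L[X].polynomialRing
    Cφ = record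
      { ⟦_⟧     = L[X].C ∘ φ
      ; ⟦⟧-cong = L[X].C-cong ∘ φ.⟦⟧-cong
      ; +-homo  = λ x y → L[X].trans (L[X].C-cong (φ.+-homo x y)) (L[X].C-homo-+ _ _)
      ; *-homo  = λ x y → L[X].trans (L[X].C-cong (φ.*-homo x y)) (L[X].C-homo-* _ _)
      ; 1#-homo = L[X].trans (L[X].C-cong φ.1#-homo) L[X].C-1
      }
    module EΦ = Evaluation Cφ

    Φ : L[X].Polynomial → L[X].Polynomial
    Φ = EΦ.eval L[X].X

    Φ-coefficient : ∀ f i → L[X].coefficient (Φ f) i ≈ φ (L[X].coefficient f i)
    Φ-coefficient []      i       = sym φ.0#-homo
    Φ-coefficient (b ∷ f) zero    = sym (L[X].at (L[X].∷-≋ (φ b) (Φ f)) 0)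
    Φ-coefficient (b ∷ f) (suc i) = trans (sym (L[X].at (L[X].∷-≋ (φ b) (Φ f)) (suc i))) (Φ-coefficient f i)

    Φ-X- : ∀ b → Φ (L[X].X- b) L[X].≋ L[X].X- (φ b)
    Φ-X- b = L[X].trans (EΦ.eval-⊕ L[X].X L[X].X (L[X].C (- b)))
      (L[X].+-cong (EΦ.eval-X L[X].X) (L[X].trans (EΦ.eval-C L[X].X (- b)) (L[X].C-cong (φ.-‿homo b))))

  preimage : ∀ f → (∀ i → ∃ λ x → ι⟦ x ⟧ ≈ L[X].coefficient f i) →
             ∃ λ g → ∀ i → ι⟦ F[X].coefficient g i ⟧ ≈ L[X].coefficient f i
  preimage []      _ = [] , λ _ → ι.0#-homo
  preimage (b ∷ f) h =
    let x , ιx≈b = h 0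
        g , ιg≈f = preimage f (h ∘ suc)
    in x ∷ g , λ { zero → ιx≈b ; (suc i) → ιg≈f i }

  -- The conjugation argument takes irreducibility of p only in this form, as minimality of d; it
  -- never refers to the construction of `L`.
  module _ (α : Carrier) (d : ℕ)
           (minimal : ∀ h → F[X].Below d h → evalι α h ≈ 0# → h F[X].≋ []) where

    β : ℕ → Carrier
    β i = φ^ i α

    β-+ : ∀ i j → β (i ℕ.+ j) ≈ φ^ i (β j)
    β-+ i j = reflexive (φ^-+ i j α)

    -- If φᵏ fixes α, the polynomial ∏_{i < k} (X - φⁱ α) has coefficients in F.
    noShortPeriod : ∀ k → 0 < k → k < d → ¬ β k ≈ α
    -- h is monic of degree k < d and has the root α. Its descent g to F is zero by minimality, so
    -- the leading coefficient 1 would be zero.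
    noShortPeriod k@(suc k′) _ k<d βk≈α = 1≉0 (begin
      1#                       ≈⟨ L[X].linear-monic {k} (β ∘ Fin.toℕ) ⟨
      L[X].coefficient h k     ≈⟨ ιg≈h k ⟨
      ι⟦ F[X].coefficient g k ⟧ ≈⟨ ι.⟦⟧-cong (F[X].at g≋[] k) ⟩
      ι⟦ F.0# ⟧                ≈⟨ ι.0#-homo ⟩
      0#                       ∎)
      where
      h = L[X].∏ k (L[X].X- ∘ β)
      h′ = L[X].∏ k′ (L[X].X- ∘ β ∘ suc)
      -- Frobenius permutes the linear factors of h cyclically, since the k-th conjugate is α again.
      -- The coefficients of h are thus fixed and come from F.
      Φh≋h : Φ h L[X].≋ h
      Φh≋h = L[X].trans (product-homo (EΦ.evalHom L[X].X) {k} (L[X].X- ∘ β ∘ Fin.toℕ))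
        (L[X].trans (L[X].∏-cong k {Φ ∘ L[X].X- ∘ β} {L[X].X- ∘ β ∘ suc} (Φ-X- ∘ β))
                    (L[X].∏-cycle k (L[X].X- ∘ β) (L[X].X-‿cong βk≈α)))
      descent = preimage h λ i → frobenius-fixed (L[X].coefficient h i)
        (trans (sym (Φ-coefficient h i)) (L[X].at Φh≋h i))
      g    = proj₁ descent
      ιg≈h = proj₂ descent
      g<d : F[X].Below d g
      g<d i d≤i = ι-injective (trans (ιg≈h i) (trans (L[X].Below-linear {k} (β ∘ Fin.toℕ) i (ℕ.≤-trans k<d d≤i)) (sym ι.0#-homo)))
      h[α]≈0 : L[X].eval α h ≈ 0#
      h[α]≈0 = begin
        L[X].eval α h                              ≈⟨ L[X].eval-⊗ α (L[X].X- α) h′ ⟩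
        L[X].eval α (L[X].X- α) * L[X].eval α h′   ≈⟨ *-congʳ (trans (L[X].eval-X- α α) (-‿inverseʳ α)) ⟩
        0# * L[X].eval α h′                        ≈⟨ zeroˡ _ ⟩
        0#                                         ∎
      g≋[] : g F[X].≋ []
      g≋[] = minimal g g<d (begin
        evalι α g                          ≈⟨ eval-map ι (idHom L) ι (λ _ → refl) α g ⟩
        L[X].eval α (map ι⟦_⟧ g)
          ≈⟨ L[X].eval-cong {f = map ι⟦_⟧ g} {g = h} refl (L[X].pointwise λ i → trans (Eι.coefficient-map g i) (ιg≈h i)) ⟩
        L[X].eval α h                      ≈⟨ h[α]≈0 ⟩
        0#                                 ∎)

    -- Cancelling the injective map φ^i from β_i = β_j would leave the period j - i, which is
    -- positive and less than d.
    β-distinct-< : ∀ {i j} → i < j → j < d → ¬ β i ≈ β j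
    β-distinct-< {i} {j} i<j j<d βi≈βj = noShortPeriod (j ∸ i) (ℕ.m<n⇒0<n∸m i<j)
      (ℕ.≤-<-trans (ℕ.m∸n≤m j i) j<d) (φ^-injective i (begin
        φ^ i (β (j ∸ i))       ≈⟨ β-+ i (j ∸ i) ⟨
        β (i ℕ.+ (j ∸ i))      ≡⟨ ≡.cong β (ℕ.m+[n∸m]≡n (ℕ.<⇒≤ i<j)) ⟩
        β j                    ≈⟨ βi≈βj ⟨
        φ^ i α                 ∎))

    β-distinct : ∀ (i j : Fin d) → i ≢ j → ¬ β (Fin.toℕ i) ≈ β (Fin.toℕ j)
    β-distinct i j i≢j p = [ (λ i≤j → β-distinct-< (ℕ.≤∧≢⇒< i≤j toℕ-≢) (Fin.toℕ<n j) p)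
                           , (λ j≤i → β-distinct-< (ℕ.≤∧≢⇒< j≤i (toℕ-≢ ∘ ≡.sym)) (Fin.toℕ<n i) (sym p))
                           ]′ (ℕ.≤-total (Fin.toℕ i) (Fin.toℕ j))
      where
      toℕ-≢ : Fin.toℕ i ≢ Fin.toℕ j
      toℕ-≢ = i≢j ∘ Fin.toℕ-injective

    module _ (p : F[X].Polynomial) (p≤d : F[X].Below (suc d) p)
             (p[α]≈0 : evalι α p ≈ 0#) where

      private
        top = ι⟦ F[X].coefficient p d ⟧

      -- Frobenius fixes the coefficients of p and therefore maps roots to roots. The d distinct
      -- conjugates exhaust a polynomial of degree at most d.
      splits : map ι⟦_⟧ p L[X].≋ L[X].C top L[X].⊗ L[X].∏ d (L[X].X- ∘ β)
      splits = L[X].trans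
        (L[X].linearFactorisation L-isDomain (β ∘ Fin.toℕ {d}) (map ι⟦_⟧ p) (Eι.Below-map p p≤d)
          (λ i → trans (sym (eval-map ι (idHom L) ι (λ _ → refl) (β (Fin.toℕ i)) p))
                 (trans (eval-φ^ (Fin.toℕ i) α p)
                 (trans (it.⟦⟧-cong i p[α]≈0) (it.0#-homo i))))
          β-distinct)
        (L[X].*-congʳ (L[X].C-cong (Eι.coefficient-map p d)))
        where module it (i : Fin d) = RingHom (iterate (Fin.toℕ i))

      module _ (top≉0 : ¬ F[X].coefficient p d F.≈ F.0#) where

        root⇒conjugate : ∀ y → evalι y p ≈ 0# → ∃ λ i → i < d × y ≈ β i
        root⇒conjugate y p[y]≈0 =
          let i , y-βi≈0 = product-≈0 (λ (i : Fin d) → y - β (Fin.toℕ i)) ∏≈0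
          in Fin.toℕ i , Fin.toℕ<n i , x∙y⁻¹≈ε⇒x≈y y _ y-βi≈0
          where
          ∏≈0 : ∏ d (λ i → y - β i) ≈ 0#
          ∏≈0 = [ (λ top≈0 → contradiction top≈0 (ι-≉0 top≉0)) , id ]′ (noZeroDivisor (begin
            top * ∏ d (λ i → y - β i)
              ≈⟨ *-cong (L[X].eval-C y top) (∏-cong d (λ i → L[X].eval-X- y (β i))) ⟨
            L[X].eval y (L[X].C top) * ∏ d (L[X].eval y ∘ L[X].X- ∘ β)
              ≈⟨ *-congˡ (product-homo (L[X].evalHom y) {d} (L[X].X- ∘ β ∘ Fin.toℕ)) ⟨
            L[X].eval y (L[X].C top) * L[X].eval y (L[X].∏ d (L[X].X- ∘ β))
              ≈⟨ L[X].eval-⊗ y _ _ ⟨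
            L[X].eval y (L[X].C top L[X].⊗ L[X].∏ d (L[X].X- ∘ β))
              ≈⟨ L[X].eval-cong refl splits ⟨
            L[X].eval y (map ι⟦_⟧ p)     ≈⟨ eval-map ι (idHom L) ι (λ _ → refl) y p ⟨
            evalι y p                    ≈⟨ p[y]≈0 ⟩
            0#                           ∎))

        -- β_d is again a root of p, hence some β_i with i < d. For i > 0, cancelling φ^i would
        -- leave the forbidden period d - i.
        period : β d ≈ α
        period = returns (root⇒conjugate (β d) (trans (eval-φ^ d α p)
                   (trans (RingHom.⟦⟧-cong (iterate d) p[α]≈0) (RingHom.0#-homo (iterate d)))))
          where
          returns : (∃ λ i → i < d × β d ≈ β i) → β d ≈ α
          returns (zero  , _   , βd≈βi) = βd≈βi
          returns (suc i , i<d , βd≈βi) = contradiction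
            (φ^-injective (suc i) (begin
              φ^ (suc i) (β (d ∸ suc i))       ≈⟨ β-+ (suc i) (d ∸ suc i) ⟨
              β (suc i ℕ.+ (d ∸ suc i))        ≡⟨ ≡.cong β (ℕ.m+[n∸m]≡n (ℕ.<⇒≤ i<d)) ⟩
              β d                              ≈⟨ βd≈βi ⟩
              φ^ (suc i) α                     ∎))
            (noShortPeriod (d ∸ suc i) (ℕ.m<n⇒0<n∸m i<d) (ℕ.∸-monoʳ-< (s≤s z≤n) (ℕ.<⇒≤ i<d)))

        module _ {a} (a≉0 : ¬ a F.≈ F.0#) (m : ℕ) (d≡m+m : d ≡ m ℕ.+ m)
                 (N≉0 : ¬ Quadratic.polynomialNorm F a p F.≈ F.0#)
                 (α′ : Carrier) (αα′≈a : α * α′ ≈ ι⟦ a ⟧) (p[α′]≈0 : evalι α′ p ≈ 0#) where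

          private
            N = Quadratic.polynomialNorm F a p
            module QL = Quadratic L ι⟦ a ⟧

          norm-splits : ι⟦ N ⟧ ≈ top * top * ∏ d (λ i → β i * β i - ι⟦ a ⟧)
          norm-splits = begin
            ι⟦ N ⟧                                   ≈⟨ polynomialNorm-map ι a p ⟩
            QL.polynomialNorm (map ι⟦_⟧ p)           ≈⟨ QL.polynomialNorm-cong splits ⟩
            QL.polynomialNorm (L[X].C top L[X].⊗ L[X].∏ d (L[X].X- ∘ β))
              ≈⟨ QL.polynomialNorm-⊗ _ _ ⟩
            QL.polynomialNorm (L[X].C top) * QL.polynomialNorm (L[X].∏ d (L[X].X- ∘ β))
              ≈⟨ *-cong (QL.polynomialNorm-C top)
                   (trans (QL.polynomialNorm-product {d} (L[X].X- ∘ β ∘ Fin.toℕ))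
                          (∏-cong d (λ i → QL.polynomialNorm-X- (β i)))) ⟩
            top * top * ∏ d (λ i → β i * β i - ι⟦ a ⟧)   ∎

          -- From α′ = α follows α² = a, and then the factor of N(p) at i = 0 is zero.
          α≉α′ : 0 < d → ¬ α′ ≈ α
          α≉α′ 0<d α′≈α = ι-≉0 N≉0 (begin
            ι⟦ N ⟧                                         ≈⟨ norm-splits ⟩
            top * top * ∏ d (λ i → β i * β i - ι⟦ a ⟧)     ≈⟨ *-congˡ (∏≈0 0<d) ⟩
            top * top * 0#                                 ≈⟨ zeroʳ _ ⟩
            0#                                             ∎)
            where
            ∏≈0 : ∀ {k} → 0 < k → ∏ k (λ i → β i * β i - ι⟦ a ⟧) ≈ 0#
            ∏≈0 {suc k} _ = trans (*-congʳ (x≈y⇒x∙y⁻¹≈ε (trans (*-congˡ (sym α′≈α)) αα′≈a))) (zeroˡ _)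

          -- φ^i takes αα′ = a to itself and takes α to α′, so it has to take α′ to a/α′ = α.
          involution : ∀ i → α′ ≈ β i → φ^ i α′ ≈ α
          involution i α′≈βi = *-cancelˡ α′≉0 (begin
            α′ * φ^ i α′       ≈⟨ *-congʳ α′≈βi ⟩
            β i * φ^ i α′      ≈⟨ it.*-homo α α′ ⟨
            φ^ i (α * α′)      ≈⟨ it.⟦⟧-cong αα′≈a ⟩
            φ^ i ι⟦ a ⟧        ≈⟨ φ^-ι i a ⟩
            ι⟦ a ⟧             ≈⟨ αα′≈a ⟨
            α * α′             ≈⟨ *-comm α α′ ⟩
            α′ * α             ∎)
            where
            module it = RingHom (iterate i)
            α′≉0 : ¬ α′ ≈ 0#
            α′≉0 α′≈0 = ι-≉0 a≉0 (trans (sym αα′≈a) (trans (*-congˡ α′≈0) (zeroʳ α)))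

          -- If α′ = β_i, then φ^(2i) fixes α by `involution`. For 0 < i < m this is a period 2i <
          -- d, for i > m it leaves the period 2i - d < d, and i = 0 would mean α′ = α. Only i = m
          -- remains.
          conjugate : β m ≈ α′
          conjugate = identify (root⇒conjugate α′ p[α′]≈0)
            where
            locate : ∀ i → i < d → α′ ≈ β i → β (i ℕ.+ i) ≈ α → Tri (i < m) (i ≡ m) (m < i) → β m ≈ α′
            locate i _ α′≈βi _ (tri≈ _ ≡.refl _) = sym α′≈βi
            locate zero 0<d α′≈α _ (tri< _ _ _) = contradiction α′≈α (α≉α′ 0<d)
            locate i@(suc _) _ _ β2i≈α (tri< i<m _ _) = contradiction β2i≈α
              (noShortPeriod (i ℕ.+ i) (s≤s z≤n) (≡.subst (i ℕ.+ i <_) (≡.sym d≡m+m) (ℕ.+-mono-< i<m i<m)))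
            locate i i<d _ β2i≈α (tri> _ _ m<i) = contradiction
              (begin
                β k             ≈⟨ RingHom.⟦⟧-cong (iterate k) period ⟨
                φ^ k (β d)      ≈⟨ β-+ k d ⟨
                β (k ℕ.+ d)     ≡⟨ ≡.cong β k+d≡2i ⟩
                β (i ℕ.+ i)     ≈⟨ β2i≈α ⟩
                α               ∎)
              (noShortPeriod k (ℕ.m<n⇒0<n∸m d<2i)
                (ℕ.+-cancelʳ-< d k d (≡.subst (_< d ℕ.+ d) (≡.sym k+d≡2i) (ℕ.+-mono-< i<d i<d))))
              where
              k = i ℕ.+ i ∸ d
              d<2i : d < i ℕ.+ i
              d<2i = ≡.subst (_< i ℕ.+ i) (≡.sym d≡m+m) (ℕ.+-mono-< m<i m<i)
              k+d≡2i : k ℕ.+ d ≡ i ℕ.+ i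
              k+d≡2i = ℕ.m∸n+n≡m (ℕ.<⇒≤ d<2i)
            identify : (∃ λ i → i < d × α′ ≈ β i) → β m ≈ α′
            identify (i , i<d , α′≈βi) = locate i i<d α′≈βi
              (trans (β-+ i i) (trans (RingHom.⟦⟧-cong (iterate i) (sym α′≈βi)) (involution i α′≈βi)))
              (ℕ.<-cmp i m)

          private
            δ : ℕ → Carrier
            δ i = β i - β (m ℕ.+ i)

            Δ : Carrier
            Δ = ∏ m δ

            conjugate-+ : ∀ i → β (m ℕ.+ i) ≈ φ^ i α′
            conjugate-+ i = begin
              β (m ℕ.+ i)      ≡⟨ ≡.cong β (ℕ.+-comm m i) ⟩
              β (i ℕ.+ m)      ≈⟨ β-+ i m ⟩
              φ^ i (β m)       ≈⟨ RingHom.⟦⟧-cong (iterate i) conjugate ⟩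
              φ^ i α′          ∎

            βα : ∀ i → β i * β (m ℕ.+ i) ≈ ι⟦ a ⟧
            βα i = begin
              β i * β (m ℕ.+ i)      ≈⟨ *-congˡ (conjugate-+ i) ⟩
              β i * φ^ i α′          ≈⟨ it.*-homo α α′ ⟨
              φ^ i (α * α′)          ≈⟨ it.⟦⟧-cong αα′≈a ⟩
              φ^ i ι⟦ a ⟧            ≈⟨ φ^-ι i a ⟩
              ι⟦ a ⟧                 ∎
              where module it = RingHom (iterate i)

            -- (β² - a)(β′² - a) = - a (β - β′)² whenever ββ′ = a.
            factor : ∀ i → (β i * β i - ι⟦ a ⟧) * (β (m ℕ.+ i) * β (m ℕ.+ i) - ι⟦ a ⟧)
                           ≈ (- ι⟦ a ⟧) * (δ i * δ i)
            factor i = begin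
              (x * x - ι⟦ a ⟧) * (y * y - ι⟦ a ⟧)
                ≈⟨ *-cong (+-congˡ (-‿cong (sym (βα i)))) (+-congˡ (-‿cong (sym (βα i)))) ⟩
              (x * x - x * y) * (y * y - x * y)
                ≈⟨ solve 2 (λ x y → (x :* x :- x :* y) :* (y :* y :- x :* y)
                                    := (:- (x :* y)) :* ((x :- y) :* (x :- y))) refl x y ⟩
              (- (x * y)) * (δ i * δ i)              ≈⟨ *-congʳ (-‿cong (βα i)) ⟩
              (- ι⟦ a ⟧) * (δ i * δ i)               ∎
              where x = β i
                    y = β (m ℕ.+ i)

            -- The product over i < 2m is folded in half, so that index i meets index m + i and
            -- `factor` applies.
            Δ² : ∏ d (λ i → β i * β i - ι⟦ a ⟧) ≈ (- ι⟦ a ⟧) ^ m * (Δ * Δ)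
            Δ² = begin
              ∏ d t                              ≡⟨ ≡.cong (λ k → ∏ k t) d≡m+m ⟩
              ∏ (m ℕ.+ m) t                      ≈⟨ ∏-++ m m t ⟩
              ∏ m t * ∏ m (λ i → t (m ℕ.+ i))    ≈⟨ ∏-* m t (λ i → t (m ℕ.+ i)) ⟨
              ∏ m (λ i → t i * t (m ℕ.+ i))      ≈⟨ ∏-cong m factor ⟩
              ∏ m (λ i → (- ι⟦ a ⟧) * (δ i * δ i))
                ≈⟨ ∏-* m (λ _ → - ι⟦ a ⟧) (λ i → δ i * δ i) ⟩
              ∏ m (λ _ → - ι⟦ a ⟧) * ∏ m (λ i → δ i * δ i)
                ≈⟨ *-cong (Sum.sum-replicate *-commutativeMonoid m) (∏-* m δ δ) ⟩
              (- ι⟦ a ⟧) ^ m * (Δ * Δ)           ∎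
              where t : ℕ → Carrier
                    t i = β i * β i - ι⟦ a ⟧

            -- φ moves δ_i to δ_(i+1), and the factor that enters at the end is δ_m = β_m - β_(2m) =
            -- β_m - β_0 = -δ_0.
            φΔ : 0 < m → φ Δ ≈ - Δ
            φΔ 0<m = begin
              φ Δ                     ≈⟨ product-homo frobenius {m} (δ ∘ Fin.toℕ) ⟩
              ∏ m (φ ∘ δ)             ≈⟨ ∏-cong m (λ i → trans (φ.+-homo (β i) (- β (m ℕ.+ i))) (+-congˡ (φ.-‿homo (β (m ℕ.+ i))))) ⟩
              ∏ m (λ i → φ (β i) - φ (β (m ℕ.+ i)))
                ≈⟨ ∏-cong m (λ i → reflexive (≡.cong (λ k → β (suc i) - β k) (≡.sym (ℕ.+-suc m i)))) ⟩
              ∏ m (δ ∘ suc)           ≈⟨ ∏-anticycle m δ 0<m δm ⟩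
              - Δ                     ∎
              where
              δm : δ m ≈ - δ 0
              δm = begin
                β m - β (m ℕ.+ m)     ≈⟨ +-congˡ (-‿cong (trans (reflexive (≡.cong β (≡.sym d≡m+m))) period)) ⟩
                β m - α               ≈⟨ solve 2 (λ x y → x :- y := :- (y :- x)) refl (β m) α ⟩
                - (α - β m)           ≡⟨ ≡.cong (λ k → - (α - β k)) (ℕ.+-identityʳ m) ⟨
                - (α - β (m ℕ.+ 0))   ∎

          -- (-a)^m N(p) = (c (-a)^m Δ)², and Frobenius changes the sign of Δ.
          nonsquare : 0 < m → ¬ F.1# F.+ F.1# F.≈ F.0# → ∀ y → ¬ y F.* y F.≈ (F.- a) F.^ m F.* N
          -- A square root y in F would satisfy ι(y) = w or ι(y) = -w. Frobenius negates w but fixes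
          -- ι(y), so 2y = 0 and y = 0, although y² is nonzero.
          nonsquare 0<m 2≉0 y yy≈ = y≉0 (y≈0 (ι-injective (begin
            ι⟦ y F.+ y ⟧         ≈⟨ ι.+-homo y y ⟩
            ι⟦ y ⟧ + ι⟦ y ⟧      ≈⟨ +-congʳ (trans (sym (frobenius-ι y)) φιy≈-ιy) ⟩
            - ι⟦ y ⟧ + ι⟦ y ⟧    ≈⟨ -‿inverseˡ _ ⟩
            0#                   ≈⟨ ι.0#-homo ⟨
            ι⟦ F.0# ⟧            ∎)))
            where
            a^m : F.Carrier
            a^m = (F.- a) F.^ m
            c₀ = F[X].coefficient p d F.* a^m
            w = ι⟦ c₀ ⟧ * Δ
            F-^-≉0 : ∀ k {x} → ¬ x F.≈ F.0# → ¬ x F.^ k F.≈ F.0#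
            F-^-≉0 zero    x≉0 = F.1≉0
            F-^-≉0 (suc k) x≉0 = F.*-≉0 x≉0 (F-^-≉0 k x≉0)
            -a≉0 : ¬ F.- a F.≈ F.0#
            -a≉0 p = a≉0 (F.-‿injective (F.trans p (F.sym F.-0#≈0#)))
            y≉0 : ¬ y F.≈ F.0#
            y≉0 p = F.*-≉0 (F-^-≉0 m -a≉0) N≉0 (F.trans (F.sym yy≈)
              (F.trans (F.*-congʳ p) (F.zeroˡ y)))
            y≈0 : y F.+ y F.≈ F.0# → y F.≈ F.0#
            y≈0 p = [ (λ 2≈0 → contradiction 2≈0 2≉0) , id ]′ (F.noZeroDivisor
              (F.trans (F.distribʳ y F.1# F.1#) (F.trans (F.+-cong (F.*-identityˡ y) (F.*-identityˡ y)) p)))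
            ιa^m : ι⟦ a^m ⟧ ≈ (- ι⟦ a ⟧) ^ m
            ιa^m = trans (ι-^ (F.- a) m) (^-congˡ m (ι.-‿homo a))
            φw≈-w : φ w ≈ - w
            φw≈-w = trans (φ.*-homo ι⟦ c₀ ⟧ Δ) (trans (*-cong (frobenius-ι c₀) (φΔ 0<m)) (sym (-‿distribʳ-* _ _)))
            ιyιy≈ww : ι⟦ y ⟧ * ι⟦ y ⟧ ≈ w * w
            ιyιy≈ww = begin
              ι⟦ y ⟧ * ι⟦ y ⟧                    ≈⟨ ι.*-homo y y ⟨
              ι⟦ y F.* y ⟧                       ≈⟨ ι.⟦⟧-cong yy≈ ⟩
              ι⟦ a^m F.* N ⟧                     ≈⟨ ι.*-homo a^m N ⟩
              ι⟦ a^m ⟧ * ι⟦ N ⟧                  ≈⟨ *-congˡ (trans norm-splits (*-congˡ (trans Δ² (*-congʳ (sym ιa^m))))) ⟩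
              ι⟦ a^m ⟧ * (top * top * (ι⟦ a^m ⟧ * (Δ * Δ)))
                ≈⟨ solve 3 (λ u t e → u :* (t :* t :* (u :* (e :* e))) := ((t :* u) :* e) :* ((t :* u) :* e)) refl ι⟦ a^m ⟧ top Δ ⟩
              ((top * ι⟦ a^m ⟧) * Δ) * ((top * ι⟦ a^m ⟧) * Δ)
                ≈⟨ *-cong (*-congʳ (ι.*-homo _ _)) (*-congʳ (ι.*-homo _ _)) ⟨
              w * w                              ∎
            φιy≈-ιy : φ ι⟦ y ⟧ ≈ - ι⟦ y ⟧
            φιy≈-ιy = [ (λ ιy≈w → trans (φ.⟦⟧-cong ιy≈w) (trans φw≈-w (-‿cong (sym ιy≈w))))
                      , (λ ιy≈-w → trans (φ.⟦⟧-cong ιy≈-w) (trans (φ.-‿homo w) (-‿cong (trans φw≈-w (sym ιy≈-w)))))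
                      ]′ (y²≈z²⇒y≈±z ιyιy≈ww)

-- Quotient by a principal ideal

module Quotient (R : CommutativeRing c ℓ) (p : CommutativeRing.Carrier R) where

  open CommutativeRing R hiding (zero)
  open SetoidReasoning setoid
  open IntegerCoefficients R using (solve; _:+_; _:*_; _:-_; :-_; _:=_; con)

  infix 4 _~_
  -- The multiplier is part of the data, so that an element congruent to zero comes with its
  -- cofactor; `kernel` returns that cofactor later.
  record _~_ (x y : Carrier) : Set (c ⊔ ℓ) where
    constructor _,_
    field
      multiple : Carrier
      equation : x ≈ y + multiple * p

  ≈⇒~ : ∀ {x y} → x ≈ y → x ~ y
  ≈⇒~ {x} {y} x≈y = 0# , trans x≈y (solve 2 (λ y p → y := y :+ con (+ 0) :* p) refl y p)

  quotientRing : CommutativeRing c (c ⊔ ℓ)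
  quotientRing = commutativeRingʳ {_≈_ = _~_}
    (record
      { refl  = ≈⇒~ refl
      ; sym   = λ {x} {y} (h , x≈) → - h , (begin
          y                              ≈⟨ solve 3 (λ y h p → y := (y :+ h :* p) :+ (:- h) :* p) refl y h p ⟩
          (y + h * p) + - h * p          ≈⟨ +-congʳ x≈ ⟨
          x + - h * p                    ∎)
      ; trans = λ {x} {y} {z} (h , x≈) (k , y≈) → h + k , (begin
          x                              ≈⟨ trans x≈ (+-congʳ y≈) ⟩
          (z + k * p) + h * p            ≈⟨ solve 4 (λ z k h p → (z :+ k :* p) :+ h :* p := z :+ (h :+ k) :* p) refl z k h p ⟩
          z + (h + k) * p                ∎)
      })
    (λ {x} {y} {u} {v} (h , x≈) (k , u≈) → h + k , (begin
      x + u                              ≈⟨ +-cong x≈ u≈ ⟩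
      (y + h * p) + (v + k * p)
        ≈⟨ solve 5 (λ y h v k p → (y :+ h :* p) :+ (v :+ k :* p) := (y :+ v) :+ (h :+ k) :* p) refl y h v k p ⟩
      (y + v) + (h + k) * p              ∎))
    (λ {x} {y} {u} {v} (h , x≈) (k , u≈) → h * v + y * k + h * p * k , (begin
      x * u                              ≈⟨ *-cong x≈ u≈ ⟩
      (y + h * p) * (v + k * p)
        ≈⟨ solve 5 (λ y h v k p → (y :+ h :* p) :* (v :+ k :* p)
                                  := y :* v :+ (h :* v :+ y :* k :+ h :* p :* k) :* p) refl y h v k p ⟩
      y * v + (h * v + y * k + h * p * k) * p   ∎))
    (λ {x} {y} (h , x≈) → - h , (begin
      - x                                ≈⟨ -‿cong x≈ ⟩
      - (y + h * p)                      ≈⟨ solve 3 (λ y h p → :- (y :+ h :* p) := :- y :+ (:- h) :* p) refl y h p ⟩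
      - y + - h * p                      ∎))
    (λ x y z → ≈⇒~ (+-assoc x y z))
    (λ x y → ≈⇒~ (+-comm x y))
    (λ x → ≈⇒~ (+-identityˡ x))
    (λ x → ≈⇒~ (-‿inverseˡ x))
    (λ x y z → ≈⇒~ (*-assoc x y z))
    (λ x y → ≈⇒~ (*-comm x y))
    (λ x → ≈⇒~ (*-identityˡ x))
    (λ x y z → ≈⇒~ (distribʳ x y z))

  p~0 : p ~ 0#
  p~0 = 1# , solve 1 (λ p → p := con (+ 0) :+ con (+ 1) :* p) refl p

  ~0⇒multiple : ∀ {x} → x ~ 0# → ∃ λ h → x ≈ h * p
  ~0⇒multiple (h , x≈) = h , trans x≈ (+-identityˡ (h * p))

-- Degrees, Euclidean division and root fields

module FieldPolynomials (F : CommutativeRing c ℓ) (isField : IsField F) where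

  open CommutativeRing F hiding (zero)
  open RingProperties ring
  open IsField isField
  open IsDomain isDomain hiding (1≉0)
  open PolynomialRing F
  private module P = CommutativeRing polynomialRing
  open IntegerCoefficients polynomialRing using (solve; _:+_; _:*_; _:-_; :-_; _:=_; con)
  private module ≈-Reasoning = SetoidReasoning setoid
  private module ≋-Reasoning = SetoidReasoning P.setoid

  record HasDegree (N : ℕ) (f : Polynomial) : Set ℓ where
    constructor _,_
    field
      bound     : Below (suc N) f
      leading≉0 : ¬ coefficient f N ≈ 0#
  open HasDegree public

  -- Trailing zeros are tested from the end of the list, each test being decided by `invert`.
  degree : ∀ f → f ≋ [] ⊎ ∃ λ N → HasDegree N f
  degree []      = inj₁ P.refl
  degree (b ∷ f) = [ constant , (λ (N , f≤N , fN≉0) → inj₂ (suc N , Below-∷ {b = b} {f} f≤N , fN≉0)) ]′ (degree f)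
    where
    constant : f ≋ [] → b ∷ f ≋ [] ⊎ ∃ λ N → HasDegree N (b ∷ f)
    constant f≋[] with invert b
    ... | inj₁ b≈0            = inj₁ (0∷[]≋[] b≈0 f≋[])
    ... | inj₂ (b⁻¹ , bb⁻¹≈1) = inj₂ (0 , (λ { (suc i) _ → at f≋[] i })
      , λ b≈0 → 1≉0 (trans (sym bb⁻¹≈1) (trans (*-congʳ b≈0) (zeroˡ b⁻¹))))

  HasDegree-cong : ∀ {N f g} → f ≋ g → HasDegree N f → HasDegree N g
  HasDegree-cong f≋g (f≤N , fN≉0) = Below-cong f≋g f≤N , λ gN≈0 → fN≉0 (trans (at f≋g _) gN≈0)

  HasDegree-⊗ : ∀ {M N f g} → HasDegree M f → HasDegree N g → HasDegree (M ℕ.+ N) (f ⊗ g)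
  HasDegree-⊗ {M} {N} {f} {g} (f≤M , fM≉0) (g≤N , gN≉0) =
    Below-⊗ M N f g f≤M g≤N ,
    λ p → *-≉0 fM≉0 gN≉0 (trans (sym (coefficient-top-⊗ M N f g f≤M g≤N)) p)

  HasDegree⇒≉ : ∀ {N f} → HasDegree N f → ¬ f ≋ []
  HasDegree⇒≉ (_ , fN≉0) f≋[] = fN≉0 (at f≋[] _)

  HasDegree-Below : ∀ {N k f} → HasDegree N f → Below k f → N < k
  HasDegree-Below {N} {k} (_ , fN≉0) f<k = ℕ.≰⇒> (λ k≤N → fN≉0 (f<k N k≤N))

  HasDegree-unique : ∀ {M N f} → HasDegree M f → HasDegree N f → M ≡ N
  HasDegree-unique f° f°′ = ℕ.≤-antisym (ℕ.≤-pred (HasDegree-Below f° (bound f°′)))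
                                        (ℕ.≤-pred (HasDegree-Below f°′ (bound f°)))

  multiple-Below : ∀ {d p} → HasDegree d p → ∀ e → Below d (e ⊗ p) → e ≋ []
  multiple-Below {d} {p} p° e ep<d = [ id , (λ (N , e°) → contradiction
    (HasDegree-Below (HasDegree-⊗ {f = e} {p} e° p°) ep<d) (ℕ.≤⇒≯ (ℕ.m≤n+m d N))) ]′ (degree e)

  polynomialsDomain : IsDomain polynomialRing
  polynomialsDomain = record
    { 1≉0 = λ 𝟙≋[] → 1≉0 (trans (sym (coefficient-C 1#)) (at (P.trans C-1 𝟙≋[]) 0))
    ; noZeroDivisor = λ {f} {g} fg≋[] → zeroDivisor f g fg≋[] (degree f) (degree g)
    }
    where
    zeroDivisor : ∀ f g → f ⊗ g ≋ [] → (f ≋ [] ⊎ ∃ λ N → HasDegree N f) →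
                  (g ≋ [] ⊎ ∃ λ N → HasDegree N g) → f ≋ [] ⊎ g ≋ []
    zeroDivisor f g fg≋[] (inj₁ f≋[])     _               = inj₁ f≋[]
    zeroDivisor f g fg≋[] (inj₂ _)        (inj₁ g≋[])     = inj₂ g≋[]
    zeroDivisor f g fg≋[] (inj₂ (_ , f°)) (inj₂ (_ , g°)) =
      contradiction fg≋[] (HasDegree⇒≉ (HasDegree-⊗ {f = f} {g} f° g°))

  HasDegree-factor : ∀ {d p} → HasDegree d p → ∀ f {N} → HasDegree N (p ⊗ f) →
                     ∃ λ M → HasDegree M f × N ≡ d ℕ.+ M
  HasDegree-factor {d} {p} p° f pf° =
    [ (λ f≋[] → contradiction (P.trans (P.*-congˡ f≋[]) (P.zeroʳ p)) (HasDegree⇒≉ pf°))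
    , (λ (M , f°) → M , f° , HasDegree-unique {f = p ⊗ f} pf° (HasDegree-⊗ {f = p} {f} p° f°)) ]′ (degree f)

  divide : ∀ {d g} → HasDegree d g → ∀ f → ∃ λ s → ∃ λ r → f ≋ (s ⊗ g) ⊕ r × Below d r
  divide {d} {g} g° [] = [] , [] , P.sym (P.trans (P.+-identityʳ _) (P.zeroˡ g)) , λ _ _ → refl
  divide {d} {g} g°@(g≤d , gd≉0) (b ∷ f) =
    let s , r , f≋sg+r , r<d = divide g° f
        g⁻¹ , gg⁻¹≈1 = inverse gd≉0
        t = b ∷ r
        t≤d = Below-∷ {b = b} {r} r<d
        -- The remainder r of the tail turns into b + X r, of degree at most d; k is the multiple of
        -- g that cancels its coefficient of x^d.
        k = coefficient t d * g⁻¹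
        r′ = t ⊕ (⊖ (C k ⊗ g))
    in (X ⊗ s) ⊕ C k , r′ , (let open ≋-Reasoning in begin
      b ∷ f                                    ≈⟨ ∷-≋ b f ⟩
      C b ⊕ (X ⊗ f)                            ≈⟨ P.+-congˡ (P.*-congˡ f≋sg+r) ⟩
      C b ⊕ (X ⊗ ((s ⊗ g) ⊕ r))
        ≈⟨ solve 6 (λ b x s g r k → b :+ x :* (s :* g :+ r) := (x :* s :+ k) :* g :+ ((b :+ x :* r) :- k :* g))
             P.refl (C b) X s g r (C k) ⟩
      (((X ⊗ s) ⊕ C k) ⊗ g) ⊕ ((C b ⊕ (X ⊗ r)) ⊕ (⊖ (C k ⊗ g)))
                                               ≈⟨ P.+-congˡ (P.+-congʳ (∷-≋ b r)) ⟨
      (((X ⊗ s) ⊕ C k) ⊗ g) ⊕ r′               ∎)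
    , Below-lower r′ (Below-⊕ t (⊖ (C k ⊗ g)) t≤d (Below-⊖ (C k ⊗ g) (Below-C⊗ k g g≤d)))
        (let open ≈-Reasoning in begin
        coefficient r′ d                                         ≈⟨ coefficient-⊕ t (⊖ (C k ⊗ g)) d ⟩
        coefficient t d + coefficient (⊖ (C k ⊗ g)) d
          ≈⟨ +-congˡ (trans (coefficient-⊖ (C k ⊗ g) d) (-‿cong (coefficient-C⊗ k g d))) ⟩
        coefficient t d - k * coefficient g d
          ≈⟨ +-congˡ (-‿cong (trans (*-assoc _ _ _) (*-congˡ (trans (*-comm _ _) gg⁻¹≈1)))) ⟩
        coefficient t d - coefficient t d * 1#                   ≈⟨ x≈y⇒x∙y⁻¹≈ε (sym (*-identityʳ _)) ⟩
        0#                                                       ∎)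

  record Bézout (f g : Polynomial) : Set (c ⊔ ℓ) where
    field
      divisor u v w z : Polynomial
      combination : divisor ≋ (u ⊗ f) ⊕ (v ⊗ g)
      divides-f   : f ≋ w ⊗ divisor
      divides-g   : g ≋ z ⊗ divisor

  -- Euclid's algorithm on (f, g). The number n is a decreasing bound for the second entry: a
  -- remainder modulo g stays below the degree of g, which itself is less than the current bound.
  bézout : ∀ n f g → Below n g → Bézout f g
  bézout n f g g<n = [ (λ g≋[] → record
      { divisor = f ; u = 𝟙 ; v = [] ; w = 𝟙 ; z = []
      ; combination = solve 2 (λ f g → f := con (+ 1) :* f :+ con (+ 0) :* g) P.refl f g
      ; divides-f = P.sym (P.*-identityˡ f)
      ; divides-g = P.trans g≋[] (P.sym (P.zeroˡ f))
      })
    , (λ (N , g°) → step n g<n g°) ]′ (degree g)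
    where
    step : ∀ n {N} → Below n g → HasDegree N g → Bézout f g
    step zero    g<0 (_ , gN≉0) = contradiction (g<0 _ z≤n) gN≉0
    step (suc n) g≤n g° =
      let s , r , f≋sg+r , r<N = divide g° f
          open Bézout (bézout n g r (Below-mono {f = r} (ℕ.≤-pred (HasDegree-Below {f = g} g° g≤n)) r<N))
      in record
      { divisor = divisor ; u = v ; v = u ⊕ (⊖ (v ⊗ s)) ; w = (s ⊗ w) ⊕ z ; z = w
      ; combination = (let open ≋-Reasoning in begin
          divisor                                    ≈⟨ combination ⟩
          (u ⊗ g) ⊕ (v ⊗ r)
            ≈⟨ solve 5 (λ u g v r s → u :* g :+ v :* r := v :* (s :* g :+ r) :+ (u :- v :* s) :* g) P.refl u g v r s ⟩
          (v ⊗ ((s ⊗ g) ⊕ r)) ⊕ ((u ⊕ (⊖ (v ⊗ s))) ⊗ g)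
                                                     ≈⟨ P.+-congʳ (P.*-congˡ f≋sg+r) ⟨
          (v ⊗ f) ⊕ ((u ⊕ (⊖ (v ⊗ s))) ⊗ g)          ∎)
      ; divides-f = (let open ≋-Reasoning in begin
          f                                          ≈⟨ f≋sg+r ⟩
          (s ⊗ g) ⊕ r                                ≈⟨ P.+-cong (P.*-congˡ divides-f) divides-g ⟩
          (s ⊗ (w ⊗ divisor)) ⊕ (z ⊗ divisor)
            ≈⟨ solve 4 (λ s w z d → s :* (w :* d) :+ z :* d := (s :* w :+ z) :* d) P.refl s w z divisor ⟩
          ((s ⊗ w) ⊕ z) ⊗ divisor                    ∎)
      ; divides-g = divides-f
      }

  IsUnit : Polynomial → Set (c ⊔ ℓ)
  IsUnit f = ∃ λ g → g ⊗ f ≋ 𝟙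

  -- Stated with the opaque product, so that both factors can be inferred from an equation;
  -- `irreducible-raw` translates the notion used in the theorem.
  record Irreducible (p : Polynomial) : Set (c ⊔ ℓ) where
    field
      nonUnit : ¬ IsUnit p
      split   : ∀ {f g} → p ≋ f ⊗ g → IsUnit f ⊎ IsUnit g

  module RootField {p} (irreducible : Irreducible p) where
    open Irreducible irreducible
    open Quotient polynomialRing p public

    rootField : IsField quotientRing
    rootField = record
      { 1≉0    = λ (h , 𝟙≋) → nonUnit (h , P.sym (P.trans 𝟙≋ (P.+-identityˡ _)))
      ; invert = invertible
      }
      where
      -- Let p = w g and f = z g with g the divisor found by Bézout. If w is a unit, then p divides
      -- f; otherwise g is a unit, and its expression through p and f gives an inverse of f modulo
      -- p.
      invertible : ∀ f → f ~ [] ⊎ ∃ λ g → f ⊗ g ~ 𝟙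
      invertible f = [ (λ (k , kw≋𝟙) → inj₁ (z ⊗ k , (let open ≋-Reasoning in begin
          f                              ≈⟨ divides-g ⟩
          z ⊗ divisor                    ≈⟨ P.*-congˡ (P.*-identityˡ divisor) ⟨
          z ⊗ (𝟙 ⊗ divisor)              ≈⟨ P.*-congˡ (P.*-congʳ kw≋𝟙) ⟨
          z ⊗ ((k ⊗ w) ⊗ divisor)        ≈⟨ solve 4 (λ z k w d → z :* ((k :* w) :* d) := con (+ 0) :+ z :* k :* (w :* d)) P.refl z k w divisor ⟩
          [] ⊕ ((z ⊗ k) ⊗ (w ⊗ divisor)) ≈⟨ P.+-congˡ (P.*-congˡ divides-f) ⟨
          [] ⊕ ((z ⊗ k) ⊗ p)             ∎)))
        , (λ (k , kd≋𝟙) → inj₂ (k ⊗ v , ⊖ (k ⊗ u) , (let open ≋-Reasoning in begin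
          f ⊗ (k ⊗ v)
            ≈⟨ solve 5 (λ f k v u p → f :* (k :* v) := k :* (u :* p :+ v :* f) :+ (:- (k :* u)) :* p) P.refl f k v u p ⟩
          (k ⊗ ((u ⊗ p) ⊕ (v ⊗ f))) ⊕ ((⊖ (k ⊗ u)) ⊗ p)
            ≈⟨ P.+-congʳ (P.trans (P.*-congˡ (P.sym combination)) kd≋𝟙) ⟩
          𝟙 ⊕ ((⊖ (k ⊗ u)) ⊗ p)          ∎)))
        ]′ (split divides-f)
        where open Bézout (bézout (Data.List.Base.length f) p f (length-Below f))

    private module L = CommutativeRing quotientRing

    constant : RingHom F quotientRing
    constant = record
      { ⟦_⟧     = C
      ; ⟦⟧-cong = ≈⇒~ ∘ C-cong
      ; +-homo  = λ x y → ≈⇒~ (C-homo-+ x y)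
      ; *-homo  = λ x y → ≈⇒~ (C-homo-* x y)
      ; 1#-homo = ≈⇒~ C-1
      }

    open Evaluation constant using (eval)

    eval-root : ∀ f → eval X f ~ f
    eval-root []      = L.refl
    eval-root (b ∷ f) = L.trans (L.+-congˡ {C b} (L.*-congˡ {X} (eval-root f))) (L.sym (≈⇒~ (∷-≋ b f)))

  -- `root` and `kernel` together say that the polynomials vanishing at α are the multiples of p.
  -- Besides being a field over F, nothing else is used of F[x]/p, and the opaque instance below
  -- keeps the quotient from unfolding.
  record RootExtension (p : Polynomial) : Set (Level.suc (c ⊔ ℓ)) where
    field
      extension : CommutativeRing c (c ⊔ ℓ)
      isFieldᴸ  : IsField extension
      ι         : RingHom F extension
      α         : CommutativeRing.Carrier extension
    open CommutativeRing extension using () renaming (_≈_ to _≈ᴸ_; 0# to 0ᴸ) public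
    open Evaluation ι using (eval) public
    field
      root      : eval α p ≈ᴸ 0ᴸ
      kernel    : ∀ f → eval α f ≈ᴸ 0ᴸ → ∃ λ h → f ≋ h ⊗ p

  opaque
    rootExtension : ∀ {p} → Irreducible p → RootExtension p
    rootExtension {p} irreducible = record
      { extension = quotientRing
      ; isFieldᴸ  = rootField
      ; ι         = constant
      ; α         = X
      ; root      = L.trans {eval X p} {p} {[]} (eval-root p) p~0
      ; kernel    = λ f f[α]~0 → ~0⇒multiple (L.trans {f} {eval X f} {[]} (L.sym {eval X f} {f} (eval-root f)) f[α]~0)
      }
      where
      open RootField irreducible
      module L = CommutativeRing quotientRing
      open Evaluation constant using (eval)

-- Reversal of polynomials

module Reversal (R : CommutativeRing c ℓ) (a : CommutativeRing.Carrier R) where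

  open CommutativeRing R hiding (zero)
  open Exp commutativeSemiring using (_^_; ^-homo-*)
  open PolynomialRing R
  private
    module P where
      open CommutativeRing polynomialRing public
      open Exp (CommutativeRing.commutativeSemiring polynomialRing) public using (_^_)
    module ≈-Reasoning = SetoidReasoning setoid
    module ≋-Reasoning = SetoidReasoning P.setoid
    module RS = IntegerCoefficients R
  open IntegerCoefficients polynomialRing using (solve; _:+_; _:*_; _:-_; :-_; _:=_; con)

  coefficient-applyUpTo-< : ∀ g n {i} → i < n → coefficient (applyUpTo g n) i ≡ g i
  coefficient-applyUpTo-< g (suc n) {zero}  _         = ≡.refl
  coefficient-applyUpTo-< g (suc n) {suc i} (s≤s i<n) = coefficient-applyUpTo-< (g ∘ suc) n i<n

  coefficient-applyUpTo-≥ : ∀ g n {i} → n ≤ i → coefficient (applyUpTo g n) i ≡ 0#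
  coefficient-applyUpTo-≥ g zero            _         = ≡.refl
  coefficient-applyUpTo-≥ g (suc n) {suc i} (s≤s n≤i) = coefficient-applyUpTo-≥ (g ∘ suc) n n≤i

  -- x^N f(a/x)
  reversal : ℕ → Polynomial → Polynomial
  reversal N f = applyUpTo (λ j → coefficient f (N ∸ j) * a ^ (N ∸ j)) (suc N)

  coefficient-reversal : ∀ N f {i} → i ≤ N →
    coefficient (reversal N f) i ≈ coefficient f (N ∸ i) * a ^ (N ∸ i)
  coefficient-reversal N f i≤N = reflexive (coefficient-applyUpTo-<
    (λ j → coefficient f (N ∸ j) * a ^ (N ∸ j)) (suc N) (s≤s i≤N))

  Below-reversal : ∀ N f → Below (suc N) (reversal N f)
  Below-reversal N f i N<i = reflexive (coefficient-applyUpTo-≥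
    (λ j → coefficient f (N ∸ j) * a ^ (N ∸ j)) (suc N) N<i)

  reversal-ext : ∀ N f {g} → (∀ i → i ≤ N → coefficient f (N ∸ i) * a ^ (N ∸ i) ≈ coefficient g i) →
                 Below (suc N) g → reversal N f ≋ g
  reversal-ext N f {g} low g≤N = pointwise λ i →
    [ (λ i≤N → trans (coefficient-reversal N f i≤N) (low i i≤N))
    , (λ N<i → trans (Below-reversal N f i N<i) (sym (g≤N i N<i)))
    ]′ (ℕ.≤-<-connex i N)

  reversal-cong : ∀ N {f g} → f ≋ g → reversal N f ≋ reversal N g
  reversal-cong N {f} {g} f≋g = reversal-ext N f
    (λ i i≤N → trans (*-congʳ (at f≋g (N ∸ i))) (sym (coefficient-reversal N g i≤N))) (Below-reversal N g)

  reversal-[] : ∀ N → reversal N [] ≋ []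
  reversal-[] N = reversal-ext N [] (λ _ _ → zeroˡ _) (λ _ _ → refl)

  reversal-⊕ : ∀ N f g → reversal N (f ⊕ g) ≋ reversal N f ⊕ reversal N g
  reversal-⊕ N f g = reversal-ext N (f ⊕ g) (λ i i≤N → let open ≈-Reasoning in begin
    coefficient (f ⊕ g) (N ∸ i) * a ^ (N ∸ i)               ≈⟨ *-congʳ (coefficient-⊕ f g (N ∸ i)) ⟩
    (coefficient f (N ∸ i) + coefficient g (N ∸ i)) * a ^ (N ∸ i)
                                                            ≈⟨ distribʳ _ _ _ ⟩
    coefficient f (N ∸ i) * a ^ (N ∸ i) + coefficient g (N ∸ i) * a ^ (N ∸ i)
      ≈⟨ +-cong (coefficient-reversal N f i≤N) (coefficient-reversal N g i≤N) ⟨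
    coefficient (reversal N f) i + coefficient (reversal N g) i
                                                            ≈⟨ coefficient-⊕ (reversal N f) (reversal N g) i ⟨
    coefficient (reversal N f ⊕ reversal N g) i             ∎)
    (Below-⊕ (reversal N f) (reversal N g) (Below-reversal N f) (Below-reversal N g))

  reversal-C⊗ : ∀ N b f → reversal N (C b ⊗ f) ≋ C b ⊗ reversal N f
  reversal-C⊗ N b f = reversal-ext N (C b ⊗ f) (λ i i≤N → let open ≈-Reasoning in begin
    coefficient (C b ⊗ f) (N ∸ i) * a ^ (N ∸ i)             ≈⟨ *-congʳ (coefficient-C⊗ b f (N ∸ i)) ⟩
    (b * coefficient f (N ∸ i)) * a ^ (N ∸ i)               ≈⟨ *-assoc _ _ _ ⟩
    b * (coefficient f (N ∸ i) * a ^ (N ∸ i))               ≈⟨ *-congˡ (coefficient-reversal N f i≤N) ⟨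
    b * coefficient (reversal N f) i                        ≈⟨ coefficient-C⊗ b (reversal N f) i ⟨
    coefficient (C b ⊗ reversal N f) i                      ∎)
    (Below-C⊗ b (reversal N f) (Below-reversal N f))

  -- The identity x^(N+1) (a/x) f(a/x) = a x^N f(a/x).
  reversal-X⊗ : ∀ N f → reversal (suc N) (X ⊗ f) ≋ C a ⊗ reversal N f
  reversal-X⊗ N f = P.trans (reversal-cong (suc N) (X-⊗ f))
    (reversal-ext (suc N) (0# ∷ f) low
      (Below-mono {f = C a ⊗ reversal N f} (ℕ.n≤1+n (suc N)) (Below-C⊗ a (reversal N f) (Below-reversal N f))))
    where
    low : ∀ i → i ≤ suc N → coefficient (0# ∷ f) (suc N ∸ i) * a ^ (suc N ∸ i) ≈ coefficient (C a ⊗ reversal N f) i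
    low i i≤1+N with ℕ.m≤n⇒m<n∨m≡n i≤1+N
    ... | inj₂ ≡.refl rewrite ℕ.n∸n≡0 (suc N) = trans (zeroˡ _)
      (sym (Below-C⊗ a (reversal N f) (Below-reversal N f) (suc N) ℕ.≤-refl))
    ... | inj₁ (s≤s i≤N) rewrite ℕ.+-∸-assoc 1 i≤N = let open ≈-Reasoning in begin
      coefficient f (N ∸ i) * (a * a ^ (N ∸ i))
        ≈⟨ RS.solve 3 (λ f a e → f RS.:* (a RS.:* e) RS.:= a RS.:* (f RS.:* e)) refl _ _ _ ⟩
      a * (coefficient f (N ∸ i) * a ^ (N ∸ i))      ≈⟨ *-congˡ (coefficient-reversal N f i≤N) ⟨
      a * coefficient (reversal N f) i               ≈⟨ coefficient-C⊗ a (reversal N f) i ⟨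
      coefficient (C a ⊗ reversal N f) i             ∎

  -- Reversing in a degree that is too large by k turns the k vanishing top coefficients into k
  -- leading zeros of the list, that is, into a factor x^k.
  reversal-raise : ∀ k N f → Below (suc N) f → reversal (k ℕ.+ N) f ≋ X P.^ k ⊗ reversal N f
  reversal-raise zero    N f f≤N = P.sym (P.*-identityˡ _)
  reversal-raise (suc k) N f f≤N = let open ≋-Reasoning in begin
    reversal (suc (k ℕ.+ N)) f              ≈⟨ ∷-cong (trans (*-congʳ (f≤N (suc (k ℕ.+ N)) (s≤s (ℕ.m≤n+m N k)))) (zeroˡ _)) P.refl ⟩
    0# ∷ reversal (k ℕ.+ N) f               ≈⟨ X-⊗ (reversal (k ℕ.+ N) f) ⟨
    X ⊗ reversal (k ℕ.+ N) f                ≈⟨ P.*-congˡ (reversal-raise k N f f≤N) ⟩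
    X ⊗ (X P.^ k ⊗ reversal N f)            ≈⟨ P.*-assoc _ _ _ ⟨
    X P.^ suc k ⊗ reversal N f              ∎

  reversal-0 : ∀ f → reversal 0 f ≋ C (coefficient f 0)
  reversal-0 f = P.trans (Below-1⇒C (Below-reversal 0 f)) (C-cong (*-identityʳ _))

  reversal-C : ∀ N b → reversal N (C b) ≋ C b ⊗ X P.^ N
  reversal-C N b = let open ≋-Reasoning in begin
    reversal N (C b)              ≡⟨ ≡.cong (λ k → reversal k (C b)) (ℕ.+-identityʳ N) ⟨
    reversal (N ℕ.+ 0) (C b)      ≈⟨ reversal-raise N 0 (C b) (Below-C b) ⟩
    X P.^ N ⊗ reversal 0 (C b)    ≈⟨ P.*-congˡ (P.trans (reversal-0 (C b)) (C-cong (coefficient-C b))) ⟩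
    X P.^ N ⊗ C b                 ≈⟨ P.*-comm _ _ ⟩
    C b ⊗ X P.^ N                 ∎

  reversal-∷ : ∀ N b f → reversal (suc N) (b ∷ f) ≋ (C b ⊗ X P.^ suc N) ⊕ (C a ⊗ reversal N f)
  reversal-∷ N b f = P.trans (reversal-cong (suc N) (∷-≋ b f)) (P.trans (reversal-⊕ (suc N) (C b) (X ⊗ f))
    (P.+-cong (reversal-C (suc N) b) (reversal-X⊗ N f)))

  -- Formally x^(M+N) f(a/x) g(a/x) splits at once into two factors. As a/x is no polynomial, the
  -- proof is an induction on M through f = b + X f′.
  reversal-⊗ : ∀ M N f g → Below (suc M) f → Below (suc N) g →
               reversal (M ℕ.+ N) (f ⊗ g) ≋ reversal M f ⊗ reversal N g
  reversal-⊗ zero    N f       g f≤M g≤N = let open ≋-Reasoning in begin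
    reversal N (f ⊗ g)                      ≈⟨ reversal-cong N (P.*-congʳ (Below-1⇒C f≤M)) ⟩
    reversal N (C (coefficient f 0) ⊗ g)    ≈⟨ reversal-C⊗ N _ g ⟩
    C (coefficient f 0) ⊗ reversal N g      ≈⟨ P.*-congʳ (reversal-0 f) ⟨
    reversal 0 f ⊗ reversal N g             ∎
  reversal-⊗ (suc M) N []      g f≤M g≤N = let open ≋-Reasoning in begin
    reversal (suc M ℕ.+ N) ([] ⊗ g)         ≈⟨ reversal-cong (suc M ℕ.+ N) (P.zeroˡ g) ⟩
    reversal (suc M ℕ.+ N) []               ≈⟨ reversal-[] (suc M ℕ.+ N) ⟩
    []                                      ≈⟨ P.zeroˡ _ ⟨
    [] ⊗ reversal N g                       ≈⟨ P.*-congʳ (reversal-[] (suc M)) ⟨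
    reversal (suc M) [] ⊗ reversal N g      ∎
  reversal-⊗ (suc M) N (b ∷ f) g f≤M g≤N = let open ≋-Reasoning in begin
    reversal K ((b ∷ f) ⊗ g)
      ≈⟨ reversal-cong K (P.trans (P.*-congʳ (∷-≋ b f))
           (solve 4 (λ b x f g → (b :+ x :* f) :* g := b :* g :+ x :* (f :* g)) P.refl (C b) X f g)) ⟩
    reversal K ((C b ⊗ g) ⊕ (X ⊗ (f ⊗ g)))                   ≈⟨ reversal-⊕ K _ _ ⟩
    reversal K (C b ⊗ g) ⊕ reversal K (X ⊗ (f ⊗ g))
      ≈⟨ P.+-cong (P.trans (reversal-C⊗ K b g) (P.*-congˡ (reversal-raise (suc M) N g g≤N)))
                  (P.trans (reversal-X⊗ (M ℕ.+ N) (f ⊗ g)) (P.*-congˡ (reversal-⊗ M N f g (Below-tail {b = b} {f} f≤M) g≤N))) ⟩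
    (C b ⊗ (X P.^ suc M ⊗ g′)) ⊕ (C a ⊗ (reversal M f ⊗ g′))
      ≈⟨ solve 5 (λ b x g a f → b :* (x :* g) :+ a :* (f :* g) := (b :* x :+ a :* f) :* g) P.refl (C b) (X P.^ suc M) g′ (C a) (reversal M f) ⟩
    ((C b ⊗ X P.^ suc M) ⊕ (C a ⊗ reversal M f)) ⊗ g′        ≈⟨ P.*-congʳ (reversal-∷ M b f) ⟨
    reversal (suc M) (b ∷ f) ⊗ g′                            ∎
    where K = suc (M ℕ.+ N)
          g′ = reversal N g

  -- Substituting a/x twice gives x back, and the powers in front combine to x^N (a/x)^N = a^N.
  reversal-reversal : ∀ N f → Below (suc N) f → reversal N (reversal N f) ≋ C (a ^ N) ⊗ f
  reversal-reversal N f f≤N = reversal-ext N (reversal N f) (λ i i≤N → let open ≈-Reasoning in begin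
    coefficient (reversal N f) (N ∸ i) * a ^ (N ∸ i)
      ≈⟨ *-congʳ (coefficient-reversal N f (ℕ.m∸n≤m N i)) ⟩
    coefficient f (N ∸ (N ∸ i)) * a ^ (N ∸ (N ∸ i)) * a ^ (N ∸ i)
      ≡⟨ ≡.cong (λ k → coefficient f k * a ^ k * a ^ (N ∸ i)) (ℕ.m∸[m∸n]≡n i≤N) ⟩
    coefficient f i * a ^ i * a ^ (N ∸ i)
      ≈⟨ RS.solve 3 (λ f u v → f RS.:* u RS.:* v RS.:= (u RS.:* v) RS.:* f) refl _ _ _ ⟩
    (a ^ i * a ^ (N ∸ i)) * coefficient f i          ≈⟨ *-congʳ (^-homo-* a i (N ∸ i)) ⟨
    a ^ (i ℕ.+ (N ∸ i)) * coefficient f i            ≡⟨ ≡.cong (λ k → a ^ k * coefficient f i) (ℕ.m+[n∸m]≡n i≤N) ⟩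
    a ^ N * coefficient f i                          ≈⟨ coefficient-C⊗ (a ^ N) f i ⟨
    coefficient (C (a ^ N) ⊗ f) i                    ∎)
    (Below-C⊗ (a ^ N) f f≤N)

  coefficient-top-reversal : ∀ N f → coefficient (reversal N f) N ≈ coefficient f 0
  coefficient-top-reversal N f = trans (coefficient-reversal N f ℕ.≤-refl) (trans
    (reflexive (≡.cong (λ k → coefficient f k * a ^ k) (ℕ.n∸n≡0 N))) (*-identityʳ _))

  module _ {S : CommutativeRing c′ ℓ′} (h : RingHom R S) where
    private
      module S where
        open CommutativeRing S public
        open Exp (CommutativeRing.commutativeSemiring S) public using (_^_)
      open RingHom h
      open Evaluation h
      module ∼-Reasoning = SetoidReasoning S.setoid
      module SS = IntegerCoefficients S

    eval-X^ : ∀ y k → eval y (X P.^ k) S.≈ y S.^ k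
    eval-X^ y zero    = eval-𝟙 y
    eval-X^ y (suc k) = S.trans (eval-⊗ y X (X P.^ k)) (S.*-cong (eval-X y) (eval-X^ y k))

    -- z plays the role of a/y. The relation yz = a avoids a division, so the lemma also applies at
    -- y = z = s, where s² = a.
    eval-reversal : ∀ {y z} → y S.* z S.≈ ⟦ a ⟧ → ∀ N f → Below (suc N) f →
                    eval y (reversal N f) S.≈ y S.^ N S.* eval z f
    eval-reversal {y} {z} yz≈a zero f f≤0 = let open ∼-Reasoning in begin
      eval y (reversal 0 f)               ≈⟨ eval-cong {f = reversal 0 f} S.refl (reversal-0 f) ⟩
      eval y (C (coefficient f 0))        ≈⟨ S.trans (eval-C y _) (S.sym (eval-C z _)) ⟩
      eval z (C (coefficient f 0))        ≈⟨ eval-cong {f = f} S.refl (Below-1⇒C f≤0) ⟨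
      eval z f                            ≈⟨ S.*-identityˡ _ ⟨
      S.1# S.* eval z f                   ∎
    eval-reversal {y} {z} yz≈a (suc N) [] f≤N =
      S.trans (eval-≋[] y {reversal (suc N) []} (reversal-[] (suc N))) (S.sym (S.zeroʳ _))
    eval-reversal {y} {z} yz≈a (suc N) (b ∷ f) f≤N = let open ∼-Reasoning in begin
      eval y (reversal (suc N) (b ∷ f))
        ≈⟨ eval-cong {f = reversal (suc N) (b ∷ f)} S.refl (reversal-∷ N b f) ⟩
      eval y ((C b ⊗ X P.^ suc N) ⊕ (C a ⊗ reversal N f))      ≈⟨ eval-⊕ y _ _ ⟩
      eval y (C b ⊗ X P.^ suc N) S.+ eval y (C a ⊗ reversal N f)
        ≈⟨ S.+-cong (S.trans (eval-⊗ y _ _) (S.*-cong (eval-C y b) (eval-X^ y (suc N))))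
                    (S.trans (eval-⊗ y _ _) (S.*-cong (S.trans (eval-C y a) (S.sym yz≈a))
                      (eval-reversal yz≈a N f (Below-tail {b = b} {f} f≤N)))) ⟩
      ⟦ b ⟧ S.* (y S.* y S.^ N) S.+ (y S.* z) S.* (y S.^ N S.* eval z f)
        ≈⟨ SS.solve 5 (λ b y u z f → b SS.:* (y SS.:* u) SS.:+ (y SS.:* z) SS.:* (u SS.:* f)
                          SS.:= (y SS.:* u) SS.:* (b SS.:+ z SS.:* f)) S.refl ⟦ b ⟧ y (y S.^ N) z (eval z f) ⟩
      (y S.* y S.^ N) S.* (⟦ b ⟧ S.+ z S.* eval z f)           ∎

-- Self-reciprocal polynomials and their factors

module SelfReciprocity (F : CommutativeRing c ℓ) (isField : IsField F)
                       {a : CommutativeRing.Carrier F}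
                       (a≉0 : ¬ CommutativeRing._≈_ F a (CommutativeRing.0# F)) where

  open CommutativeRing F hiding (zero)
  open RingProperties ring
  open Exp commutativeSemiring
  open IsField isField
  open IsDomain isDomain hiding (1≉0)
  open PolynomialRing F
  open FieldPolynomials F isField
  open Reversal F a
  open Quadratic F a
  private
    module P where
      open CommutativeRing polynomialRing public
      open IsDomain polynomialsDomain public using (*-cancelˡ)
    module Q where
      open CommutativeRing quadraticRing public
      open Exp (CommutativeRing.commutativeSemiring quadraticRing) public using (_^_; ^-homo-*; ^-distrib-*; ^-congˡ)
    module ≈-Reasoning = SetoidReasoning setoid
    module ≋-Reasoning = SetoidReasoning P.setoid
    module QR = Evaluation embed
  open IntegerCoefficients polynomialRing using (solve; _:+_; _:*_; _:-_; :-_; _:=_; con)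

  ^-≉0 : ∀ k {x} → ¬ x ≈ 0# → ¬ x ^ k ≈ 0#
  ^-≉0 zero    x≉0 = 1≉0
  ^-≉0 (suc k) x≉0 = *-≉0 x≉0 (^-≉0 k x≉0)

  -a≉0 : ¬ - a ≈ 0#
  -a≉0 p = a≉0 (-‿injective (trans p (sym -0#≈0#)))

  C-inverse : ∀ {b} → ¬ b ≈ 0# → ∃ λ b′ → C b′ ⊗ C b ≋ 𝟙
  C-inverse b≉0 = let b′ , bb′≈1 = inverse b≉0 in
    b′ , P.trans (P.sym (C-homo-* b′ _)) (P.trans (C-cong (trans (*-comm _ _) bb′≈1)) C-1)

  reversal-degree : ∀ N f → ¬ coefficient f 0 ≈ 0# → HasDegree N (reversal N f)
  reversal-degree N f f0≉0 =
    Below-reversal N f , λ p → f0≉0 (trans (sym (coefficient-top-reversal N f)) p)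

  norm-^ : ∀ x k → norm (x Q.^ k) ≈ norm x ^ k
  norm-^ x zero    = norm-1
  norm-^ x (suc k) = trans (norm-* x _) (*-congˡ (norm-^ x k))

  -- Since s = a/s, the reversal takes the value s^N f(s) at s, and the norm of s is -a.
  polynomialNorm-reversal : ∀ N f → Below (suc N) f →
    polynomialNorm (reversal N f) ≈ (- a) ^ N * polynomialNorm f
  polynomialNorm-reversal N f f≤N = trans (norm-cong (eval-reversal embed s²≃a N f f≤N))
    (trans (norm-* (s Q.^ N) _) (*-congʳ (trans (norm-^ s N) (^-congˡ N norm-s))))

  private
    unit-norm : ∀ z → ¬ norm z ≈ 0# → ∃ λ z′ → z Q.* z′ ≃ Q.1#
    unit-norm z@(u ⊹ v) nz≉0 = let n⁻¹ , nn⁻¹≈1 = inverse nz≉0 in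
      (u * n⁻¹ ⊹ - v * n⁻¹)
      , trans (FS.solve 4 (λ a u v n → u FS.:* (u FS.:* n) FS.:+ a FS.:* (v FS.:* (FS.:- v FS.:* n))
                 FS.:= (u FS.:* u FS.:- a FS.:* (v FS.:* v)) FS.:* n) refl a u v n⁻¹) nn⁻¹≈1
      , FS.solve 3 (λ u v n → u FS.:* (FS.:- v FS.:* n) FS.:+ v FS.:* (u FS.:* n) FS.:= FS.con (+ 0)) refl u v n⁻¹
      where module FS = IntegerCoefficients F

    -- The quadratic ring may have zero divisors, but an element of nonzero norm is invertible: its
    -- conjugate divided by the norm is an inverse.
    cancel-norm : ∀ {x y} z → ¬ norm z ≈ 0# → x Q.* z ≃ y Q.* z → x ≃ y
    cancel-norm {x} {y} z nz≉0 xz≃yz = let z′ , zz′≃1 = unit-norm z nz≉0 in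
      Q.trans (Q.sym (Q.trans (Q.*-congˡ {x} zz′≃1) (Q.*-identityʳ x)))
      (Q.trans (Q.sym (Q.*-assoc x z z′)) (Q.trans (Q.*-congʳ {z′} xz≃yz)
      (Q.trans (Q.*-assoc y z z′) (Q.trans (Q.*-congˡ {y} zz′≃1) (Q.*-identityʳ y)))))

    embed-^ : ∀ x k → (x ⊹ 0#) Q.^ k ≃ (x ^ k ⊹ 0#)
    embed-^ x zero    = Q.refl
    embed-^ x (suc k) = Q.trans (Q.*-congˡ {x ⊹ 0#} (embed-^ x k)) (Q.sym (RingHom.*-homo embed x (x ^ k)))

    s^-even : ∀ m → s Q.^ (m ℕ.+ m) ≃ (a ^ m ⊹ 0#)
    s^-even m = Q.trans (Q.^-homo-* s m m) (Q.trans (Q.sym (Q.^-distrib-* s s m))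
      (Q.trans (Q.^-congˡ m s²≃a) (embed-^ a m)))

    s^-odd : ∀ m → s Q.^ suc (m ℕ.+ m) ≃ (0# ⊹ a ^ m)
    s^-odd m = Q.trans (Q.*-congˡ {s} (s^-even m))
      ( solveF 2 (λ a e → conF (+ 0) ·F e +F a ·F (conF (+ 1) ·F conF (+ 0)) =F conF (+ 0)) refl a (a ^ m)
      , solveF 1 (λ e → conF (+ 0) ·F conF (+ 0) +F conF (+ 1) ·F e =F e) refl (a ^ m))
      where open IntegerCoefficients F renaming (solve to solveF; con to conF; _:*_ to _·F_; _:+_ to _+F_; _:=_ to _=F_)

    parity : ∀ N → (∃ λ m → N ≡ m ℕ.+ m) ⊎ (∃ λ m → N ≡ suc (m ℕ.+ m))
    parity zero    = inj₁ (0 , ≡.refl)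
    parity (suc N) = [ (λ (m , p) → inj₂ (m , ≡.cong suc p))
                     , (λ (m , p) → inj₁ (suc m , ≡.cong suc (≡.trans p (≡.sym (ℕ.+-suc m m)))))
                     ]′ (parity N)

  -- Self-reciprocity up to a constant: the form that passes to the factors and cofactors of the
  -- induction, which are in general not monic.
  record SelfReciprocalOf (N : ℕ) (f : Polynomial) : Set (c ⊔ ℓ) where
    field
      hasDegree  : HasDegree N f
      constant≉0 : ¬ coefficient f 0 ≈ 0#
      factor     : Carrier
      equation   : reversal N f ≋ C factor ⊗ f

    factor≉0 : ¬ factor ≈ 0#
    factor≉0 factor≈0 = constant≉0 (let open ≈-Reasoning in begin
      coefficient f 0                     ≈⟨ coefficient-top-reversal N f ⟨
      coefficient (reversal N f) N        ≈⟨ at equation N ⟩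
      coefficient (C factor ⊗ f) N        ≈⟨ coefficient-C⊗ factor f N ⟩
      factor * coefficient f N            ≈⟨ *-congʳ factor≈0 ⟩
      0# * coefficient f N                ≈⟨ zeroˡ _ ⟩
      0#                                  ∎)

    -- Evaluating at s = a / s gives s^N f(s) = factor · f(s), and f(s) is
    -- invertible, so s^N lies in F.
    evenDegree : ¬ polynomialNorm f ≈ 0# → ∃ λ m → N ≡ m ℕ.+ m
    -- For N = 2m + 1 the power s^N = a^m s has the nonzero coefficient a^m at s, so it does not lie
    -- in F.
    evenDegree Nf≉0 = [ id , (λ (m , N≡) → contradiction
      (im-≈ (Q.trans (Q.sym (s^-odd m)) (Q.trans (Q.reflexive (≡.cong (s Q.^_) (≡.sym N≡))) s^N)))
      (^-≉0 m a≉0)) ]′ (parity N)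
      where
      s^N : s Q.^ N ≃ (factor ⊹ 0#)
      s^N = cancel-norm (QR.eval s f) Nf≉0
        (Q.trans (Q.sym (eval-reversal embed s²≃a N f (bound hasDegree)))
        (Q.trans (QR.eval-cong {f = reversal N f} Q.refl equation)
        (Q.trans (QR.eval-⊗ s (C factor) f) (Q.*-congʳ {QR.eval s f} (QR.eval-C s factor)))))

  open SelfReciprocalOf public

  -- The reversal of f = g h is the product of the two reversals. Replacing those of f and g by
  -- constant multiples of f and g leaves a common factor g to cancel; the constant for h is the
  -- quotient of the other two.
  cofactor : ∀ {M N f g h} → SelfReciprocalOf N f → SelfReciprocalOf M g → f ≋ g ⊗ h →
             ∃ λ K → N ≡ M ℕ.+ K × SelfReciprocalOf K h
  cofactor {M} {N} {f} {g} {h} f-sr g-sr f≋gh =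
    let K , h° , N≡M+K = HasDegree-factor (hasDegree g-sr) h (HasDegree-cong f≋gh (hasDegree f-sr))
        e , ee≋𝟙 = C-inverse (factor≉0 g-sr)
    in K , N≡M+K , record
    { hasDegree  = h°
    ; constant≉0 = λ h0≈0 → constant≉0 f-sr (trans (at f≋gh 0) (trans (coefficient-0-⊗ g h)
                     (trans (*-congˡ h0≈0) (zeroʳ _))))
    ; factor     = e * factor f-sr
    ; equation   = P.*-cancelˡ {g} (HasDegree⇒≉ (hasDegree g-sr)) (let open ≋-Reasoning in begin
        g ⊗ reversal K h
          ≈⟨ P.*-identityˡ _ ⟨
        𝟙 ⊗ (g ⊗ reversal K h)
          ≈⟨ P.*-congʳ ee≋𝟙 ⟨
        (C e ⊗ C (factor g-sr)) ⊗ (g ⊗ reversal K h)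
          ≈⟨ solve 4 (λ e k g r → (e :* k) :* (g :* r) := e :* ((k :* g) :* r)) P.refl (C e) (C (factor g-sr)) g (reversal K h) ⟩
        C e ⊗ ((C (factor g-sr) ⊗ g) ⊗ reversal K h)
          ≈⟨ P.*-congˡ (P.*-congʳ (equation g-sr)) ⟨
        C e ⊗ (reversal M g ⊗ reversal K h)
          ≈⟨ P.*-congˡ (reversal-⊗ M K g h (bound (hasDegree g-sr)) (bound h°)) ⟨
        C e ⊗ reversal (M ℕ.+ K) (g ⊗ h)
          ≈⟨ P.*-congˡ (P.trans (reversal-cong (M ℕ.+ K) (P.sym f≋gh))
               (P.reflexive (≡.cong (λ k → reversal k f) (≡.sym N≡M+K)))) ⟩
        C e ⊗ reversal N f
          ≈⟨ P.*-congˡ (P.trans (equation f-sr) (P.*-congˡ f≋gh)) ⟩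
        C e ⊗ (C (factor f-sr) ⊗ (g ⊗ h))
          ≈⟨ solve 4 (λ e k g h → e :* (k :* (g :* h)) := g :* ((e :* k) :* h)) P.refl (C e) (C (factor f-sr)) g h ⟩
        g ⊗ ((C e ⊗ C (factor f-sr)) ⊗ h)
          ≈⟨ P.*-congˡ (P.*-congʳ (C-homo-* e (factor f-sr))) ⟨
        g ⊗ (C (e * factor f-sr) ⊗ h)  ∎)
    }

  unit-degree : ∀ {f} → IsUnit f → HasDegree 0 f
  unit-degree {f} (g , gf≋𝟙) = [ (λ f≋[] → contradiction
      (P.trans (P.sym gf≋𝟙) (P.trans (P.*-congˡ f≋[]) (P.zeroʳ g))) (HasDegree⇒≉ 𝟙°))
    , (λ (N , f°) → ≡.subst (λ k → HasDegree k f) (N≡0 N f°) f°) ]′ (degree f)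
    where
    𝟙° : HasDegree 0 𝟙
    𝟙° = Below-𝟙 , λ p → 1≉0 (trans (sym (trans (sym (at C-1 0)) (coefficient-C 1#))) p)
    N≡0 : ∀ N → HasDegree N f → N ≡ 0
    N≡0 N f° = let M , _ , 0≡N+M = HasDegree-factor f° g (HasDegree-cong (P.trans (P.sym gf≋𝟙) (P.*-comm g f)) 𝟙°) in
      ℕ.m+n≡0⇒m≡0 N (≡.sym 0≡N+M)

  constant-unit : ∀ {f} → HasDegree 0 f → IsUnit f
  constant-unit (f≤0 , f0≉0) = let b′ , p = C-inverse f0≉0 in
    C b′ , P.trans (P.*-congˡ (Below-1⇒C f≤0)) p

  -- If the irreducible p divides the reversal of the irreducible f, then f is
  -- the reversal of p up to a constant.
  reversal-associated : ∀ {d e p f} → HasDegree d p → HasDegree e f →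
    ¬ coefficient p 0 ≈ 0# → ¬ coefficient f 0 ≈ 0# → Irreducible p → Irreducible f →
    ∀ k → reversal e f ≋ k ⊗ p →
    e ≡ d × ∃ λ κ → ¬ κ ≈ 0# × f ≋ C κ ⊗ reversal d p
  reversal-associated {d} {e} {p} {f} p° f° p0≉0 f0≉0 p-irr f-irr k rev-f≋kp =
    [ (λ unit → let u° = unit-degree unit in
         HasDegree-unique (HasDegree-cong f≋ f°) (HasDegree-⊗ {f = C i ⊗ reversal j k} {g = reversal d p} u° (reversal-degree d p p0≉0)) ,
         coefficient (C i ⊗ reversal j k) 0 , leading≉0 u° ,
         P.trans f≋ (P.*-congʳ (Below-1⇒C (bound u°))))
    -- As p(0) is nonzero, the reversal of p has degree d as well. If it were a unit, p would be a
    -- nonzero constant.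
    , (λ unit → contradiction (constant-unit (≡.subst (λ n → HasDegree n p)
         (HasDegree-unique (reversal-degree d p p0≉0) (unit-degree unit)) p°)) (Irreducible.nonUnit p-irr))
    ]′ (Irreducible.split f-irr f≋)
    where
    quotient = HasDegree-factor p° k (HasDegree-cong (P.trans rev-f≋kp (P.*-comm k p)) (reversal-degree e f f0≉0))
    j = proj₁ quotient
    k° = proj₁ (proj₂ quotient)
    e≡d+j = proj₂ (proj₂ quotient)
    i = proj₁ (C-inverse (^-≉0 e a≉0))
    -- Reversing the equation rev f = k p once more gives a^e f on the left and the product of the
    -- two reversals on the right; i is the inverse of a^e. Irreducibility of f is then applied to
    -- this product.
    f≋ : f ≋ (C i ⊗ reversal j k) ⊗ reversal d p
    f≋ = let open ≋-Reasoning in begin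
      f                                               ≈⟨ P.*-identityˡ f ⟨
      𝟙 ⊗ f                                           ≈⟨ P.*-congʳ (proj₂ (C-inverse (^-≉0 e a≉0))) ⟨
      (C i ⊗ C (a ^ e)) ⊗ f                           ≈⟨ P.*-assoc _ _ _ ⟩
      C i ⊗ (C (a ^ e) ⊗ f)                           ≈⟨ P.*-congˡ (reversal-reversal e f (bound f°)) ⟨
      C i ⊗ reversal e (reversal e f)                 ≈⟨ P.*-congˡ (reversal-cong e (P.trans rev-f≋kp (P.*-comm k p))) ⟩
      C i ⊗ reversal e (p ⊗ k)                        ≡⟨ ≡.cong (λ n → C i ⊗ reversal n (p ⊗ k)) e≡d+j ⟩
      C i ⊗ reversal (d ℕ.+ j) (p ⊗ k)                ≈⟨ P.*-congˡ (reversal-⊗ d j p k (bound p°) (bound k°)) ⟩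
      C i ⊗ (reversal d p ⊗ reversal j k)
        ≈⟨ solve 3 (λ i p k → i :* (p :* k) := (i :* k) :* p) P.refl (C i) (reversal d p) (reversal j k) ⟩
      (C i ⊗ reversal j k) ⊗ reversal d p             ∎

  module _ {d p} (p° : HasDegree d p) (p0≉0 : ¬ coefficient p 0 ≈ 0#)
           {f κ} (κ≉0 : ¬ κ ≈ 0#) (f≋ : f ≋ C κ ⊗ reversal d p) where

    reversal≋ : ∃ λ κ′ → reversal d p ≋ C κ′ ⊗ f
    reversal≋ = let κ′ , κ′κ≋𝟙 = C-inverse κ≉0 in κ′ , (let open ≋-Reasoning in begin
      reversal d p                        ≈⟨ P.*-identityˡ _ ⟨
      𝟙 ⊗ reversal d p                    ≈⟨ P.*-congʳ κ′κ≋𝟙 ⟨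
      (C κ′ ⊗ C κ) ⊗ reversal d p         ≈⟨ P.*-assoc _ _ _ ⟩
      C κ′ ⊗ (C κ ⊗ reversal d p)         ≈⟨ P.*-congˡ f≋ ⟨
      C κ′ ⊗ f                            ∎)

    f° : HasDegree d f
    f° = HasDegree-cong (P.sym f≋) (HasDegree-⊗ {f = C κ} {g = reversal d p}
      (Below-C κ , λ p → κ≉0 (trans (sym (coefficient-C κ)) p)) (reversal-degree d p p0≉0))

    reversal-f≋ : reversal d f ≋ C (κ * a ^ d) ⊗ p
    reversal-f≋ = let open ≋-Reasoning in begin
      reversal d f                          ≈⟨ reversal-cong d f≋ ⟩
      reversal d (C κ ⊗ reversal d p)       ≈⟨ reversal-C⊗ d κ (reversal d p) ⟩
      C κ ⊗ reversal d (reversal d p)       ≈⟨ P.*-congˡ (reversal-reversal d p (bound p°)) ⟩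
      C κ ⊗ (C (a ^ d) ⊗ p)                 ≈⟨ P.*-assoc _ _ _ ⟨
      (C κ ⊗ C (a ^ d)) ⊗ p                 ≈⟨ P.*-congʳ (C-homo-* κ (a ^ d)) ⟨
      C (κ * a ^ d) ⊗ p                     ∎

    -- Reversal exchanges p and f up to constants, and so multiplies p f by a constant.
    pair-selfReciprocal : ¬ coefficient f 0 ≈ 0# → SelfReciprocalOf (d ℕ.+ d) (p ⊗ f)
    pair-selfReciprocal f0≉0 = record
      { hasDegree  = HasDegree-⊗ {f = p} {g = f} p° f°
      ; constant≉0 = λ q → *-≉0 p0≉0 f0≉0 (trans (sym (coefficient-0-⊗ p f)) q)
      ; factor     = proj₁ reversal≋ * (κ * a ^ d)
      ; equation   = let open ≋-Reasoning in begin
          reversal (d ℕ.+ d) (p ⊗ f)              ≈⟨ reversal-⊗ d d p f (bound p°) (bound f°) ⟩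
          reversal d p ⊗ reversal d f             ≈⟨ P.*-cong (proj₂ reversal≋) reversal-f≋ ⟩
          (C _ ⊗ f) ⊗ (C (κ * a ^ d) ⊗ p)
            ≈⟨ solve 4 (λ u v f p → (u :* f) :* (v :* p) := (u :* v) :* (p :* f)) P.refl (C (proj₁ reversal≋)) (C (κ * a ^ d)) f p ⟩
          (C _ ⊗ C (κ * a ^ d)) ⊗ (p ⊗ f)         ≈⟨ P.*-congʳ (C-homo-* _ _) ⟨
          C _ ⊗ (p ⊗ f)                           ∎
      }

    -- From f = κ rev p follows N(f) = κ² (-a)^d N(p). The outer factor (-a)^d and a second copy of
    -- N(p) complete the square.
    pair-norm : (- a) ^ d * polynomialNorm (p ⊗ f) ≈
                ((- a) ^ d * (κ * polynomialNorm p)) * ((- a) ^ d * (κ * polynomialNorm p))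
    pair-norm = let open ≈-Reasoning in begin
      u * polynomialNorm (p ⊗ f)                      ≈⟨ *-congˡ (polynomialNorm-⊗ p f) ⟩
      u * (n * polynomialNorm f)                      ≈⟨ *-congˡ (*-congˡ (trans (polynomialNorm-cong f≋) (polynomialNorm-⊗ (C κ) (reversal d p)))) ⟩
      u * (n * (polynomialNorm (C κ) * polynomialNorm (reversal d p)))
        ≈⟨ *-congˡ (*-congˡ (*-cong (polynomialNorm-C κ) (polynomialNorm-reversal d p (bound p°)))) ⟩
      u * (n * ((κ * κ) * (u * n)))
        ≈⟨ FS.solve 3 (λ u n k → u FS.:* (n FS.:* ((k FS.:* k) FS.:* (u FS.:* n)))
             FS.:= (u FS.:* (k FS.:* n)) FS.:* (u FS.:* (k FS.:* n))) refl u n κ ⟩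
      (u * (κ * n)) * (u * (κ * n))                   ∎
      where
      u = (- a) ^ d
      n = polynomialNorm p
      module FS = IntegerCoefficients F

-- Parity of the number of irreducible factors

module FactorParity (F : CommutativeRing c ℓ) (isField : IsField F) (q₂ : ℕ)
  (enumeration : HasCardinality (CommutativeRing.setoid F) (suc (suc q₂)))
  (2≉0 : ¬ CommutativeRing._≈_ F (CommutativeRing._+_ F (CommutativeRing.1# F) (CommutativeRing.1# F)) (CommutativeRing.0# F))
  {a : CommutativeRing.Carrier F} (a≉0 : ¬ CommutativeRing._≈_ F a (CommutativeRing.0# F)) where

  open CommutativeRing F hiding (zero)
  open Exp commutativeSemiring
  open IsField isField
  open IsDomain isDomain hiding (1≉0)
  open PolynomialRing F
  open FieldPolynomials F isField
  open Reversal F a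
  open Quadratic F a using (polynomialNorm; polynomialNorm-cong; polynomialNorm-⊗; polynomialNorm-C)
  open SelfReciprocity F isField a≉0
  open Squares F isField enumeration
  open Product polynomialRing using (product; product-remove)
  private
    module P = CommutativeRing polynomialRing
    module ≈-Reasoning = SetoidReasoning setoid
  open IntegerCoefficients F using (solve; _:+_; _:*_; _:-_; :-_; _:=_; con)

  -- Recursion in steps of two: splitting off a reciprocal pair leaves the proposition
  -- definitionally the same, and no parity has to be computed.
  SquareParity : ℕ → Carrier → Set (c ⊔ ℓ)
  SquareParity zero          x = IsSquare x
  SquareParity (suc zero)    x = ¬ IsSquare x
  SquareParity (suc (suc r)) x = SquareParity r x

  SquareParity-cong : ∀ r {x y} → x ≈ y → SquareParity r x → SquareParity r y
  SquareParity-cong zero          x≈y = IsSquare-cong x≈y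
  SquareParity-cong (suc zero)    x≈y = _∘ IsSquare-cong (sym x≈y)
  SquareParity-cong (suc (suc r)) x≈y = SquareParity-cong r x≈y

  root-≉0 : ∀ {x y} → ¬ x ≈ 0# → y * y ≈ x → ¬ y ≈ 0#
  root-≉0 x≉0 yy≈x y≈0 = x≉0 (trans (sym yy≈x) (trans (*-congˡ y≈0) (zeroʳ _)))

  SquareParity-square : ∀ r {x y} → ¬ x ≈ 0# → IsSquare x → SquareParity r y → SquareParity r (x * y)
  SquareParity-square zero       x≉0 □x           □y  = IsSquare-* □x □y
  SquareParity-square (suc zero) x≉0 (z , zz≈x) ¬□y □xy = ¬□y (IsSquare-cancelʳ (root-≉0 x≉0 zz≈x)
    (IsSquare-cong (trans (*-comm _ _) (*-congˡ (sym zz≈x))) □xy))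
  SquareParity-square (suc (suc r)) x≉0 □x p = SquareParity-square r x≉0 □x p

  -- For r = 1 two nonsquares have to multiply to a square; here `squareOrMultiple` enters, and with
  -- it the finiteness of F.
  SquareParity-nonsquare : ∀ r {x y} → ¬ IsSquare x → ¬ y ≈ 0# →
                           SquareParity r y → SquareParity (suc r) (x * y)
  SquareParity-nonsquare zero ¬□x y≉0 (z , zz≈y) □xy = ¬□x (IsSquare-cancelʳ (root-≉0 y≉0 zz≈y)
    (IsSquare-cong (*-congˡ (sym zz≈y)) □xy))
  SquareParity-nonsquare (suc zero) {y = y} ¬□x y≉0 ¬□y =
    [ (λ □y → contradiction □y ¬□y) , id ]′ (squareOrMultiple ¬□x y)
  SquareParity-nonsquare (suc (suc r)) ¬□x y≉0 p = SquareParity-nonsquare r ¬□x y≉0 p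

  module Conjugation {p} (irreducible : Irreducible p) {d} (p° : HasDegree d p)
                     (p0≉0 : ¬ coefficient p 0 ≈ 0#) where
    open RootExtension (rootExtension irreducible)
    open Evaluation ι hiding (eval)
    private
      module L where
        open CommutativeRing extension public
        open IsField isFieldᴸ public using (isDomain; inverse)
        open IsDomain (IsField.isDomain isFieldᴸ) public
        open Exp (CommutativeRing.commutativeSemiring extension) public using (_^_)
      module ι = RingHom ι

    ι-≉0 : ∀ {b} → ¬ b ≈ 0# → ¬ ι.⟦ b ⟧ L.≈ L.0#
    ι-≉0 {b} b≉0 ιb≈0 = let b′ , bb′≈1 = inverse b≉0 in L.1≉0 (begin
      L.1#                        ≈⟨ ι.1#-homo ⟨
      ι.⟦ 1# ⟧                    ≈⟨ ι.⟦⟧-cong bb′≈1 ⟨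
      ι.⟦ b * b′ ⟧                ≈⟨ ι.*-homo b b′ ⟩
      ι.⟦ b ⟧ L.* ι.⟦ b′ ⟧        ≈⟨ L.*-congʳ ιb≈0 ⟩
      L.0# L.* ι.⟦ b′ ⟧           ≈⟨ L.zeroˡ _ ⟩
      L.0#                        ∎)
      where open SetoidReasoning L.setoid

    eval-0 : ∀ f → eval L.0# f L.≈ ι.⟦ coefficient f 0 ⟧
    eval-0 []      = L.sym ι.0#-homo
    eval-0 (b ∷ f) = L.trans (L.+-congˡ (L.zeroˡ _)) (L.+-identityʳ _)

    α≉0 : ¬ α L.≈ L.0#
    α≉0 α≈0 = ι-≉0 p0≉0 (L.trans (L.sym (eval-0 p)) (L.trans (eval-cong {f = p} (L.sym α≈0) P.refl) root))

    α^-≉0 : ∀ k → ¬ α L.^ k L.≈ L.0#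
    α^-≉0 zero    = L.1≉0
    α^-≉0 (suc k) = L.*-≉0 α≉0 (α^-≉0 k)

    α′ : L.Carrier
    α′ = proj₁ (L.inverse α≉0) L.* ι.⟦ a ⟧

    αα′≈a : α L.* α′ L.≈ ι.⟦ a ⟧
    αα′≈a = L.trans (L.sym (L.*-assoc α _ _))
      (L.trans (L.*-congʳ (proj₂ (L.inverse α≉0))) (L.*-identityˡ _))

    HasConjugateRoot : Polynomial → Set (c ⊔ ℓ)
    HasConjugateRoot f = eval α′ f L.≈ L.0#

    -- α^N f(a/α) is the value of the reversal at α, hence a constant times f(α) = 0, and α is
    -- nonzero.
    conjugate-root : ∀ {N f h} → SelfReciprocalOf N f → f ≋ p ⊗ h → HasConjugateRoot f
    conjugate-root {N} {f} {h} f-sr f≋ph = [ (λ α^N≈0 → contradiction α^N≈0 (α^-≉0 N)) , id ]′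
      (L.noZeroDivisor (begin
        α L.^ N L.* eval α′ f                   ≈⟨ eval-reversal ι αα′≈a N f (bound (hasDegree f-sr)) ⟨
        eval α (reversal N f)                   ≈⟨ eval-cong {f = reversal N f} L.refl (equation f-sr) ⟩
        eval α (C (factor f-sr) ⊗ f)            ≈⟨ eval-⊗ α (C (factor f-sr)) f ⟩
        eval α (C (factor f-sr)) L.* eval α f
          ≈⟨ L.*-congˡ (L.trans (eval-cong {f = f} L.refl f≋ph) (L.trans (eval-⊗ α p h) (L.trans (L.*-congʳ root) (L.zeroˡ _)))) ⟩
        eval α (C (factor f-sr)) L.* L.0#       ≈⟨ L.zeroʳ _ ⟩
        L.0#                                    ∎))
      where open SetoidReasoning L.setoid

    conjugate-factor : ∀ {n} (t : Vector Polynomial n) → HasConjugateRoot (product t) →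
                       ∃ λ j → HasConjugateRoot (t j)
    conjugate-factor t p = L.product-≈0 (eval α′ ∘ t) (L.trans (L.sym (product-homo (evalHom α′) t)) p)

    HasConjugateRoot-cong : ∀ {f g} → f ≋ g → HasConjugateRoot f → HasConjugateRoot g
    HasConjugateRoot-cong {f} {g} f≋g p = L.trans (eval-cong {f = g} {f} L.refl (P.sym f≋g)) p

    -- A root a/α of g makes α a root of the reversal of g, which is then a multiple of p.
    divides-reversal : ∀ {e g} → HasDegree e g → HasConjugateRoot g → ∃ λ k → reversal e g ≋ k ⊗ p
    divides-reversal {e} {g} g° g[α′]≈0 = kernel (reversal e g)
      (L.trans (eval-reversal ι αα′≈a e g (bound g°)) (L.trans (L.*-congˡ g[α′]≈0) (L.zeroʳ _)))

    minimal : ∀ f → Below d f → eval α f L.≈ L.0# → f ≋ []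
    minimal f f<d f[α]≈0 = let h , f≋hp = kernel f f[α]≈0 in
      P.trans f≋hp (P.trans (P.*-congʳ (multiple-Below p° h (Below-cong f≋hp f<d))) (P.zeroˡ p))

    irreducible-nonsquare : ∀ m → d ≡ m ℕ.+ m → ¬ polynomialNorm p ≈ 0# → HasConjugateRoot p →
                            ¬ IsSquare ((- a) ^ m * polynomialNorm p)
    irreducible-nonsquare m d≡m+m Np≉0 p[α′]≈0 (y , yy≈) =
      nonsquare α d minimal p (bound p°) root (leading≉0 p°) a≉0 m d≡m+m Np≉0
        α′ αα′≈a p[α′]≈0 (0<m m d≡m+m) 2≉0 y yy≈
      where
      open KeyLemma F isField q₂ enumeration extension L.isDomain ι using (nonsquare)
      -- For m = 0 the polynomial p would be a nonzero constant, hence a unit.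
      0<m : ∀ m → d ≡ m ℕ.+ m → 0 < m
      0<m zero    d≡0 = contradiction (constant-unit (≡.subst (λ k → HasDegree k p) d≡0 p°)) (Irreducible.nonUnit irreducible)
      0<m (suc m) _   = s≤s z≤n

  -- The degree is tied to m by an equation, because the degrees of cofactors come out of divisions
  -- and are recognised as even only afterwards, by `evenDegree`.
  Claim : ℕ → Set (c ⊔ ℓ)
  Claim r = ∀ {N} m {f} → SelfReciprocalOf N f → N ≡ m ℕ.+ m → ¬ polynomialNorm f ≈ 0# →
            (t : Vector Polynomial r) → (∀ i → Irreducible (t i)) → f ≋ product t →
            SquareParity r ((- a) ^ m * polynomialNorm f)

  private
    half-injective : ∀ {m k} → m ℕ.+ m ≡ k ℕ.+ k → m ≡ k
    half-injective {zero}  {zero}  _ = ≡.refl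
    half-injective {suc m} {suc k} p = ≡.cong suc (half-injective (ℕ.suc-injective
      (≡.trans (≡.sym (ℕ.+-suc m m)) (≡.trans (ℕ.suc-injective p) (ℕ.+-suc k k)))))

    +-interchange : ∀ m k → (m ℕ.+ m) ℕ.+ (k ℕ.+ k) ≡ (m ℕ.+ k) ℕ.+ (m ℕ.+ k)
    +-interchange m k = ≡.trans (ℕ.+-assoc m m (k ℕ.+ k)) (≡.trans
      (≡.cong (m ℕ.+_) (≡.trans (≡.sym (ℕ.+-assoc m k k)) (≡.trans (≡.cong (ℕ._+ k) (ℕ.+-comm m k)) (ℕ.+-assoc k m k))))
      (≡.sym (ℕ.+-assoc m k (m ℕ.+ k))))

    combine : ∀ {N M K} m m₁ m₂ → N ≡ M ℕ.+ K → M ≡ m₁ ℕ.+ m₁ → K ≡ m₂ ℕ.+ m₂ → N ≡ m ℕ.+ m → m ≡ m₁ ℕ.+ m₂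
    combine m m₁ m₂ ≡.refl ≡.refl ≡.refl N≡ = half-injective (≡.trans (≡.sym N≡) (+-interchange m₁ m₂))

  module _ {f g h} (f≋gh : f ≋ g ⊗ h) (Nf≉0 : ¬ polynomialNorm f ≈ 0#) where
    private
      Nf : polynomialNorm f ≈ polynomialNorm g * polynomialNorm h
      Nf = trans (polynomialNorm-cong f≋gh) (polynomialNorm-⊗ g h)

    norm-left≉0 : ¬ polynomialNorm g ≈ 0#
    norm-left≉0 p = Nf≉0 (trans Nf (trans (*-congʳ p) (zeroˡ _)))

    norm-right≉0 : ¬ polynomialNorm h ≈ 0#
    norm-right≉0 p = Nf≉0 (trans Nf (trans (*-congˡ p) (zeroʳ _)))

    scaled-norm : ∀ m m₁ m₂ → m ≡ m₁ ℕ.+ m₂ → (- a) ^ m * polynomialNorm f ≈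
                  ((- a) ^ m₁ * polynomialNorm g) * ((- a) ^ m₂ * polynomialNorm h)
    scaled-norm _ m₁ m₂ ≡.refl = trans (*-cong (^-homo-* (- a) m₁ m₂) Nf)
      (solve 4 (λ u v x y → (u :* v) :* (x :* y) := (u :* x) :* (v :* y)) refl _ _ _ _)

    -- The part common to both inductive steps. With g self-reciprocal, so is h; its norm is
    -- nonzero, which makes its degree even, and the induction hypothesis applies. The witness x is
    -- (-a)^m₂ N(h).
    peel : ∀ {N M} m m₁ {r} → SelfReciprocalOf N f → N ≡ m ℕ.+ m → SelfReciprocalOf M g → M ≡ m₁ ℕ.+ m₁ →
      Claim r → (t : Vector Polynomial r) → (∀ i → Irreducible (t i)) → h ≋ product t →
      ∃ λ x → ¬ x ≈ 0# × SquareParity r x × (- a) ^ m * polynomialNorm f ≈ ((- a) ^ m₁ * polynomialNorm g) * x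
    peel m m₁ f-sr N≡ g-sr M≡ claim t t-irr h≋t =
      let K , N≡M+K , h-sr = cofactor f-sr g-sr f≋gh
          m₂ , K≡ = evenDegree h-sr norm-right≉0
      in (- a) ^ m₂ * polynomialNorm h , *-≉0 (^-≉0 m₂ -a≉0) norm-right≉0
       , claim m₂ h-sr K≡ norm-right≉0 t t-irr h≋t , scaled-norm m m₁ m₂ (combine m m₁ m₂ N≡M+K M≡ K≡ N≡)

  claim-0 : Claim 0
  claim-0 {N} m {f} f-sr N≡ Nf≉0 t t-irr f≋1 = 1# , trans (*-identityʳ 1#) (sym (let open ≈-Reasoning in begin
    (- a) ^ m * polynomialNorm f      ≡⟨ ≡.cong (λ k → (- a) ^ k * polynomialNorm f) m≡0 ⟩
    1# * polynomialNorm f             ≈⟨ *-identityˡ _ ⟩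
    polynomialNorm f                  ≈⟨ polynomialNorm-cong (P.trans f≋1 (P.sym C-1)) ⟩
    polynomialNorm (C 1#)             ≈⟨ polynomialNorm-C 1# ⟩
    1# * 1#                           ≈⟨ *-identityʳ 1# ⟩
    1#                                ∎))
    where
    N≡0 : N ≡ 0
    N≡0 = HasDegree-unique (hasDegree f-sr) (unit-degree (𝟙 , P.trans (P.*-identityˡ f) f≋1))
    m≡0 : m ≡ 0
    m≡0 = ℕ.m+n≡0⇒m≡0 m (≡.trans (≡.sym N≡) N≡0)

  factor-constant≉0 : ∀ {f g h} → f ≋ g ⊗ h → ¬ coefficient f 0 ≈ 0# → ¬ coefficient g 0 ≈ 0#
  factor-constant≉0 {g = g} {h} f≋gh f0≉0 g0≈0 =
    f0≉0 (trans (at f≋gh 0) (trans (coefficient-0-⊗ g h) (trans (*-congʳ g0≈0) (zeroˡ _))))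

  nonzero-degree : ∀ p → ¬ coefficient p 0 ≈ 0# → ∃ λ d → HasDegree d p
  nonzero-degree p p0≉0 = [ (λ p≋[] → contradiction (at p≋[] 0) p0≉0) , id ]′ (degree p)

  module Step {r} {N} m {f} (f-sr : SelfReciprocalOf N f) (N≡m+m : N ≡ m ℕ.+ m) (Nf≉0 : ¬ polynomialNorm f ≈ 0#)
              (t : Vector Polynomial (suc r)) (t-irr : ∀ i → Irreducible (t i)) (f≋t : f ≋ product t) where
    private
      p = t zero

      constant≉0′ : ∀ j → ¬ coefficient (t j) 0 ≈ 0#
      constant≉0′ j = factor-constant≉0 (P.trans f≋t (product-remove {i = j} t)) (constant≉0 f-sr)

      p-degree = nonzero-degree p (constant≉0′ zero)
      d = proj₁ p-degree
      p° = proj₂ p-degree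

      module α = Conjugation {p} (t-irr zero) p° (constant≉0′ zero)

    ConjugateRootAt : Fin (suc r) → Set (c ⊔ ℓ)
    ConjugateRootAt j = α.HasConjugateRoot (t j)

    conjugateRoot : ∃ ConjugateRootAt
    conjugateRoot = α.conjugate-factor t (α.HasConjugateRoot-cong f≋t (α.conjugate-root f-sr f≋t))

    private
      associated : ∀ j → ConjugateRootAt j → ∃ λ κ → ¬ κ ≈ 0# × t j ≋ C κ ⊗ reversal d p
      associated j root =
        let e , tj° = nonzero-degree (t j) (constant≉0′ j)
            k , rev≋kp = α.divides-reversal tj° root
        in proj₂ (reversal-associated p° tj° (constant≉0′ zero) (constant≉0′ j) (t-irr zero) (t-irr j) k rev≋kp)

    selfReciprocalFactor : Claim r → ConjugateRootAt zero → SquareParity (suc r) ((- a) ^ m * polynomialNorm f)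
    selfReciprocalFactor claim root =
      let κ , κ≉0 , p≋ = associated zero root
          κ′ , rev≋ = reversal≋ p° (constant≉0′ zero) κ≉0 p≋
          p-sr = record { hasDegree = p° ; constant≉0 = constant≉0′ zero ; factor = κ′ ; equation = rev≋ }
          Np≉0 = norm-left≉0 f≋t Nf≉0
          m₁ , d≡ = evenDegree p-sr Np≉0
          x , x≉0 , parity , eq = peel f≋t Nf≉0 m m₁ f-sr N≡m+m p-sr d≡ claim (t ∘ suc) (t-irr ∘ suc) P.refl
      in SquareParity-cong (suc r) (sym eq)
           (SquareParity-nonsquare r (α.irreducible-nonsquare m₁ d≡ Np≉0 root) x≉0 parity)

    reciprocalPair : ∀ j {r′} → Claim r′ → ConjugateRootAt (suc j) →
      (u : Vector Polynomial r′) → (∀ i → Irreducible (u i)) → product (t ∘ suc) ≋ t (suc j) ⊗ product u →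
      SquareParity r′ ((- a) ^ m * polynomialNorm f)
    reciprocalPair j {r′} claim root u u-irr t≋ =
      let κ , κ≉0 , g≋ = associated (suc j) root
          f≋ = P.trans f≋t (P.trans (P.*-congˡ t≋) (P.sym (P.*-assoc p (t (suc j)) (product u))))
          pair-sr = pair-selfReciprocal p° (constant≉0′ zero) κ≉0 g≋ (constant≉0′ (suc j))
          x , x≉0 , parity , eq = peel f≋ Nf≉0 m d f-sr N≡m+m pair-sr ≡.refl claim u u-irr P.refl
      in SquareParity-cong r′ (sym eq) (SquareParity-square r′
           (*-≉0 (^-≉0 d -a≉0) (norm-left≉0 f≋ Nf≉0))
           (_ , sym (pair-norm p° (constant≉0′ zero) κ≉0 g≋)) parity)

  -- The cases are separated by the index of the factor that has the root a/α, not by comparing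
  -- polynomials. A repeated factor found at a later index counts as a pair, and the argument for
  -- pairs covers it.
  step : ∀ r → (∀ {k} → k < suc r → Claim k) → Claim (suc r)
  step r claims m {f} f-sr N≡m+m Nf≉0 t t-irr f≋t = dispatch r claims t t-irr f≋t (Step.conjugateRoot m f-sr N≡m+m Nf≉0 t t-irr f≋t)
    where
    dispatch : ∀ r → (∀ {k} → k < suc r → Claim k) → (t : Vector Polynomial (suc r)) (t-irr : ∀ i → Irreducible (t i)) (f≋t : f ≋ product t) →
               ∃ (Step.ConjugateRootAt m f-sr N≡m+m Nf≉0 t t-irr f≋t) →
               SquareParity (suc r) ((- a) ^ m * polynomialNorm f)
    dispatch r claims t t-irr f≋t (zero , root) =
      Step.selfReciprocalFactor m f-sr N≡m+m Nf≉0 t t-irr f≋t (claims (ℕ.n<1+n r)) root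
    -- An index `suc j` presupposes a second factor. After removal of the pair r factors remain, and
    -- `SquareParity` takes the same value at r and at r + 2.
    dispatch (suc r) claims t t-irr f≋t (suc j , root) =
      Step.reciprocalPair m f-sr N≡m+m Nf≉0 t t-irr f≋t j (claims (ℕ.m≤n⇒m≤1+n (ℕ.n<1+n r))) root
        (removeAt (t ∘ suc) j) (λ i → t-irr (suc (Fin.punchIn j i))) (product-remove {i = j} (t ∘ suc))

  claim : ∀ r → Claim r
  claim r = <-rec Claim induct r
    where
    induct : ∀ r → (∀ {k} → k < r → Claim k) → Claim r
    induct zero    _      = claim-0
    induct (suc r) claims = step r claims

-- Passage to list polynomials and to the values at the square roots of a

module RawPolynomials (R : CommutativeRing c ℓ) where
  open PolynomialRing R
  open RawSemiringDefinitions polynomialRawSemiring using () renaming (product to productₚ; Irreducible to Irreducibleₚ)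
  open RawSemiringDefinitions.Irreducible

  opaque
    unfolding _⊗_

    product-raw : ∀ {n} (t : Vector Polynomial n) → Product.product polynomialRing t ≡ productₚ t
    product-raw {zero}  t = ≡.refl
    product-raw {suc n} t = ≡.cong (t zero ⊗_) (product-raw (t ∘ suc))

  module _ (isField : IsField R) where
    open FieldPolynomials R isField using (Irreducible; IsUnit)

    opaque
      unfolding _⊗_

      irreducible-raw : ∀ {p} → Irreducibleₚ p → Irreducible p
      irreducible-raw p-irr = record
        { nonUnit = λ (g , gp≋𝟙) → p∤1 p-irr (g by at gp≋𝟙)
        ; split   = λ p≋fg → [ inj₁ ∘ unit , inj₂ ∘ unit ]′ (split-∣1 p-irr (at p≋fg))
        }
        where
        open RawMagmaDefinitions (RawSemiring.*-rawMagma polynomialRawSemiring) using () renaming (_∣_ to _∣ₚ_; _,_ to _by_)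
        unit : ∀ {f} → f ∣ₚ 𝟙 → IsUnit f
        unit (g by gf≈1) = g , pointwise gf≈1

module Values {F : CommutativeRing c ℓ} {K : CommutativeRing c′ ℓ′} (ι : RingHom F K)
              (a : CommutativeRing.Carrier F) (√a : CommutativeRing.Carrier K)
              (√a²≈a : CommutativeRing._≈_ K (CommutativeRing._*_ K √a √a) (RingHom.⟦_⟧ ι a)) where
  private module F = CommutativeRing F
  open CommutativeRing K
  open RingHom ι
  open Quadratic F a
  open PolynomialRing F using (Polynomial)
  open Polynomials rawRing using (evaluate)
  open RingProperties ring
  open SetoidReasoning setoid
  open IntegerCoefficients K using (solve; _:+_; _:*_; _:-_; :-_; _:=_; con)

  -- Evaluation at any square root x of a reduces by x² = a exactly as evaluation at s does. It is
  -- applied to √a and to -√a, whose values are conjugate.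
  value : ∀ {x} → x * x ≈ ⟦ a ⟧ → ∀ f →
          evaluate (map ⟦_⟧ f) x ≈ ⟦ re (evalQ s f) ⟧ + x * ⟦ im (evalQ s f) ⟧
  value {x} xx≈a []      = sym (trans (+-cong 0#-homo (trans (*-congˡ 0#-homo) (zeroʳ x))) (+-identityʳ 0#))
  value {x} xx≈a (b ∷ f) = begin
    ⟦ b ⟧ + x * evaluate (map ⟦_⟧ f) x           ≈⟨ +-congˡ (*-congˡ (value xx≈a f)) ⟩
    ⟦ b ⟧ + x * (⟦ u ⟧ + x * ⟦ v ⟧)
      ≈⟨ solve 4 (λ b x u v → b :+ x :* (u :+ x :* v) := (b :+ (x :* x) :* v) :+ x :* u) refl ⟦ b ⟧ x ⟦ u ⟧ ⟦ v ⟧ ⟩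
    (⟦ b ⟧ + (x * x) * ⟦ v ⟧) + x * ⟦ u ⟧        ≈⟨ +-congʳ (+-congˡ (trans (*-congʳ xx≈a) (sym (*-homo a v)))) ⟩
    (⟦ b ⟧ + ⟦ a F.* v ⟧) + x * ⟦ u ⟧            ≈⟨ +-congʳ (+-homo b (a F.* v)) ⟨
    ⟦ b F.+ a F.* v ⟧ + x * ⟦ u ⟧
      ≈⟨ +-cong (⟦⟧-cong (FS.solve 4 (λ a b u v → b FS.:+ a FS.:* v FS.:= b FS.:+ (FS.con (+ 0) FS.:* u FS.:+ a FS.:* (FS.con (+ 1) FS.:* v))) F.refl a b u v))
                (*-congˡ (⟦⟧-cong (FS.solve 2 (λ u v → u FS.:= FS.con (+ 0) FS.:+ (FS.con (+ 0) FS.:* v FS.:+ FS.con (+ 1) FS.:* u)) F.refl u v))) ⟩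
    ⟦ re (evalQ s (b ∷ f)) ⟧ + x * ⟦ im (evalQ s (b ∷ f)) ⟧   ∎
    where
    u = re (evalQ s f)
    v = im (evalQ s f)
    module FS = IntegerCoefficients F

  value-product : ∀ f → evaluate (map ⟦_⟧ f) √a * evaluate (map ⟦_⟧ f) (- √a) ≈ ⟦ polynomialNorm f ⟧
  value-product f = begin
    evaluate (map ⟦_⟧ f) √a * evaluate (map ⟦_⟧ f) (- √a)
      ≈⟨ *-cong (value √a²≈a f) (value (trans (solve 1 (λ x → :- x :* :- x := x :* x) refl √a) √a²≈a) f) ⟩
    (⟦ u ⟧ + √a * ⟦ v ⟧) * (⟦ u ⟧ + - √a * ⟦ v ⟧)
      ≈⟨ solve 3 (λ u v x → (u :+ x :* v) :* (u :+ :- x :* v) := u :* u :- (x :* x) :* (v :* v)) refl ⟦ u ⟧ ⟦ v ⟧ √a ⟩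
    ⟦ u ⟧ * ⟦ u ⟧ - (√a * √a) * (⟦ v ⟧ * ⟦ v ⟧)
      ≈⟨ +-cong (*-homo u u) (-‿cong (trans (*-homo a (v F.* v)) (*-cong (sym √a²≈a) (*-homo v v)))) ⟨
    ⟦ u F.* u ⟧ - ⟦ a F.* (v F.* v) ⟧         ≈⟨ +-congˡ (-‿homo _) ⟨
    ⟦ u F.* u ⟧ + ⟦ F.- (a F.* (v F.* v)) ⟧   ≈⟨ +-homo _ _ ⟨
    ⟦ polynomialNorm f ⟧                      ∎
    where
    u = re (evalQ s f)
    v = im (evalQ s f)

-- With n = k + 2 the number is n(n - 2) + n = n(n - 1), and it grows by 2n from n to n + 1.
pronic-even : ∀ k → ∃ λ h → (2 ℕ.+ k) ℕ.* k ℕ.+ (2 ℕ.+ k) ≡ h ℕ.+ h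
pronic-even zero    = 1 , ≡.refl
pronic-even (suc k) = let h , p = pronic-even k in h ℕ.+ (2 ℕ.+ k) , ≡.trans
  (solve 1 (λ k → (con 3 :+ k) :* (con 1 :+ k) :+ (con 3 :+ k)
                  := ((con 2 :+ k) :* k :+ (con 2 :+ k)) :+ ((con 2 :+ k) :+ (con 2 :+ k))) ≡.refl k)
  (≡.trans (≡.cong (ℕ._+ ((2 ℕ.+ k) ℕ.+ (2 ℕ.+ k))) p)
    (solve 2 (λ h k → (h :+ h) :+ (k :+ k) := (h :+ k) :+ (h :+ k)) ≡.refl h (2 ℕ.+ k)))
  where open +-*-Solver

n[n-2]-nonNegative : ∀ k → + (2 ℕ.+ k) ℤ.* (+ (2 ℕ.+ k) ℤ.- + 2) ≡ + ((2 ℕ.+ k) ℕ.* k)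
n[n-2]-nonNegative k = ≡.trans
  (≡.cong (+ (2 ℕ.+ k) ℤ.*_) (≡.trans (ℤ.[1+m]⊖[1+n]≡m⊖n (suc k) 1) (ℤ.[1+m]⊖[1+n]≡m⊖n k 0)))
  (≡.sym (ℤ.pos-* (2 ℕ.+ k) k))

-- Finite Heyting fields

module FiniteHeytingField {c ℓ₁ ℓ₂} (H : HeytingField c ℓ₁ ℓ₂) where
  open FieldNotions H hiding (zero)
  open RingProperties (CommutativeRing.ring commutativeRing)
  open Exp (CommutativeRing.commutativeSemiring commutativeRing) using (^-homo-*)
  open IntegerCoefficients commutativeRing using (solve; _:+_; _:*_; _:-_; :-_; _:=_; con)

  x-0≈x : ∀ x → x - 0# ≈ x
  x-0≈x x = trans (+-congˡ -0#≈0#) (+-identityʳ x)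

  #⇒≉ : ∀ {x y} → x # y → ¬ x ≈ y
  #⇒≉ x#y x≈y = #-irrefl x≈y x#y

  inverseʳ : ∀ {x} (x#0 : x # 0#) → x * inverse x x#0 ≈ 1#
  inverseʳ {x} x#0 = trans (*-congʳ (sym (x-0≈x x))) (proj₂ (proj₂ (#⇒invertible x#0)))

  module _ {q} (enumeration : HasCardinality setoid q) where
    open Enumeration {F = commutativeRing} enumeration

    isField : IsField commutativeRing
    isField = record
      { 1≉0    = #⇒≉ (invertible⇒# (1# , one , trans (*-comm _ _) one))
      ; invert = invert
      }
      where
      one : 1# * (1# - 0#) ≈ 1#
      one = trans (*-identityˡ _) (x-0≈x 1#)
      -- An inverse is sought among the finitely many elements. If there is none, x cannot be apart
      -- from zero, and tightness of the apartness gives x = 0.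
      invert : ∀ x → x ≈ 0# ⊎ ∃ λ y → x * y ≈ 1#
      invert x with Fin.any? (λ i → (x * element i) ≟ 1#)
      ... | yes (i , xy≈1) = inj₂ (element i , xy≈1)
      ... | no  ¬xy≈1      = inj₁ (proj₁ (tight x 0#) λ x#0 → ¬xy≈1
        (index (inverse x x#0) , trans (*-congˡ (element-index (inverse x x#0))) (inverseʳ x#0)))

  -- The exponents add up to the even number n(n - 1). For n = 1, where n(n - 2) = -1, the product
  -- is 1, which gives h = 0.
  zpow-square : ∀ {a} (a#0 : a # 0#) n → 1 ≤ n →
    ∃ λ h → zpow a a#0 (+ n ℤ.* (+ n ℤ.- + 2)) * a ^ n ≈ a ^ h * a ^ h
  zpow-square {a} a#0 (suc zero)    _ = 0 , (begin
    (inverse a a#0 * 1#) * (a * 1#)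
      ≈⟨ solve 2 (λ x y → (y :* con (+ 1)) :* (x :* con (+ 1)) := x :* y) refl a (inverse a a#0) ⟩
    a * inverse a a#0                   ≈⟨ inverseʳ a#0 ⟩
    1#                                  ≈⟨ *-identityʳ 1# ⟨
    1# * 1#                             ∎)
    where open SetoidReasoning setoid
  zpow-square {a} a#0 (suc (suc k)) _ = let h , even = pronic-even k in h , (begin
    zpow a a#0 (+ (2 ℕ.+ k) ℤ.* (+ (2 ℕ.+ k) ℤ.- + 2)) * a ^ (2 ℕ.+ k)
      ≡⟨ ≡.cong (λ e → zpow a a#0 e * a ^ (2 ℕ.+ k)) (n[n-2]-nonNegative k) ⟩
    a ^ ((2 ℕ.+ k) ℕ.* k) * a ^ (2 ℕ.+ k)    ≈⟨ ^-homo-* a ((2 ℕ.+ k) ℕ.* k) (2 ℕ.+ k) ⟨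
    a ^ ((2 ℕ.+ k) ℕ.* k ℕ.+ (2 ℕ.+ k))      ≡⟨ ≡.cong (a ^_) even ⟩
    a ^ (h ℕ.+ h)                            ≈⟨ ^-homo-* a h h ⟩
    a ^ h * a ^ h                            ∎)
    where open SetoidReasoning setoid

  module _ {a N f} (f-sr : SelfReciprocal a N f) where
    open SelfReciprocal f-sr
    open PolynomialRing commutativeRing using (_≋_; pointwise; C; _⊗_; coefficient-C⊗)
    open Reversal commutativeRing a using (reversal)
    open SetoidReasoning setoid

    private
      b₀ b₀⁻¹ : Carrier
      b₀   = coefficient f 0
      b₀⁻¹ = inverse b₀ constantNonzero

      coefficient-scaled : ∀ (g : ℕ → Carrier) n i →
        coefficient (applyUpTo (λ j → b₀⁻¹ * g j) n) i ≈ b₀⁻¹ * coefficient (applyUpTo g n) i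
      coefficient-scaled g zero    i       = sym (zeroʳ b₀⁻¹)
      coefficient-scaled g (suc n) zero    = refl
      coefficient-scaled g (suc n) (suc i) = coefficient-scaled (g ∘ suc) n i

    reversal-selfReciprocal : reversal N f ≋ C b₀ ⊗ f
    reversal-selfReciprocal = pointwise λ i → begin
      coefficient (reversal N f) i                      ≈⟨ *-identityˡ _ ⟨
      1# * coefficient (reversal N f) i                 ≈⟨ *-congʳ (inverseʳ constantNonzero) ⟨
      (b₀ * b₀⁻¹) * coefficient (reversal N f) i        ≈⟨ *-assoc _ _ _ ⟩
      b₀ * (b₀⁻¹ * coefficient (reversal N f) i)
        ≈⟨ *-congˡ (trans (sym (coefficient-scaled (λ j → coefficient f (N ∸ j) * a ^ (N ∸ j)) (suc N) i)) (reciprocalEqual i)) ⟩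
      b₀ * coefficient f i                              ≈⟨ coefficient-C⊗ b₀ f i ⟨
      coefficient (C b₀ ⊗ f) i                          ∎

-- The criterion with the normalisation (-1)^n a^(n(n-2))

module Main {c ℓ₁ ℓ₂} (H : HeytingField c ℓ₁ ℓ₂) (q₂ : ℕ)
  (enumeration : HasCardinality (HeytingField.setoid H) (suc (suc q₂))) (2∤q : ¬ 2 ∣ suc (suc q₂))
  {a} (a#0 : HeytingField._#_ H a (HeytingField.0# H)) where

  open FieldNotions H hiding (zero)
  open FiniteHeytingField H
  open RingProperties (CommutativeRing.ring commutativeRing)
  open Exp (CommutativeRing.commutativeSemiring commutativeRing) using (^-distrib-*; ^-congˡ)
  open IntegerCoefficients commutativeRing using (solve; _:+_; _:*_; _:-_; :-_; _:=_; con)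
  open SetoidReasoning setoid

  private
    field′ = isField enumeration
    a≉0 : ¬ a ≈ 0#
    a≉0 = #⇒≉ a#0

  open Quadratic commutativeRing a using (polynomialNorm)
  open FiniteField commutativeRing field′ q₂ enumeration using (2≉0)
  open Squares commutativeRing field′ enumeration
  open SelfReciprocity commutativeRing field′ a≉0 using (SelfReciprocalOf; ^-≉0)
  open FactorParity commutativeRing field′ q₂ enumeration (2≉0 2∤q) a≉0
  open FieldPolynomials commutativeRing field′ using (HasDegree; _,_)
  open RawPolynomials commutativeRing

  SquareParity⇔ : ∀ r {x} → SquareParity r x → (2 ∣ r → IsSquare x) × (IsSquare x → 2 ∣ r)
  SquareParity⇔ zero          □x  = (λ _ → □x) , λ _ → divides 0 ≡.refl
  SquareParity⇔ (suc zero)    ¬□x = (λ 2∣1 → contradiction (ℕ.∣⇒≤ 2∣1) (ℕ.<⇒≱ (s≤s (s≤s z≤n)))) , λ □x → contradiction □x ¬□x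
  SquareParity⇔ (suc (suc r)) p   = let to , from = SquareParity⇔ r p in
    (λ 2∣2+r → to (ℕ.∣m+n∣m⇒∣n 2∣2+r ℕ.∣-refl)) , (λ □x → ℕ.∣m∣n⇒∣m+n ℕ.∣-refl (from □x))

  module _ (n : ℕ) (1≤n : 1 ≤ n) {f} (f-sr : NontrivialSelfReciprocal a n f) (Nf≉0 : ¬ polynomialNorm f ≈ 0#) where
    open NontrivialSelfReciprocal f-sr
    open SelfReciprocal selfReciprocal

    private
      selfReciprocalOf : SelfReciprocalOf (2 ℕ.* n) f
      selfReciprocalOf = record
        { hasDegree  = proj₂ monic , λ p → IsField.1≉0 field′ (trans (sym (proj₁ monic)) p)
        ; constant≉0 = #⇒≉ constantNonzero
        ; factor     = coefficient f 0
        ; equation   = reversal-selfReciprocal selfReciprocal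
        }

      Z W : Carrier
      Z = zpow a a#0 (+ n ℤ.* (+ n ℤ.- + 2))
      W = (- 1#) ^ n * Z

      -- One factor a^n joins (-1)^n to form (-a)^n, the other makes Z a square by `zpow-square`.
      -- Both normalisations thus differ by nonzero squares.
      rescale : ∃ λ h → (W * polynomialNorm f) * (a ^ n * a ^ n) ≈ ((- a) ^ n * polynomialNorm f) * (a ^ h * a ^ h)
      rescale = let h , Zaⁿ≈aʰaʰ = zpow-square a#0 n 1≤n in h , (begin
        (((- 1#) ^ n * Z) * N) * (a ^ n * a ^ n)
          ≈⟨ solve 4 (λ e z m a → ((e :* z) :* m) :* (a :* a) := ((e :* a) :* m) :* (z :* a)) refl ((- 1#) ^ n) Z N (a ^ n) ⟩
        (((- 1#) ^ n * a ^ n) * N) * (Z * a ^ n)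
          ≈⟨ *-cong (*-congʳ (trans (sym (^-distrib-* (- 1#) a n)) (^-congˡ n (-1*x≈-x a)))) Zaⁿ≈aʰaʰ ⟩
        ((- a) ^ n * N) * (a ^ h * a ^ h)         ∎)
        where N = polynomialNorm f

      sameClass : (IsSquare ((- a) ^ n * polynomialNorm f) → IsSquare (W * polynomialNorm f)) ×
                  (IsSquare (W * polynomialNorm f) → IsSquare ((- a) ^ n * polynomialNorm f))
      sameClass = let h , eq = rescale in
        (λ □E → IsSquare-cancelʳ (^-≉0 n a≉0) (IsSquare-cong (sym eq) (IsSquare-* □E (a ^ h , refl)))) ,
        (λ □W → IsSquare-cancelʳ (^-≉0 h a≉0) (IsSquare-cong eq (IsSquare-* □W (a ^ n , refl))))

    parity⇔square : ∀ {r} → IrreducibleFactorisation f r →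
                    (2 ∣ r → IsSquare (W * polynomialNorm f)) × (IsSquare (W * polynomialNorm f) → 2 ∣ r)
    parity⇔square {r} factorisation =
      let even⇒square , square⇒even = SquareParity⇔ r (claim r n selfReciprocalOf (≡.cong (n ℕ.+_) (ℕ.+-identityʳ n)) Nf≉0
            factors (irreducible-raw field′ ∘ factorsIrreducible)
            (pointwise λ i → trans (isFactorisation i) (reflexive (≡.cong (λ g → coefficient g i) (≡.sym (product-raw factors))))))
      in proj₁ sameClass ∘ even⇒square , square⇒even ∘ proj₂ sameClass
      where
      open IrreducibleFactorisation factorisation
      open PolynomialRing commutativeRing using (pointwise)

theorem7 :
    ∀ {c ℓ₁ ℓ₂ c′ ℓ₁′ ℓ₂′}
    (F : HeytingField c ℓ₁ ℓ₂) (K : FieldExtension F c′ ℓ₁′ ℓ₂′) →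
    let module F = FieldNotions F
        module K = FieldExtension K
    in
    ∀ (q : ℕ) → OddPrimePower q → HasCardinality F.setoid q →
    ∀ (a : F.Carrier) (a#0 : a F.# F.0#) (n : ℕ) → 1 ≤ n →
    ∀ (√a : K.Carrier) → √a K.* √a K.≈ K.ι a →
    ∀ (f : F.Polynomial) → F.NontrivialSelfReciprocal a n f →
    K.evaluateAt f √a K.* K.evaluateAt f (K.- √a) K.# K.0# →
    ∀ (r : ℕ) → F.IrreducibleFactorisation f r →
    2 ∣ r ⇔
    K.IsSquareInBase
      (K.ι ((F.- F.1#) F.^ n F.* F.zpow a a#0 (+ n ℤ.* (+ n ℤ.- + 2)))
        K.* (K.evaluateAt f √a K.* K.evaluateAt f (K.- √a)))
-- Sizes 0 and 1 are impossible, since F contains zero and an element a apart from it. The remaining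
-- q has the form `suc (suc q₂)` that the results on finite fields expect.
theorem7 F K 0 _ enumeration = contradiction (Inverse.from enumeration (HeytingField.0# F)) λ ()
theorem7 F K 1 _ enumeration a a#0 = contradiction
  (Enumeration.index-injective {F = FieldNotions.commutativeRing F} enumeration (only _ _))
  (FiniteHeytingField.#⇒≉ F a#0)
  where
  only : (i j : Fin 1) → i ≡ j
  only zero zero = ≡.refl
theorem7 F K q@(suc (suc q₂)) (_ , _ , _ , _ , _ , 2∤q) enumeration a a#0 n 1≤n √a √a²≈a f f-sr f#0 r factorisation =
  -- A square root in F is carried to K by ι; conversely, as both sides of the equation in K are
  -- images under ι, injectivity takes it back to F.
  mk⇔ (λ 2∣r → let y , yy≈ = proj₁ iff 2∣r in y , K.trans (RingHom.⟦⟧-cong ι yy≈) values)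
      (λ (y , ιyy≈) → proj₂ iff (y , ι.injective (K.trans ιyy≈ (K.sym values))))
  where
  module F = FieldNotions F
  module K = FieldExtension K
  module ι = RingMorphisms.IsRingMonomorphism K.ι-isRingMonomorphism
  ι : RingHom F.commutativeRing K.commutativeRing
  ι = record { ⟦_⟧ = K.ι ; ⟦⟧-cong = ι.⟦⟧-cong ; +-homo = ι.+-homo ; *-homo = ι.*-homo ; 1#-homo = ι.1#-homo }
  open Quadratic F.commutativeRing a using (polynomialNorm)
  product≈norm : K.evaluateAt f √a K.* K.evaluateAt f (K.- √a) K.≈ K.ι (polynomialNorm f)
  product≈norm = Values.value-product ι a √a √a²≈a f
  Nf≉0 : ¬ polynomialNorm f F.≈ F.0#
  Nf≉0 p = K.#-irrefl (K.trans product≈norm (K.trans (ι.⟦⟧-cong p) ι.0#-homo)) f#0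
  W = (F.- F.1#) F.^ n F.* F.zpow a a#0 (+ n ℤ.* (+ n ℤ.- + 2))
  values : K.ι (W F.* polynomialNorm f) K.≈ K.ι W K.* (K.evaluateAt f √a K.* K.evaluateAt f (K.- √a))
  values = K.trans (ι.*-homo W (polynomialNorm f)) (K.*-congˡ (K.sym product≈norm))
  iff = Main.parity⇔square F q₂ enumeration 2∤q a#0 n 1≤n f-sr Nf≉0 factorisation
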